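{- Let $G$ be a finite graph with $M(G)>0$, and let $\lambda=\lambda(G)$. Then there exists a constant $C=C(G)>0$ such that, for infinitely many positive integers $k$, the tensor power $G^{\otimes k}$ contains a regular subgraph $F_k$ of degree $d_k$ satisfying $$\lambda^k k^{ -C}\le d_k\le \lambda^k .$$ Moreover, $M(F_k)\le M(G)^k$.
   Context: Graphs are finite and simple, with nonempty vertex set. $M(G):=2e(G)$ where $e(G)$ is the number of edges, and $\lambda(G)$ is the spectral radius of the adjacency matrix of $G$. The $k$-th tensor power $G^{\otimes k}$ has vertex set $V(G)^k$, and $(u_1,\dots,u_k)$, $(v_1,\dots,v_k)$ are adjacent if and only if $u_iv_i\in E(G)$ for every $i\in\{1,\dots,k\}$. Subgraphs are not required to be induced or spanning. -}

module Defs where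

open import Level using (0ℓ)
open import Data.Bool.Base using (if_then_else_)
open import Data.Fin.Base using (Fin; fromℕ<; finToFun)
import Data.Fin.Base as Fin
import Data.Fin.Properties as Fin
open import Data.Fin.Subset using (Subset; Nonempty; _∈_; ∣_∣)
import Data.Integer.Base as ℤ
open import Data.List.Base using (allFin; cartesianProduct; filter; length)
open import Data.Nat.Base as ℕ using (ℕ; zero; suc; NonZero; >-nonZero⁻¹)
import Data.Nat.Properties as ℕ
open import Data.Product.Base using (Σ-syntax; ∃-syntax; _×_; _,_; proj₁; proj₂)
open import Data.Rational.Base as ℚ using (ℚ; 0ℚ; 1ℚ; ½; Positive; positive)
import Data.Rational.Properties as ℚ
open import Data.Rational.Solver using (module +-*-Solver)
open import Data.Vec.Base using (tabulate)
open import Data.Vec.Functional using (Vector; foldr)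
open import Relation.Binary.Core using (Rel)
open import Relation.Binary.Definitions using (Decidable; Symmetric; Irreflexive)
open import Relation.Binary.PropositionalEquality
  using (_≡_; refl; sym; trans; cong; subst; subst₂)
open import Relation.Nullary using (¬_; does; _×-dec_)

-- Real numbers: Cauchy sequences of rationals, taken up to the
-- equivalence _≈_ below.

record ℝ : Set where
  constructor mkℝ
  field
    seq    : ℕ → ℚ
    cauchy : ∀ ε → 0ℚ ℚ.< ε →
             ∃[ N ] (∀ m n → N ℕ.≤ m → N ℕ.≤ n → ℚ.∣ seq m ℚ.- seq n ∣ ℚ.≤ ε)

open ℝ public

infix  4 _≈_ _≤_
infixl 6 _+_ _-_
infixl 7 _*_
infixr 8 _^_

_≈_ : ℝ → ℝ → Set
x ≈ y = ∀ ε → 0ℚ ℚ.< ε → ∃[ N ] (∀ n → N ℕ.≤ n → ℚ.∣ seq x n ℚ.- seq y n ∣ ℚ.≤ ε)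

_≤_ : ℝ → ℝ → Set
x ≤ y = ∀ ε → 0ℚ ℚ.< ε → ∃[ N ] (∀ n → N ℕ.≤ n → seq x n ℚ.≤ seq y n ℚ.+ ε)

fromℚ : ℚ → ℝ
fromℚ q = mkℝ (λ _ → q) λ ε 0<ε → 0 , λ _ _ _ _ →
  ℚ.≤-trans (ℚ.≤-reflexive (cong ℚ.∣_∣ (ℚ.+-inverseʳ q))) (ℚ.<⇒≤ 0<ε)

fromℕ : ℕ → ℝ
fromℕ n = fromℚ (ℤ.+ n ℚ./ 1)

0ℝ 1ℝ : ℝ
0ℝ = fromℚ 0ℚ
1ℝ = fromℚ 1ℚ

_+_ : ℝ → ℝ → ℝ
x + y = mkℝ (λ n → seq x n ℚ.+ seq y n) c
  where
  c : ∀ ε → 0ℚ ℚ.< ε → ∃[ N ] (∀ m n → N ℕ.≤ m → N ℕ.≤ n →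
      ℚ.∣ (seq x m ℚ.+ seq y m) ℚ.- (seq x n ℚ.+ seq y n) ∣ ℚ.≤ ε)
  c ε 0<ε = M ℕ.⊔ N , λ m n p q →
      subst₂ (λ a b → ℚ.∣ a ∣ ℚ.≤ b) (sym (rearrange (seq x m) (seq y m) (seq x n) (seq y n))) half+half
        (ℚ.≤-trans (ℚ.∣p+q∣≤∣p∣+∣q∣ (seq x m ℚ.- seq x n) (seq y m ℚ.- seq y n))
          (ℚ.+-mono-≤
            (proj₂ cx m n (ℕ.≤-trans (ℕ.m≤m⊔n M N) p) (ℕ.≤-trans (ℕ.m≤m⊔n M N) q))
            (proj₂ cy m n (ℕ.≤-trans (ℕ.m≤n⊔m M N) p) (ℕ.≤-trans (ℕ.m≤n⊔m M N) q))))
    where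
    δ = ½ ℚ.* ε
    0<δ : 0ℚ ℚ.< δ
    0<δ = ℚ.positive⁻¹ δ {{ℚ.pos*pos⇒pos ½ ε {{positive 0<ε}}}}
    cx = cauchy x δ 0<δ
    cy = cauchy y δ 0<δ
    M = proj₁ cx
    N = proj₁ cy
    half+half : δ ℚ.+ δ ≡ ε
    half+half = trans (sym (ℚ.*-distribʳ-+ ε ½ ½)) (ℚ.*-identityˡ ε)
    rearrange : ∀ a b a′ b′ →
      (a ℚ.+ b) ℚ.- (a′ ℚ.+ b′) ≡ (a ℚ.- a′) ℚ.+ (b ℚ.- b′)
    rearrange = solve 4 (λ a b a′ b′ →
      (a :+ b) :- (a′ :+ b′) := (a :- a′) :+ (b :- b′)) refl
      where open +-*-Solver

-_ : ℝ → ℝ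
- x = mkℝ (λ n → ℚ.- seq x n) λ ε 0<ε → proj₁ (cauchy x ε 0<ε) , λ m n p q →
  subst (ℚ._≤ ε)
    (trans (sym (ℚ.∣-p∣≡∣p∣ (seq x m ℚ.- seq x n)))
           (cong ℚ.∣_∣ (ℚ.neg-distrib-+ (seq x m) (ℚ.- seq x n))))
    (proj₂ (cauchy x ε 0<ε) m n p q)

_-_ : ℝ → ℝ → ℝ
x - y = x + (- y)

eventually-bounded : ∀ x → Σ[ B ∈ ℚ ] Positive B × ∃[ N ] (∀ n → N ℕ.≤ n → ℚ.∣ seq x n ∣ ℚ.≤ B)
eventually-bounded x = B , B-positive , N , bound
  where
  N = proj₁ (cauchy x 1ℚ (ℚ.positive⁻¹ 1ℚ))
  B = 1ℚ ℚ.+ ℚ.∣ seq x N ∣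
  B-positive : Positive B
  B-positive = ℚ.pos+nonNeg⇒pos 1ℚ ℚ.∣ seq x N ∣ {{ℚ.nonNegative (ℚ.0≤∣p∣ (seq x N))}}
  cancel : ∀ a b → (a ℚ.- b) ℚ.+ b ≡ a
  cancel = solve 2 (λ a b → (a :- b) :+ b := a) refl
    where open +-*-Solver
  bound : ∀ n → N ℕ.≤ n → ℚ.∣ seq x n ∣ ℚ.≤ B
  bound n p = subst (λ a → ℚ.∣ a ∣ ℚ.≤ B) (cancel (seq x n) (seq x N))
    (ℚ.≤-trans (ℚ.∣p+q∣≤∣p∣+∣q∣ (seq x n ℚ.- seq x N) (seq x N))
      (ℚ.+-monoˡ-≤ ℚ.∣ seq x N ∣
        (proj₂ (cauchy x 1ℚ (ℚ.positive⁻¹ 1ℚ)) n N p ℕ.≤-refl)))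

_*_ : ℝ → ℝ → ℝ
x * y = mkℝ (λ n → seq x n ℚ.* seq y n) c
  where
  bx = eventually-bounded x
  by = eventually-bounded y
  B = proj₁ bx
  D = proj₁ by
  instance
    B⁺ : Positive B
    B⁺ = proj₁ (proj₂ bx)
    D⁺ : Positive D
    D⁺ = proj₁ (proj₂ by)
    S⁺ : Positive (B ℚ.+ D)
    S⁺ = ℚ.pos+pos⇒pos B D
    S≢0 : ℚ.NonZero (B ℚ.+ D)
    S≢0 = ℚ.pos⇒nonZero (B ℚ.+ D)
  c : ∀ ε → 0ℚ ℚ.< ε → ∃[ N ] (∀ m n → N ℕ.≤ m → N ℕ.≤ n →
      ℚ.∣ (seq x m ℚ.* seq y m) ℚ.- (seq x n ℚ.* seq y n) ∣ ℚ.≤ ε)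
  c ε 0<ε = N , λ m n p q →
      subst₂ (λ a b → ℚ.∣ a ∣ ℚ.≤ b) (sym (rearrange (seq x m) (seq y m) (seq x n) (seq y n))) total
        (ℚ.≤-trans
          (ℚ.∣p+q∣≤∣p∣+∣q∣ (seq x m ℚ.* (seq y m ℚ.- seq y n)) ((seq x m ℚ.- seq x n) ℚ.* seq y n))
          (ℚ.+-mono-≤
            (∣*∣-mono (seq x m) (seq y m ℚ.- seq y n)
              (proj₂ (proj₂ (proj₂ bx)) m (ℕ.≤-trans N₁≤N p))
              (proj₂ cy m n (ℕ.≤-trans N₄≤N p) (ℕ.≤-trans N₄≤N q)))
            (∣*∣-mono (seq x m ℚ.- seq x n) (seq y n)
              (proj₂ cx m n (ℕ.≤-trans N₃≤N p) (ℕ.≤-trans N₃≤N q))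
              (proj₂ (proj₂ (proj₂ by)) n (ℕ.≤-trans N₂≤N q)))))
    where
    δ = ε ℚ.* ℚ.1/ (B ℚ.+ D)
    0<δ : 0ℚ ℚ.< δ
    0<δ = ℚ.positive⁻¹ δ {{ℚ.pos*pos⇒pos ε {{positive 0<ε}} _ {{ℚ.1/pos⇒pos (B ℚ.+ D)}}}}
    cx = cauchy x δ 0<δ
    cy = cauchy y δ 0<δ
    N₁ = proj₁ (proj₂ (proj₂ bx))
    N₂ = proj₁ (proj₂ (proj₂ by))
    N₃ = proj₁ cx
    N₄ = proj₁ cy
    N = (N₁ ℕ.⊔ N₂) ℕ.⊔ (N₃ ℕ.⊔ N₄)
    N₁≤N : N₁ ℕ.≤ N
    N₁≤N = ℕ.≤-trans (ℕ.m≤m⊔n N₁ N₂) (ℕ.m≤m⊔n (N₁ ℕ.⊔ N₂) (N₃ ℕ.⊔ N₄))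
    N₂≤N : N₂ ℕ.≤ N
    N₂≤N = ℕ.≤-trans (ℕ.m≤n⊔m N₁ N₂) (ℕ.m≤m⊔n (N₁ ℕ.⊔ N₂) (N₃ ℕ.⊔ N₄))
    N₃≤N : N₃ ℕ.≤ N
    N₃≤N = ℕ.≤-trans (ℕ.m≤m⊔n N₃ N₄) (ℕ.m≤n⊔m (N₁ ℕ.⊔ N₂) (N₃ ℕ.⊔ N₄))
    N₄≤N : N₄ ℕ.≤ N
    N₄≤N = ℕ.≤-trans (ℕ.m≤n⊔m N₃ N₄) (ℕ.m≤n⊔m (N₁ ℕ.⊔ N₂) (N₃ ℕ.⊔ N₄))
    ∣*∣-mono : ∀ a b {r s} → ℚ.∣ a ∣ ℚ.≤ r → ℚ.∣ b ∣ ℚ.≤ s → ℚ.∣ a ℚ.* b ∣ ℚ.≤ r ℚ.* s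
    ∣*∣-mono a b {r} {s} p q = ℚ.≤-trans (ℚ.≤-reflexive (ℚ.∣p*q∣≡∣p∣*∣q∣ a b))
      (ℚ.≤-trans
        (ℚ.*-monoˡ-≤-nonNeg ℚ.∣ a ∣ {{ℚ.nonNegative (ℚ.0≤∣p∣ a)}} q)
        (ℚ.*-monoʳ-≤-nonNeg s {{ℚ.nonNegative (ℚ.≤-trans (ℚ.0≤∣p∣ b) q)}} p))
    rearrange : ∀ a b a′ b′ →
      (a ℚ.* b) ℚ.- (a′ ℚ.* b′) ≡ (a ℚ.* (b ℚ.- b′)) ℚ.+ ((a ℚ.- a′) ℚ.* b′)
    rearrange = solve 4 (λ a b a′ b′ →
      (a :* b) :- (a′ :* b′) := (a :* (b :- b′)) :+ ((a :- a′) :* b′)) refl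
      where open +-*-Solver
    collect : ∀ b d e → (b ℚ.* e) ℚ.+ (e ℚ.* d) ≡ e ℚ.* (b ℚ.+ d)
    collect = solve 3 (λ b d e → (b :* e) :+ (e :* d) := e :* (b :+ d)) refl
      where open +-*-Solver
    total : (B ℚ.* δ) ℚ.+ (δ ℚ.* D) ≡ ε
    total = trans (collect B D δ) (trans (ℚ.*-assoc ε _ (B ℚ.+ D))
      (trans (cong (ε ℚ.*_) (ℚ.*-inverseˡ (B ℚ.+ D))) (ℚ.*-identityʳ ε)))

_^_ : ℝ → ℕ → ℝ
x ^ zero  = 1ℝ
x ^ suc n = x * x ^ n

-- k ^⁻ C is the real number k^(-C).
_^⁻_ : (k : ℕ) .{{_ : NonZero k}} → ℕ → ℝ
k ^⁻ C = fromℚ ((ℤ.+ 1 ℚ./ (k ℕ.^ C)) {{ℕ.m^n≢0 k C}})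

record ℂ : Set where
  constructor _+i_
  field
    re im : ℝ

open ℂ public

_≈ᶜ_ : ℂ → ℂ → Set
z ≈ᶜ w = re z ≈ re w × im z ≈ im w

0ᶜ 1ᶜ : ℂ
0ᶜ = 0ℝ +i 0ℝ
1ᶜ = 1ℝ +i 0ℝ

_+ᶜ_ _*ᶜ_ : ℂ → ℂ → ℂ
z +ᶜ w = (re z + re w) +i (im z + im w)
z *ᶜ w = (re z * re w - im z * im w) +i (re z * im w + im z * re w)

-- The modulus as a relation, avoiding a square root operation on ℝ.
HasModulus : ℂ → ℝ → Set
HasModulus z r = 0ℝ ≤ r × r * r ≈ re z * re z + im z * im z

Matrix : ℕ → Set
Matrix n = Fin n → Fin n → ℂ

_·_ : ∀ {n} → Matrix n → Vector ℂ n → Vector ℂ n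
(A · z) u = foldr _+ᶜ_ 0ᶜ (λ v → A u v *ᶜ z v)

IsEigenvalue : ∀ {n} → Matrix n → ℂ → Set
IsEigenvalue {n} A μ = Σ[ z ∈ Vector ℂ n ]
  ¬ (∀ u → z u ≈ᶜ 0ᶜ) × (∀ u → (A · z) u ≈ᶜ (μ *ᶜ z u))

-- r is the largest modulus of an eigenvalue of A.  This determines r up to _≈_.
IsSpectralRadius : ∀ {n} → Matrix n → ℝ → Set
IsSpectralRadius A r =
  (∃[ μ ] IsEigenvalue A μ × HasModulus μ r) ×
  (∀ μ s → IsEigenvalue A μ → HasModulus μ s → s ≤ r)

record Graph : Set₁ where
  field
    order    : ℕ
    nonempty : NonZero order
    Adj      : Rel (Fin order) 0ℓ
    adj?     : Decidable Adj
    symm     : Symmetric Adj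
    irrefl   : Irreflexive _≡_ Adj

open Graph public

-- Subgraphs need be neither induced nor spanning.
record Subgraph (H : Graph) : Set₁ where
  field
    vertices  : Subset (order H)
    inhabited : Nonempty vertices
    Edge      : Rel (Fin (order H)) 0ℓ
    edge?     : Decidable Edge
    edge-symm : Symmetric Edge
    edge⇒adj  : ∀ {u v} → Edge u v → Adj H u v
    edge⇒∈    : ∀ {u v} → Edge u v → u ∈ vertices × v ∈ vertices

open Subgraph public

-- Each undirected edge is counted once, as the pair (u , v) with u < v.
countEdges : ∀ {n} {E : Rel (Fin n) 0ℓ} → Decidable E → ℕ
countEdges {n} E? = length
  (filter (λ (u , v) → (u Fin.<? v) ×-dec E? u v) (cartesianProduct (allFin n) (allFin n)))

M : Graph → ℕ
M G = 2 ℕ.* countEdges (adj? G)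

Mₛ : ∀ {H} → Subgraph H → ℕ
Mₛ F = 2 ℕ.* countEdges (edge? F)

degree : ∀ {H} → Subgraph H → Fin (order H) → ℕ
degree F v = ∣ tabulate (λ w → does (edge? F v w)) ∣

IsRegular : ∀ {H} → Subgraph H → ℕ → Set
IsRegular F d = ∀ v → v ∈ vertices F → degree F v ≡ d

adjacencyMatrix : (G : Graph) → Matrix (order G)
adjacencyMatrix G u v = if does (adj? G u v) then 1ᶜ else 0ᶜ

-- The vertex set V(G)^k is represented by Fin (order G ^ k): finToFun and
-- funToFin are mutually inverse, and finToFun u i is the i-th coordinate of u.
-- For k = 0 the definition would produce a loop, whence NonZero k.
tensorPower : Graph → (k : ℕ) .{{_ : NonZero k}} → Graph
tensorPower G k = record
  { order    = order G ℕ.^ k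
  ; nonempty = ℕ.m^n≢0 (order G) k {{nonempty G}}
  ; Adj      = λ u v → ∀ i → Adj G (coord u i) (coord v i)
  ; adj?     = λ u v → Fin.all? (λ i → adj? G (coord u i) (coord v i))
  ; symm     = λ uv i → symm G (uv i)
  ; irrefl   = λ { refl uu → irrefl G refl (uu (fromℕ< (>-nonZero⁻¹ k))) }
  }
  where
  coord : Fin (order G ℕ.^ k) → Fin k → Fin (order G)
  coord = finToFun

InfinitelyMany⁺ : ∀ {ℓ} → ((k : ℕ) .{{_ : NonZero k}} → Set ℓ) → Set ℓ
InfinitelyMany⁺ P = ∀ N → Σ[ k ∈ ℕ ] N ℕ.≤ k × Σ[ k≢0 ∈ NonZero k ] P k {{k≢0}}

{-# OPTIONS --safe #-}
-- Call two vertices of G^⊗k of the same type if every vertex of G occurs equally often as a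
-- coordinate.  There are at most P = (k + 1)^n types, and all vertices of one type have the same
-- number of neighbours of any given type.  If a vertex of type σ has D neighbours of type τ and a
-- vertex of type τ has D′ neighbours of type σ, then the vertices of G^⊗2k of type (σ , τ) or
-- (τ , σ) span a regular graph of degree D D′.  The spectral radius of G^⊗k is λ^k; estimating
-- ‖A ω‖² block by block, for the tensor power ω of an approximate eigenvector, gives a pair of
-- types with λ^2k ≤ P⁴ D D′.
--
-- Conversely, let F be a d-regular subgraph of G^⊗K.  For each vertex u of F the tensor product
-- of Perron eigenvectors of the components containing the coordinates of u is an eigenvector ψ ≥ 0
-- with ψ(u) > 0 and eigenvalue at most λ^K.  Summing (A ψ)(v) ≤ λ^K ψ(v) over F yields d ≤ λ^K.
-- The hypothesis on λ only speaks of given eigenvalues, so Perron eigenvectors have to be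
-- constructed, with an explicit rate of convergence, as Cauchy sequences.
module Submission where

open import Algebra using (CommutativeRing)
open import Data.Bool.Base using (Bool; true; false; if_then_else_)
open import Data.Fin.Base as Fin using (Fin; zero; suc)
import Data.Fin.Properties as Fin
import Data.Integer.Base as ℤ
import Data.Integer.Properties as ℤ
open import Data.Nat.Base as ℕ using (ℕ; zero; suc; NonZero)
import Data.Nat.Properties as ℕ
open import Data.Product.Base using (Σ-syntax; ∃-syntax; _×_; _,_; proj₁; proj₂)
open import Data.Rational.Base using (ℚ)
import Data.Rational.Properties as ℚ
import Data.Rational.Unnormalised.Base as ℚᵘ
import Data.Rational.Unnormalised.Properties as ℚᵘ
open import Data.Sum.Base using (_⊎_; inj₁; inj₂)
open import Function.Base using (_∘_; id)
open import Level using (Level; 0ℓ)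
open import Relation.Binary.Core using (Rel)
open import Relation.Binary.Definitions using (Decidable; Symmetric; tri<; tri≈; tri>)
open import Relation.Binary.PropositionalEquality
open import Relation.Nullary using (¬_; Dec; yes; no; does; _×-dec_; _⊎-dec_; ¬?; contradiction)
open import Relation.Nullary.Decidable using (dec-true; decidable-stable)
open import Tactic.RingSolver using (solve-∀)

-- The combinatorial estimates are inequalities between natural numbers. They are fed with a
-- rational slightly above or below λ or λ², denominators are cleared, and continuity of powers
-- leads back to λ at the end. The eigenvector in the hypothesis is merely known not to be zero; no
-- coordinate is known to be apart from zero. The lower bound is therefore proved by contradiction
-- on a decidable inequality in ℕ: if the degree were too small, |A f|² ≤ r |f|² would hold for all
-- rational f and some r < λ², and the eigenvector would vanish. Since |A z|² = |μ|² |z|² for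
-- complex μ as well, nothing about μ being real, or about its sign, has to be shown. For the upper
-- bound G may be disconnected, and a Perron vector vanishes outside its component. Hence there is
-- one vector for every start vertex, positive there, and a single vertex of F decides which of them
-- are multiplied. Irrationality of λ is met by using a late iterate in place of the Perron vector:
-- it is rational and satisfies A w ≤ s w exactly, for a rational s above λ.

module Combinatorics where

  open import Data.Fin.Base using (finToFun; funToFin; combine; toℕ; fromℕ<; _↑ˡ_; _↑ʳ_)
  open import Data.Fin.Subset using (Subset; ∣_∣; _∈_)
  open import Data.Fin.Subset.Properties using (_∈?_)
  open import Data.List.Base as List using (filter; length; cartesianProduct; allFin)
  import Data.List.Properties as List
  open import Data.Nat.Base
  open import Data.Nat.Properties
  open import Data.Nat.Solver using (module +-*-Solver)
  open import Data.Vec.Base using (Vec; []; _∷_; _++_; tabulate; lookup; take; drop)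
  open import Data.Vec.Properties
    using (tabulate-cong; tabulate∘lookup; take++drop≡id; lookup∘tabulate; []=⇒lookup; lookup⇒[]=; ++-injective)
  open import Defs using (Graph; order; Adj; adj?; symm; irrefl; nonempty; Subgraph; vertices; inhabited; edge?;
    edge-symm; edge⇒adj; edge⇒∈; countEdges; M; Mₛ; degree; IsRegular; tensorPower)
  open import Algebra.Properties.Semiring.Sum +-*-semiring
    using (sum; sum-syntax; sum-cong-≗; sum-replicate-zero; ∑-comm; ∑-distrib-+; *-distribˡ-sum; *-distribʳ-sum)

  private variable
    m n K : ℕ

  -- Indicators and finite sums of natural numbers.

  ⟦_⟧ : ∀ {p} {P : Set p} → Dec P → ℕ
  ⟦ d ⟧ = if does d then 1 else 0

  ⟦⟧-mono : ∀ {p q} {P : Set p} {Q : Set q} (d : Dec P) (e : Dec Q) → (P → Q) → ⟦ d ⟧ ≤ ⟦ e ⟧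
  ⟦⟧-mono (yes x) (yes y) f = ≤-refl
  ⟦⟧-mono (yes x) (no ¬y) f = contradiction (f x) ¬y
  ⟦⟧-mono (no _)  _       f = z≤n

  ⟦⟧-cong : ∀ {p q} {P : Set p} {Q : Set q} (d : Dec P) (e : Dec Q) → (P → Q) → (Q → P) → ⟦ d ⟧ ≡ ⟦ e ⟧
  ⟦⟧-cong d e f g = ≤-antisym (⟦⟧-mono d e f) (⟦⟧-mono e d g)

  ⟦×⟧ : ∀ {p q} {P : Set p} {Q : Set q} (d : Dec P) (e : Dec Q) → ⟦ d ×-dec e ⟧ ≡ ⟦ d ⟧ * ⟦ e ⟧
  ⟦×⟧ (yes _) (yes _) = refl
  ⟦×⟧ (yes _) (no _)  = refl
  ⟦×⟧ (no _)  _       = refl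

  module _ {p : Level} {P : Set p} where
    ⟦yes⟧ : (d : Dec P) → P → ⟦ d ⟧ ≡ 1
    ⟦yes⟧ (yes _) _ = refl
    ⟦yes⟧ (no ¬x) x = contradiction x ¬x

    ⟦⟧≤1 : (d : Dec P) → ⟦ d ⟧ ≤ 1
    ⟦⟧≤1 (yes _) = ≤-refl
    ⟦⟧≤1 (no _)  = z≤n

    ⟦no⟧ : (d : Dec P) → ¬ P → ⟦ d ⟧ ≡ 0
    ⟦no⟧ (yes x) ¬x = contradiction x ¬x
    ⟦no⟧ (no _)  _  = refl

    ⟦⟧*-cong : (d : Dec P) {a b : ℕ} → (P → a ≡ b) → ⟦ d ⟧ * a ≡ ⟦ d ⟧ * b
    ⟦⟧*-cong (yes x) f = cong (1 *_) (f x)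
    ⟦⟧*-cong (no _)  f = refl

    ⟦⟧*≤ : (d : Dec P) (a : ℕ) → ⟦ d ⟧ * a ≤ a
    ⟦⟧*≤ (yes x) a = ≤-reflexive (*-identityˡ a)
    ⟦⟧*≤ (no _)  a = z≤n

  sum-mono : {f g : Fin n → ℕ} → (∀ i → f i ≤ g i) → sum f ≤ sum g
  sum-mono {zero}  f≤g = z≤n
  sum-mono {suc n} f≤g = +-mono-≤ (f≤g zero) (sum-mono (f≤g ∘ suc))

  term≤sum : (f : Fin n → ℕ) (i : Fin n) → f i ≤ sum f
  term≤sum f zero    = m≤m+n _ _
  term≤sum f (suc i) = ≤-trans (term≤sum (f ∘ suc) i) (m≤n+m _ (f zero))

  sum-const : ∀ n c → sum {n} (λ _ → c) ≡ n * c
  sum-const zero    c = refl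
  sum-const (suc n) c = cong (c +_) (sum-const n c)

  sum≤const : {f : Fin n → ℕ} {c : ℕ} → (∀ i → f i ≤ c) → sum f ≤ n * c
  sum≤const {n} {c = c} f≤c = ≤-trans (sum-mono f≤c) (≤-reflexive (sum-const n c))

  sum-zero : {f : Fin n → ℕ} → (∀ i → f i ≡ 0) → sum f ≡ 0
  sum-zero {n} f≡0 = trans (sum-cong-≗ f≡0) (sum-replicate-zero n)

  sum-⟦≟⟧ : (i : Fin n) → ∑[ j < n ] ⟦ i Fin.≟ j ⟧ ≡ 1
  sum-⟦≟⟧ {suc n} zero = cong suc (sum-zero {n} λ j → refl)
  sum-⟦≟⟧ {suc n} (suc i) = trans
    (sum-cong-≗ λ j → ⟦⟧-cong (suc i Fin.≟ suc j) (i Fin.≟ j) (λ { refl → refl }) (λ { refl → refl }))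
    (sum-⟦≟⟧ i)

  ∃argmax : .{{NonZero n}} → (f : Fin n → ℕ) → ∃[ i ] (∀ j → f j ≤ f i)
  ∃argmax {suc zero}    f = zero , λ { zero → ≤-refl }
  ∃argmax {suc (suc n)} f with ∃argmax (f ∘ suc)
  ... | i , max with ≤-total (f zero) (f (suc i))
  ...   | inj₁ p = suc i , λ { zero → p ; (suc j) → max j }
  ...   | inj₂ p = zero  , λ { zero → ≤-refl ; (suc j) → ≤-trans (max j) p }

  -- Cauchy-Schwarz with `n * n` in place of `n`, by comparison with a largest term. The loss is
  -- harmless: the sum will run over the types, whose number is polynomial in the exponent.
  sum²≤ : (f : Fin n → ℕ) → sum f * sum f ≤ n * n * ∑[ i < n ] (f i * f i)
  sum²≤ {zero}  f = z≤n
  sum²≤ {n@(suc _)} f with ∃argmax f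
  ... | i , max = begin
    sum f * sum f             ≤⟨ *-mono-≤ (sum≤const max) (sum≤const max) ⟩
    n * f i * (n * f i)       ≡⟨ solve 2 (λ n x → n :* x :* (n :* x) := n :* n :* (x :* x)) refl n (f i) ⟩
    n * n * (f i * f i)       ≤⟨ *-monoʳ-≤ (n * n) (term≤sum (λ i → f i * f i) i) ⟩
    n * n * ∑[ i < n ] (f i * f i) ∎
    where open ≤-Reasoning
          open +-*-Solver

  sum-↑ : ∀ m n (f : Fin (m + n) → ℕ) → sum f ≡ ∑[ i < m ] f (i ↑ˡ n) + ∑[ j < n ] f (m ↑ʳ j)
  sum-↑ zero    n f = refl
  sum-↑ (suc m) n f = trans (cong (f zero +_) (sum-↑ m n (f ∘ suc))) (sym (+-assoc (f zero) _ _))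

  sum-combine : ∀ m n (f : Fin (m * n) → ℕ) → sum f ≡ ∑[ i < m ] ∑[ j < n ] f (combine i j)
  sum-combine zero    n f = refl
  sum-combine (suc m) n f = trans (sum-↑ n (m * n) f) (cong (∑[ j < n ] f (j ↑ˡ (m * n)) +_) (sum-combine m n (f ∘ (n ↑ʳ_))))

  -- Sums over vertices of a tensor power, product vectors and tensor matrices.

  toVec : Fin (n ^ K) → Vec (Fin n) K
  toVec u = tabulate (finToFun u)

  fromVec : Vec (Fin n) K → Fin (n ^ K)
  fromVec x = funToFin (lookup x)

  toVec-fromVec : (x : Vec (Fin n) K) → toVec (fromVec x) ≡ x
  toVec-fromVec x = trans (tabulate-cong (Fin.finToFun-funToFin (lookup x))) (tabulate∘lookup x)

  toVec-combine : (a : Fin n) (u : Fin (n ^ K)) → toVec {n} {suc K} (combine a u) ≡ a ∷ toVec u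
  toVec-combine {n} {K} a u = cong₂ _∷_ (cong proj₁ (Fin.remQuot-combine {n} a u))
    (tabulate-cong λ i → cong (λ v → finToFun (proj₂ v) i) (Fin.remQuot-combine {n} a u))

  opaque
    -- Summing over vectors rather than over `Fin (n ^ K)` lets sums split by recursion on the
    -- coordinates; being opaque, they do not unfold to arithmetic on indices.
    ∑ⱽ : (Vec (Fin n) K → ℕ) → ℕ
    ∑ⱽ {n} {K} f = ∑[ u < n ^ K ] f (toVec u)

  module _ {n K : ℕ} where
    opaque
      unfolding ∑ⱽ

      ∑ⱽ-cong : {f g : Vec (Fin n) K → ℕ} → f ≗ g → ∑ⱽ f ≡ ∑ⱽ g
      ∑ⱽ-cong f≗g = sum-cong-≗ {n ^ K} (λ u → f≗g (toVec u))

      ∑ⱽ-mono : {f g : Vec (Fin n) K → ℕ} → (∀ x → f x ≤ g x) → ∑ⱽ f ≤ ∑ⱽ g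
      ∑ⱽ-mono f≤g = sum-mono {n ^ K} (λ u → f≤g (toVec u))

      ∑ⱽ-comm : {L : ℕ} (f : Vec (Fin n) K → Vec (Fin n) L → ℕ) →
                ∑ⱽ (λ x → ∑ⱽ (f x)) ≡ ∑ⱽ (λ y → ∑ⱽ (λ x → f x y))
      ∑ⱽ-comm {L} f = ∑-comm {n ^ K} {n ^ L} (λ u v → f (toVec u) (toVec v))

      ∑ⱽ-sum-comm : {m : ℕ} (f : Vec (Fin n) K → Fin m → ℕ) →
                ∑ⱽ (λ x → sum (f x)) ≡ ∑[ i < m ] ∑ⱽ (λ x → f x i)
      ∑ⱽ-sum-comm {m} f = ∑-comm {n ^ K} {m} (λ u i → f (toVec u) i)

      ∑ⱽ-*ˡ : ∀ c (f : Vec (Fin n) K → ℕ) → ∑ⱽ (λ x → c * f x) ≡ c * ∑ⱽ f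
      ∑ⱽ-*ˡ c f = sym (*-distribˡ-sum {n ^ K} c (f ∘ toVec))

      ∑ⱽ-*ʳ : ∀ (f : Vec (Fin n) K → ℕ) c → ∑ⱽ (λ x → f x * c) ≡ ∑ⱽ f * c
      ∑ⱽ-*ʳ f c = sym (*-distribʳ-sum {n ^ K} c (f ∘ toVec))

      ∑ⱽ-zero : {f : Vec (Fin n) K → ℕ} → (∀ x → f x ≡ 0) → ∑ⱽ f ≡ 0
      ∑ⱽ-zero f≡0 = sum-zero {n ^ K} (λ u → f≡0 (toVec u))

      ∑ⱽ-∷ : (f : Vec (Fin n) (suc K) → ℕ) → ∑ⱽ f ≡ ∑[ a < n ] ∑ⱽ (λ x → f (a ∷ x))
      ∑ⱽ-∷ f = trans (sum-combine n (n ^ K) (f ∘ toVec))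
        (sum-cong-≗ λ a → sum-cong-≗ {n ^ K} λ u → cong f (toVec-combine a u))

      ∑ⱽ-[] : (f : Vec (Fin n) 0 → ℕ) → ∑ⱽ f ≡ f []
      ∑ⱽ-[] f = +-identityʳ (f [])

      ∑ⱽ-toVec : (f : Vec (Fin n) K → ℕ) → ∑ⱽ f ≡ ∑[ u < n ^ K ] f (toVec u)
      ∑ⱽ-toVec f = refl

    ∑ⱽ-∷-* : (f : Fin n → ℕ) (g : Vec (Fin n) K → ℕ) (h : Vec (Fin n) (suc K) → ℕ) →
             (∀ a x → h (a ∷ x) ≡ f a * g x) → ∑ⱽ h ≡ sum f * ∑ⱽ g
    ∑ⱽ-∷-* f g h eq = begin
      ∑ⱽ h                               ≡⟨ ∑ⱽ-∷ h ⟩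
      ∑[ a < n ] ∑ⱽ (λ x → h (a ∷ x))    ≡⟨ sum-cong-≗ (λ a → ∑ⱽ-cong (eq a)) ⟩
      ∑[ a < n ] ∑ⱽ (λ x → f a * g x)    ≡⟨ sum-cong-≗ (λ a → ∑ⱽ-*ˡ (f a) g) ⟩
      ∑[ a < n ] (f a * ∑ⱽ g)            ≡⟨ *-distribʳ-sum (∑ⱽ g) f ⟨
      sum f * ∑ⱽ g                       ∎
      where open ≡-Reasoning

  ∑ⱽ-++ : ∀ j {k} (f : Vec (Fin n) (j + k) → ℕ) → ∑ⱽ f ≡ ∑ⱽ {K = j} (λ x → ∑ⱽ {K = k} (λ y → f (x ++ y)))
  ∑ⱽ-++ {n} zero {k} f = sym (∑ⱽ-[] {n} {k} (λ x → ∑ⱽ (λ y → f (x ++ y))))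
  ∑ⱽ-++ {n} (suc j) {k} f = begin
    ∑ⱽ f                                                          ≡⟨ ∑ⱽ-∷ f ⟩
    ∑[ a < n ] ∑ⱽ (λ z → f (a ∷ z))                               ≡⟨ sum-cong-≗ (λ a → ∑ⱽ-++ j (λ z → f (a ∷ z))) ⟩
    ∑[ a < n ] ∑ⱽ {K = j} (λ x → ∑ⱽ {K = k} (λ y → f (a ∷ x ++ y))) ≡⟨ ∑ⱽ-∷ {n} {j} (λ x → ∑ⱽ (λ y → f (x ++ y))) ⟨
    ∑ⱽ {K = suc j} (λ x → ∑ⱽ {K = k} (λ y → f (x ++ y)))          ∎
    where open ≡-Reasoning

  ∏ : (Fin n → ℕ) → Vec (Fin n) K → ℕ
  ∏ f []      = 1
  ∏ f (a ∷ x) = f a * ∏ f x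

  infix 9 _⊗
  -- Serves two purposes: for an adjacency matrix it is that of the tensor power, and for a family
  -- `w` of weights the row `(w ⊗) u` is the tensor product of the vectors `w a` over the
  -- coordinates `a` of `u`.
  _⊗ : (Fin m → Fin n → ℕ) → Vec (Fin m) K → Vec (Fin n) K → ℕ
  (A ⊗) []      []      = 1
  (A ⊗) (a ∷ x) (b ∷ y) = A a b * (A ⊗) x y

  ∑ⱽ-∏ : ∀ K (f : Fin n → ℕ) → ∑ⱽ {K = K} (∏ f) ≡ sum f ^ K
  ∑ⱽ-∏ zero    f = ∑ⱽ-[] {K = 0} (∏ f)
  ∑ⱽ-∏ (suc K) f = trans (∑ⱽ-∷-* {K = K} f (∏ f) (∏ f) (λ _ _ → refl)) (cong (sum f *_) (∑ⱽ-∏ K f))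

  ∏-* : (f g : Fin n → ℕ) (x : Vec (Fin n) K) → ∏ (λ a → f a * g a) x ≡ ∏ f x * ∏ g x
  ∏-* f g []      = refl
  ∏-* f g (a ∷ x) = trans (cong (f a * g a *_) (∏-* f g x))
    (solve 4 (λ a b c d → a :* b :* (c :* d) := a :* c :* (b :* d)) refl (f a) (g a) (∏ f x) (∏ g x))
    where open +-*-Solver

  ∏-1 : (x : Vec (Fin n) K) → ∏ (λ _ → 1) x ≡ 1
  ∏-1 []      = refl
  ∏-1 (a ∷ x) = trans (*-identityˡ _) (∏-1 x)

  *-interchange : ∀ a b c d → a * b * (c * d) ≡ a * c * (b * d)
  *-interchange = solve 4 (λ a b c d → a :* b :* (c :* d) := a :* c :* (b :* d)) refl
    where open +-*-Solver

  *-^-distrib : ∀ m n k → (m * n) ^ k ≡ m ^ k * n ^ k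
  *-^-distrib m n zero    = refl
  *-^-distrib m n (suc k) = trans (cong (m * n *_) (*-^-distrib m n k)) (*-interchange m n (m ^ k) (n ^ k))

  ∑ⱽ-⊗-∏ : (A : Fin m → Fin n → ℕ) (f : Fin n → ℕ) (x : Vec (Fin m) K) →
           ∑ⱽ (λ y → (A ⊗) x y * ∏ f y) ≡ ∏ (λ a → ∑[ b < n ] (A a b * f b)) x
  ∑ⱽ-⊗-∏ {n = n} A f [] = ∑ⱽ-[] {n} {0} (λ y → (A ⊗) [] y * ∏ f y)
  ∑ⱽ-⊗-∏ {n = n} A f (a ∷ x) = trans
    (∑ⱽ-∷-* (λ b → A a b * f b) (λ y → (A ⊗) x y * ∏ f y) (λ y → (A ⊗) (a ∷ x) y * ∏ f y)
      (λ b y → *-interchange (A a b) ((A ⊗) x y) (f b) (∏ f y)))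
    (cong (∑[ b < n ] (A a b * f b) *_) (∑ⱽ-⊗-∏ A f x))

  ⊗-++ : ∀ {j k} (A : Fin m → Fin n → ℕ) (x : Vec (Fin m) j) x′ {y : Vec (Fin m) k} {y′} →
         (A ⊗) (x ++ y) (x′ ++ y′) ≡ (A ⊗) x x′ * (A ⊗) y y′
  ⊗-++ A []      []        = sym (*-identityˡ _)
  ⊗-++ A (a ∷ x) (b ∷ x′) = trans (cong (A a b *_) (⊗-++ A x x′)) (sym (*-assoc (A a b) _ _))

  ⊗-sym : (A : Fin n → Fin n → ℕ) → (∀ a b → A a b ≡ A b a) → (x y : Vec (Fin n) K) → (A ⊗) x y ≡ (A ⊗) y x
  ⊗-sym A A-sym []      []      = refl
  ⊗-sym A A-sym (a ∷ x) (b ∷ y) = cong₂ _*_ (A-sym a b) (⊗-sym A A-sym x y)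

  ⊗-diagonal : (w : Fin n → Fin n → ℕ) → (∀ a → 1 ≤ w a a) → (x : Vec (Fin n) K) → 1 ≤ (w ⊗) x x
  ⊗-diagonal w 1≤w []      = ≤-refl
  ⊗-diagonal w 1≤w (a ∷ x) = *-mono-≤ (1≤w a) (⊗-diagonal w 1≤w x)

  -- The sum factors over the coordinates, so the one-coordinate inequalities can be multiplied, all
  -- terms being nonnegative.
  ⊗-subharmonic : (A w : Fin n → Fin n → ℕ) (p q : ℕ) →
    (∀ u a → q * ∑[ b < n ] (A a b * w u b) ≤ p * w u a) →
    (u x : Vec (Fin n) K) → q ^ K * ∑ⱽ (λ y → (A ⊗) x y * (w ⊗) u y) ≤ p ^ K * (w ⊗) u x
  ⊗-subharmonic {n} A w p q qAw≤pw [] [] =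
    ≤-reflexive (cong (1 *_) (∑ⱽ-[] {n} {0} (λ y → (A ⊗) [] y * (w ⊗) [] y)))
  ⊗-subharmonic {n} {suc K} A w p q qAw≤pw (u₀ ∷ u) (a ∷ x) = begin
    q * q ^ K * ∑ⱽ (λ y → (A ⊗) (a ∷ x) y * (w ⊗) (u₀ ∷ u) y)
      ≡⟨ cong (q * q ^ K *_) (∑ⱽ-∷-* (λ b → A a b * w u₀ b) (λ y → (A ⊗) x y * (w ⊗) u y)
           (λ y → (A ⊗) (a ∷ x) y * (w ⊗) (u₀ ∷ u) y)
           (λ b y → *-interchange (A a b) ((A ⊗) x y) (w u₀ b) ((w ⊗) u y))) ⟩
    q * q ^ K * (∑[ b < n ] (A a b * w u₀ b) * ∑ⱽ (λ y → (A ⊗) x y * (w ⊗) u y))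
      ≡⟨ *-interchange q _ _ _ ⟩
    q * ∑[ b < n ] (A a b * w u₀ b) * (q ^ K * ∑ⱽ (λ y → (A ⊗) x y * (w ⊗) u y))
      ≤⟨ *-mono-≤ (qAw≤pw u₀ a) (⊗-subharmonic A w p q qAw≤pw u x) ⟩
    p * w u₀ a * (p ^ K * (w ⊗) u x)
      ≡⟨ *-interchange p _ _ _ ⟩
    p * p ^ K * (w u₀ a * (w ⊗) u x) ∎
    where open ≤-Reasoning

  -- Types of vectors and the equitable partition they form.

  count : Vec (Fin n) K → Fin n → ℕ
  count []      b = 0
  count (a ∷ x) b = ⟦ a Fin.≟ b ⟧ + count x b

  count≤ : (x : Vec (Fin n) K) (b : Fin n) → count x b ≤ K
  count≤ []      b = z≤n
  count≤ (a ∷ x) b with does (a Fin.≟ b)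
  ... | true  = s≤s (count≤ x b)
  ... | false = m≤n⇒m≤1+n (count≤ x b)

  infix 4 _↭_
  -- Equality of all counts has no induction principle. Invariance is instead checked on adjacent
  -- transpositions, and `count⇒↭` carries it over to vectors of equal type.
  data _↭_ {n} : Vec (Fin n) K → Vec (Fin n) K → Set where
    ↭-refl  : {x : Vec (Fin n) K} → x ↭ x
    ↭-prep  : ∀ a {x y : Vec (Fin n) K} → x ↭ y → a ∷ x ↭ a ∷ y
    ↭-swap  : ∀ a b (x : Vec (Fin n) K) → a ∷ b ∷ x ↭ b ∷ a ∷ x
    ↭-trans : {x y z : Vec (Fin n) K} → x ↭ y → y ↭ z → x ↭ z

  ↭⇒count : {x y : Vec (Fin n) K} → x ↭ y → count x ≗ count y
  ↭⇒count ↭-refl       c = refl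
  ↭⇒count (↭-prep a r)   c = cong (⟦ a Fin.≟ c ⟧ +_) (↭⇒count r c)
  ↭⇒count (↭-swap a b x) c = +-exchange ⟦ a Fin.≟ c ⟧ ⟦ b Fin.≟ c ⟧ (count x c)
    where
    +-exchange : ∀ a b c → a + (b + c) ≡ b + (a + c)
    +-exchange = solve 3 (λ a b c → a :+ (b :+ c) := b :+ (a :+ c)) refl
      where open +-*-Solver
  ↭⇒count (↭-trans r s)  c = trans (↭⇒count r c) (↭⇒count s c)

  pull : (a : Fin n) (y : Vec (Fin n) (suc K)) → 1 ≤ count y a → ∃[ z ] (a ∷ z ↭ y)
  pull a (b ∷ y) 1≤ with b Fin.≟ a
  ... | yes refl = y , ↭-refl
  pull {K = zero}  a (b ∷ []) () | no _
  pull {K = suc K} a (b ∷ y)  1≤ | no _ with pull a y 1≤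
  ... | z , r = b ∷ z , ↭-trans (↭-swap a b z) (↭-prep b r)

  count⇒↭ : (x y : Vec (Fin n) K) → count x ≗ count y → x ↭ y
  count⇒↭ []      []  eq = ↭-refl
  count⇒↭ (a ∷ x) y  eq with pull a y (≤-trans 1≤ (≤-reflexive (eq a)))
    where
    1≤ : 1 ≤ count (a ∷ x) a
    1≤ = ≤-trans (≤-reflexive (sym (⟦yes⟧ (a Fin.≟ a) refl))) (m≤m+n _ (count x a))
  ... | z , r = ↭-trans (↭-prep a (count⇒↭ x z λ b →
    +-cancelˡ-≡ ⟦ a Fin.≟ b ⟧ _ _ (trans (eq b) (sym (↭⇒count r b))))) r

  #types : (n K : ℕ) → ℕ
  #types n K = suc K ^ n

  funToFin-cong : {f g : Fin m → Fin n} → f ≗ g → funToFin f ≡ funToFin g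
  funToFin-cong {zero}  f≗g = refl
  funToFin-cong {suc m} f≗g = cong₂ combine (f≗g zero) (funToFin-cong (f≗g ∘ suc))

  opaque
    -- The counts are at most `K`, so they are digits in base `suc K`. The code makes equality of
    -- types decidable and allows sums over all types.
    type : Vec (Fin n) K → Fin (#types n K)
    type x = funToFin (λ b → fromℕ< (s≤s (count≤ x b)))

    type⇒count : (x y : Vec (Fin n) K) → type x ≡ type y → count x ≗ count y
    type⇒count {n} {K} x y eq b = begin
      count x b                            ≡⟨ decode x ⟨
      toℕ (finToFun (type x) b)            ≡⟨ cong (λ t → toℕ (finToFun t b)) eq ⟩
      toℕ (finToFun (type y) b)            ≡⟨ decode y ⟩
      count y b                            ∎
      where
      open ≡-Reasoning
      decode : (z : Vec (Fin n) K) → toℕ (finToFun (type z) b) ≡ count z b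
      decode z = trans (cong toℕ (Fin.finToFun-funToFin (λ b → fromℕ< (s≤s (count≤ z b))) b))
                         (Fin.toℕ-fromℕ< (s≤s (count≤ z b)))

    count⇒type : (x y : Vec (Fin n) K) → count x ≗ count y → type x ≡ type y
    count⇒type x y eq = funToFin-cong λ b → Fin.fromℕ<-cong _ _ (eq b) (s≤s (count≤ x b)) (s≤s (count≤ y b))

  type⇒↭ : (x y : Vec (Fin n) K) → type x ≡ type y → x ↭ y
  type⇒↭ x y eq = count⇒↭ x y (type⇒count x y eq)

  ↭⇒type : {x y : Vec (Fin n) K} → x ↭ y → type x ≡ type y
  ↭⇒type {x = x} {y} r = count⇒type x y (↭⇒count r)

  ∏-↭ : (f : Fin n → ℕ) {x y : Vec (Fin n) K} → x ↭ y → ∏ f x ≡ ∏ f y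
  ∏-↭ f ↭-refl       = refl
  ∏-↭ f (↭-prep a r)   = cong (f a *_) (∏-↭ f r)
  ∏-↭ f (↭-swap a b x) = solve 3 (λ a b c → a :* (b :* c) := b :* (a :* c)) refl (f a) (f b) (∏ f x)
    where open +-*-Solver
  ∏-↭ f (↭-trans r s)  = trans (∏-↭ f r) (∏-↭ f s)

  -- Permuting `x` and the summation variable `y` in the same way preserves `(A ⊗) x y`, and `f`
  -- does not see the permutation of `y`.
  ∑ⱽ-⊗-↭ : (A : Fin n → Fin n → ℕ) (f : Vec (Fin n) K → ℕ) → (∀ {y z} → y ↭ z → f y ≡ f z) →
            {x x′ : Vec (Fin n) K} → x ↭ x′ →
            ∑ⱽ (λ y → (A ⊗) x y * f y) ≡ ∑ⱽ (λ y → (A ⊗) x′ y * f y)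
  ∑ⱽ-⊗-↭ A f f-resp ↭-refl = refl
  ∑ⱽ-⊗-↭ {n} A f f-resp {x = a ∷ x} {x′ = .a ∷ x′} (↭-prep a r) = begin
    ∑ⱽ (λ y → (A ⊗) (a ∷ x) y * f y)                             ≡⟨ unfold x ⟩
    ∑[ b < n ] (A a b * ∑ⱽ (λ y → (A ⊗) x y * f (b ∷ y)))
      ≡⟨ sum-cong-≗ (λ b → cong (A a b *_) (∑ⱽ-⊗-↭ A (λ y → f (b ∷ y)) (λ s → f-resp (↭-prep b s)) r)) ⟩
    ∑[ b < n ] (A a b * ∑ⱽ (λ y → (A ⊗) x′ y * f (b ∷ y)))       ≡⟨ unfold x′ ⟨
    ∑ⱽ (λ y → (A ⊗) (a ∷ x′) y * f y)                            ∎
    where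
    open ≡-Reasoning
    unfold : ∀ x → ∑ⱽ (λ y → (A ⊗) (a ∷ x) y * f y) ≡ ∑[ b < n ] (A a b * ∑ⱽ (λ y → (A ⊗) x y * f (b ∷ y)))
    unfold x = trans (∑ⱽ-∷ (λ y → (A ⊗) (a ∷ x) y * f y)) (sum-cong-≗ λ b → trans
      (∑ⱽ-cong λ y → *-assoc (A a b) ((A ⊗) x y) (f (b ∷ y)))
      (∑ⱽ-*ˡ (A a b) (λ y → (A ⊗) x y * f (b ∷ y))))
  ∑ⱽ-⊗-↭ {n} A f f-resp (↭-swap a a′ x) = begin
    ∑ⱽ (λ y → (A ⊗) (a ∷ a′ ∷ x) y * f y)                                                 ≡⟨ unfold a a′ ⟩
    ∑[ b < n ] ∑[ c < n ] ∑ⱽ (λ y → A a b * (A a′ c * (A ⊗) x y) * f (b ∷ c ∷ y))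
      ≡⟨ ∑-comm (λ b c → ∑ⱽ (λ y → A a b * (A a′ c * (A ⊗) x y) * f (b ∷ c ∷ y))) ⟩
    ∑[ c < n ] ∑[ b < n ] ∑ⱽ (λ y → A a b * (A a′ c * (A ⊗) x y) * f (b ∷ c ∷ y))
      ≡⟨ sum-cong-≗ (λ c → sum-cong-≗ λ b → ∑ⱽ-cong λ y →
           cong₂ _*_ (exchange (A a b) (A a′ c) ((A ⊗) x y)) (f-resp (↭-swap b c y))) ⟩
    ∑[ c < n ] ∑[ b < n ] ∑ⱽ (λ y → A a′ c * (A a b * (A ⊗) x y) * f (c ∷ b ∷ y))         ≡⟨ unfold a′ a ⟨
    ∑ⱽ (λ y → (A ⊗) (a′ ∷ a ∷ x) y * f y)                                                 ∎
    where
    open ≡-Reasoning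
    exchange : ∀ a b c → a * (b * c) ≡ b * (a * c)
    exchange = solve 3 (λ a b c → a :* (b :* c) := b :* (a :* c)) refl
      where open +-*-Solver
    unfold : ∀ a a′ → ∑ⱽ (λ y → (A ⊗) (a ∷ a′ ∷ x) y * f y) ≡
                      ∑[ b < n ] ∑[ c < n ] ∑ⱽ (λ y → A a b * (A a′ c * (A ⊗) x y) * f (b ∷ c ∷ y))
    unfold a a′ = trans (∑ⱽ-∷ (λ y → (A ⊗) (a ∷ a′ ∷ x) y * f y))
      (sum-cong-≗ λ b → ∑ⱽ-∷ (λ y → (A ⊗) (a ∷ a′ ∷ x) (b ∷ y) * f (b ∷ y)))
  ∑ⱽ-⊗-↭ A f f-resp (↭-trans r s) = trans (∑ⱽ-⊗-↭ A f f-resp r) (∑ⱽ-⊗-↭ A f f-resp s)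

  ∑ⱽ-types : (f : Vec (Fin n) K → ℕ) → ∑ⱽ f ≡ ∑[ τ < #types n K ] ∑ⱽ (λ x → ⟦ type x Fin.≟ τ ⟧ * f x)
  ∑ⱽ-types {n} {K} f = begin
    ∑ⱽ f                                                                 ≡⟨ ∑ⱽ-cong (λ x → sym (split x)) ⟩
    ∑ⱽ (λ x → ∑[ τ < #types n K ] (⟦ type x Fin.≟ τ ⟧ * f x))
      ≡⟨ ∑ⱽ-sum-comm {m = #types n K} (λ x τ → ⟦ type x Fin.≟ τ ⟧ * f x) ⟩
    ∑[ τ < #types n K ] ∑ⱽ (λ x → ⟦ type x Fin.≟ τ ⟧ * f x)             ∎
    where
    open ≡-Reasoning
    split : ∀ x → ∑[ τ < #types n K ] (⟦ type x Fin.≟ τ ⟧ * f x) ≡ f x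
    split x = begin
      ∑[ τ < #types n K ] (⟦ type x Fin.≟ τ ⟧ * f x)  ≡⟨ *-distribʳ-sum {#types n K} (f x) (λ τ → ⟦ type x Fin.≟ τ ⟧) ⟨
      ∑[ τ < #types n K ] ⟦ type x Fin.≟ τ ⟧ * f x    ≡⟨ cong (_* f x) (sum-⟦≟⟧ (type x)) ⟩
      1 * f x                                          ≡⟨ *-identityˡ (f x) ⟩
      f x                                              ∎

  -- Some codes belong to no vector. They have to be recognised, because neighbour counts are read
  -- off at a representative of the type.
  inhabited? : (τ : Fin (#types n K)) → (∃[ x ] type {n} {K} x ≡ τ) ⊎ (∀ x → type {n} {K} x ≢ τ)
  inhabited? {n} {K} τ with Fin.any? (λ (u : Fin (n ^ K)) → type (toVec u) Fin.≟ τ)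
  ... | yes (u , eq) = inj₁ (toVec u , eq)
  ... | no  ∄u       = inj₂ λ x eq → ∄u (fromVec x , subst (λ y → type y ≡ τ) (sym (toVec-fromVec x)) eq)

  -- The types form an equitable partition of a tensor power: the number of neighbours of x that
  -- have type τ depends only on τ and on the type of x.
  module Types {n : ℕ} (A : Fin n → Fin n → ℕ) (A-sym : ∀ a b → A a b ≡ A b a) {K : ℕ} where

    P : ℕ
    P = #types n K

    is : Fin P → Vec (Fin n) K → ℕ
    is τ x = ⟦ type x Fin.≟ τ ⟧

    D : Vec (Fin n) K → Fin P → ℕ
    D x τ = ∑ⱽ (λ y → (A ⊗) x y * is τ y)

    size : Fin P → ℕ
    size τ = ∑ⱽ (is τ)

    D-cong : ∀ x x′ τ → type x ≡ type x′ → D x τ ≡ D x′ τ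
    D-cong x x′ τ eq = ∑ⱽ-⊗-↭ A (is τ) (λ r → cong (λ t → ⟦ t Fin.≟ τ ⟧) (↭⇒type r)) (type⇒↭ x x′ eq)

    edges-between : ∀ x τ → size (type x) * D x τ ≡ ∑ⱽ (λ x′ → ∑ⱽ (λ y → is (type x) x′ * (A ⊗) x′ y * is τ y))
    edges-between x τ = begin
      size (type x) * D x τ                                 ≡⟨ ∑ⱽ-*ʳ (is (type x)) (D x τ) ⟨
      ∑ⱽ (λ x′ → is (type x) x′ * D x τ)
        ≡⟨ ∑ⱽ-cong (λ x′ → ⟦⟧*-cong (type x′ Fin.≟ type x) λ eq → sym (D-cong x′ x τ eq)) ⟩
      ∑ⱽ (λ x′ → is (type x) x′ * D x′ τ)
        ≡⟨ ∑ⱽ-cong (λ x′ → ∑ⱽ-*ˡ (is (type x) x′) (λ y → (A ⊗) x′ y * is τ y)) ⟨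
      ∑ⱽ (λ x′ → ∑ⱽ (λ y → is (type x) x′ * ((A ⊗) x′ y * is τ y)))
        ≡⟨ ∑ⱽ-cong (λ x′ → ∑ⱽ-cong λ y → *-assoc (is (type x) x′) _ _) ⟨
      ∑ⱽ (λ x′ → ∑ⱽ (λ y → is (type x) x′ * (A ⊗) x′ y * is τ y)) ∎
      where open ≡-Reasoning

    -- Double counting: both sides are the number of adjacent pairs between the two classes, seen
    -- from either end.
    size-D-sym : ∀ x y → size (type x) * D x (type y) ≡ size (type y) * D y (type x)
    size-D-sym x y = begin
      size (type x) * D x (type y)  ≡⟨ edges-between x (type y) ⟩
      ∑ⱽ (λ x′ → ∑ⱽ (λ y′ → is (type x) x′ * (A ⊗) x′ y′ * is (type y) y′))  ≡⟨ ∑ⱽ-comm _ ⟩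
      ∑ⱽ (λ y′ → ∑ⱽ (λ x′ → is (type x) x′ * (A ⊗) x′ y′ * is (type y) y′))
        ≡⟨ ∑ⱽ-cong (λ y′ → ∑ⱽ-cong λ x′ → begin
             is (type x) x′ * (A ⊗) x′ y′ * is (type y) y′   ≡⟨ reverse (is (type x) x′) _ _ ⟩
             is (type y) y′ * (A ⊗) x′ y′ * is (type x) x′
               ≡⟨ cong (λ a → is (type y) y′ * a * is (type x) x′) (⊗-sym A A-sym x′ y′) ⟩
             is (type y) y′ * (A ⊗) y′ x′ * is (type x) x′   ∎) ⟩
      ∑ⱽ (λ y′ → ∑ⱽ (λ x′ → is (type y) y′ * (A ⊗) y′ x′ * is (type x) x′))  ≡⟨ edges-between y (type x) ⟨
      size (type y) * D y (type x)  ∎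
      where
      open ≡-Reasoning
      reverse : ∀ a b c → a * b * c ≡ c * b * a
      reverse = solve 3 (λ a b c → a :* b :* c := c :* b :* a) refl
        where open +-*-Solver

    module _ (ξ : Fin n → ℕ) {Δ : ℕ} (D*D≤Δ : ∀ x y → D x (type y) * D y (type x) ≤ Δ) where

      private
        Aξ : Fin n → ℕ
        Aξ a = ∑[ b < n ] (A a b * ξ b)

        ω² : Vec (Fin n) K → ℕ
        ω² x = ∏ ξ x * ∏ ξ x

        S : ℕ
        S = ∑ⱽ {K = K} ω²

        -- The part of (A ω)(x) that comes from the entries of type `τ`, where ω is `∏ ξ`.
        -- Accordingly `block σ τ` is the squared norm of this part over the vectors of type `σ`.
        h : Vec (Fin n) K → Fin P → ℕ
        h x τ = ∑ⱽ (λ y → (A ⊗) x y * is τ y * ∏ ξ y)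

        block : Fin P → Fin P → ℕ
        block σ τ = ∑ⱽ (λ x → is σ x * (h x τ * h x τ))

        h-value : ∀ x y → h x (type y) ≡ D x (type y) * ∏ ξ y
        h-value x y = begin
          ∑ⱽ (λ z → (A ⊗) x z * is (type y) z * ∏ ξ z)
            ≡⟨ ∑ⱽ-cong (λ z → begin
                 (A ⊗) x z * is (type y) z * ∏ ξ z    ≡⟨ *-assoc ((A ⊗) x z) _ _ ⟩
                 (A ⊗) x z * (is (type y) z * ∏ ξ z)
                   ≡⟨ cong ((A ⊗) x z *_) (⟦⟧*-cong (type z Fin.≟ type y) λ eq → ∏-↭ ξ (type⇒↭ z y eq)) ⟩
                 (A ⊗) x z * (is (type y) z * ∏ ξ y)  ≡⟨ *-assoc ((A ⊗) x z) _ _ ⟨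
                 (A ⊗) x z * is (type y) z * ∏ ξ y    ∎) ⟩
          ∑ⱽ (λ z → (A ⊗) x z * is (type y) z * ∏ ξ y)  ≡⟨ ∑ⱽ-*ʳ (λ z → (A ⊗) x z * is (type y) z) (∏ ξ y) ⟩
          D x (type y) * ∏ ξ y ∎
          where open ≡-Reasoning

        size*ω²≤S : ∀ y → size (type y) * ω² y ≤ S
        size*ω²≤S y = begin
          size (type y) * ω² y                     ≡⟨ ∑ⱽ-*ʳ (is (type y)) (ω² y) ⟨
          ∑ⱽ (λ z → is (type y) z * ω² y)
            ≡⟨ ∑ⱽ-cong (λ z → ⟦⟧*-cong (type z Fin.≟ type y) λ eq →
                 cong (λ t → t * t) (sym (∏-↭ ξ (type⇒↭ z y eq)))) ⟩
          ∑ⱽ (λ z → is (type y) z * ω² z)          ≤⟨ ∑ⱽ-mono (λ z → ⟦⟧*≤ (type z Fin.≟ type y) (ω² z)) ⟩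
          S                                        ∎
          where open ≤-Reasoning

        block≤ : ∀ σ τ → block σ τ ≤ Δ * S
        block≤ σ τ with inhabited? {n} {K} σ | inhabited? {n} {K} τ
        ... | inj₂ ∄x | _ = ≤-trans (≤-reflexive
          (∑ⱽ-zero λ x → cong (_* (h x τ * h x τ)) (⟦no⟧ (type x Fin.≟ σ) (∄x x)))) z≤n
        ... | inj₁ _ | inj₂ ∄y = ≤-trans (≤-reflexive
          (∑ⱽ-zero λ x → trans (cong (λ t → is σ x * (t * t)) (h≡0 x)) (*-zeroʳ (is σ x)))) z≤n
          where
          h≡0 : ∀ x → h x τ ≡ 0
          h≡0 x = ∑ⱽ-zero λ y → cong (_* ∏ ξ y) (trans
            (cong ((A ⊗) x y *_) (⟦no⟧ (type y Fin.≟ τ) (∄y y))) (*-zeroʳ ((A ⊗) x y)))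
        ... | inj₁ (x₀ , refl) | inj₁ (y₀ , refl) = begin
          ∑ⱽ (λ x → is (type x₀) x * (h x (type y₀) * h x (type y₀)))
            ≡⟨ ∑ⱽ-cong (λ x → ⟦⟧*-cong (type x Fin.≟ type x₀) λ eq → cong (λ t → t * t)
                 (trans (h-value x y₀) (cong (_* ∏ ξ y₀) (D-cong x x₀ (type y₀) eq)))) ⟩
          ∑ⱽ (λ x → is (type x₀) x * (d * w * (d * w)))   ≡⟨ ∑ⱽ-*ʳ (is (type x₀)) (d * w * (d * w)) ⟩
          size (type x₀) * (d * w * (d * w))              ≡⟨ regroup (size (type x₀)) d w ⟩
          -- Of the two factors `d`, one is turned round by counting the edges from the other class.
          -- What remains is `d * d′` times the share of |ω|² carried by the type of `y₀`.
          size (type x₀) * d * d * (w * w)                ≡⟨ cong (λ t → t * d * (w * w)) (size-D-sym x₀ y₀) ⟩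
          size (type y₀) * d′ * d * (w * w)               ≡⟨ regroup′ (size (type y₀)) d′ d w ⟩
          d * d′ * (size (type y₀) * (w * w))             ≤⟨ *-mono-≤ (D*D≤Δ x₀ y₀) (size*ω²≤S y₀) ⟩
          Δ * S                                           ∎
          where
          open ≤-Reasoning

          d  = D x₀ (type y₀)
          d′ = D y₀ (type x₀)
          w  = ∏ ξ y₀
          regroup : ∀ s d w → s * (d * w * (d * w)) ≡ s * d * d * (w * w)
          regroup = solve 3 (λ s d w → s :* (d :* w :* (d :* w)) := s :* d :* d :* (w :* w)) refl
            where open +-*-Solver
          regroup′ : ∀ s e d w → s * e * d * (w * w) ≡ d * e * (s * (w * w))
          regroup′ = solve 4 (λ s e d w → s :* e :* d :* (w :* w) := d :* e :* (s :* (w :* w))) refl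
            where open +-*-Solver

      -- The left side is |A ω|² in the tensor power. Of the factor P⁴, P² is lost when `sum²≤`
      -- splits an entry of A ω over the types, and P² is the number of blocks.
      power-quotient-bound : (∑[ a < n ] (Aξ a * Aξ a)) ^ K ≤ P * P * (P * P) * Δ * (∑[ a < n ] (ξ a * ξ a)) ^ K
      power-quotient-bound = begin
        (∑[ a < n ] (Aξ a * Aξ a)) ^ K                       ≡⟨ ∑ⱽ-∏ K (λ a → Aξ a * Aξ a) ⟨
        ∑ⱽ {K = K} (∏ (λ a → Aξ a * Aξ a))                   ≤⟨ ∑ⱽ-mono pointwise ⟩
        ∑ⱽ (λ x → P * P * ∑[ τ < P ] (h x τ * h x τ))        ≡⟨ ∑ⱽ-*ˡ (P * P) (λ x → ∑[ τ < P ] (h x τ * h x τ)) ⟩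
        P * P * ∑ⱽ (λ x → ∑[ τ < P ] (h x τ * h x τ))        ≡⟨ cong (P * P *_) (∑ⱽ-sum-comm (λ x τ → h x τ * h x τ)) ⟩
        P * P * ∑[ τ < P ] ∑ⱽ (λ x → h x τ * h x τ)
          ≡⟨ cong (P * P *_) (sum-cong-≗ {P} λ τ → ∑ⱽ-types (λ x → h x τ * h x τ)) ⟩
        P * P * ∑[ τ < P ] ∑[ σ < P ] block σ τ
          ≤⟨ *-monoʳ-≤ (P * P) (sum≤const {P} λ τ → sum≤const {P} λ σ → block≤ σ τ) ⟩
        P * P * (P * (P * (Δ * S)))                          ≡⟨ regroup P Δ S ⟩
        P * P * (P * P) * Δ * S                              ≡⟨ cong (P * P * (P * P) * Δ *_) S≡ ⟩
        P * P * (P * P) * Δ * (∑[ a < n ] (ξ a * ξ a)) ^ K   ∎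
        where
        open ≤-Reasoning
        regroup : ∀ p d s → p * p * (p * (p * (d * s))) ≡ p * p * (p * p) * d * s
        regroup = solve 3 (λ p d s → p :* p :* (p :* (p :* (d :* s))) := p :* p :* (p :* p) :* d :* s) refl
          where open +-*-Solver
        S≡ : S ≡ (∑[ a < n ] (ξ a * ξ a)) ^ K
        S≡ = trans (sym (∑ⱽ-cong (∏-* ξ ξ))) (∑ⱽ-∏ K (λ a → ξ a * ξ a))
        ∏Aξ : ∀ x → ∏ Aξ x ≡ ∑[ τ < P ] h x τ
        ∏Aξ x = trans (sym (∑ⱽ-⊗-∏ A ξ x)) (trans (∑ⱽ-types (λ y → (A ⊗) x y * ∏ ξ y))
          (sum-cong-≗ {P} λ τ → ∑ⱽ-cong λ y → rotate (is τ y) ((A ⊗) x y) (∏ ξ y)))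
          where
          rotate : ∀ a b c → a * (b * c) ≡ b * a * c
          rotate = solve 3 (λ a b c → a :* (b :* c) := b :* a :* c) refl
            where open +-*-Solver
        pointwise : ∀ x → ∏ (λ a → Aξ a * Aξ a) x ≤ P * P * ∑[ τ < P ] (h x τ * h x τ)
        pointwise x = begin
          ∏ (λ a → Aξ a * Aξ a) x                  ≡⟨ ∏-* Aξ Aξ x ⟩
          ∏ Aξ x * ∏ Aξ x                          ≡⟨ cong (λ t → t * t) (∏Aξ x) ⟩
          ∑[ τ < P ] h x τ * ∑[ τ < P ] h x τ      ≤⟨ sum²≤ {P} (h x) ⟩
          P * P * ∑[ τ < P ] (h x τ * h x τ)       ∎

      -- ξ witnesses that p / q is at most the largest eigenvalue of A², so that (p / q) ^ K is at
      -- most that of the K-th tensor power; only P types are available, which loses a factor P ^ 4.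
      degree-lower-bound : ∀ p q → p * ∑[ a < n ] (ξ a * ξ a) ≤ q * ∑[ a < n ] (Aξ a * Aξ a) →
                           1 ≤ ∑[ a < n ] (ξ a * ξ a) → p ^ K ≤ q ^ K * (P * P * (P * P) * Δ)
      degree-lower-bound p q pS≤qT 1≤S = *-cancelʳ-≤ _ _ (s ^ K) {{m^n≢0 s K {{>-nonZero 1≤S}}}} (begin
        p ^ K * s ^ K                                     ≡⟨ *-^-distrib p s K ⟨
        (p * s) ^ K                                       ≤⟨ ^-monoˡ-≤ K pS≤qT ⟩
        (q * t) ^ K                                       ≡⟨ *-^-distrib q t K ⟩
        q ^ K * t ^ K                                     ≤⟨ *-monoʳ-≤ (q ^ K) power-quotient-bound ⟩
        q ^ K * (P * P * (P * P) * Δ * s ^ K)             ≡⟨ *-assoc (q ^ K) _ _ ⟨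
        q ^ K * (P * P * (P * P) * Δ) * s ^ K             ∎)
        where
        open ≤-Reasoning
        s = ∑[ a < n ] (ξ a * ξ a)
        t = ∑[ a < n ] (Aξ a * Aξ a)

  -- Edge counts and degrees as sums of indicators.

  ∣tabulate∣ : (f : Fin n → Bool) → ∣ tabulate f ∣ ≡ ∑[ i < n ] (if f i then 1 else 0)
  ∣tabulate∣ {zero}  f = refl
  ∣tabulate∣ {suc n} f with f zero
  ... | true  = cong suc (∣tabulate∣ (f ∘ suc))
  ... | false = ∣tabulate∣ (f ∘ suc)

  module _ {A : Set} {P : A → Set} (P? : ∀ a → Dec (P a)) where

    length-filter-++ : ∀ xs ys → length (filter P? (xs List.++ ys)) ≡ length (filter P? xs) + length (filter P? ys)
    length-filter-++ xs ys = trans (cong length (List.filter-++ P? xs ys)) (List.length-++ (filter P? xs))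

    length-filter-∷ : ∀ x xs → length (filter P? (x List.∷ xs)) ≡ ⟦ P? x ⟧ + length (filter P? xs)
    length-filter-∷ x xs with does (P? x)
    ... | true  = refl
    ... | false = refl

    length-filter-map-tabulate : ∀ {B : Set} (g : B → A) (f : Fin n → B) →
      length (filter P? (List.map g (List.tabulate f))) ≡ ∑[ i < n ] ⟦ P? (g (f i)) ⟧
    length-filter-map-tabulate {zero}  g f = refl
    length-filter-map-tabulate {suc n} g f = trans
      (length-filter-∷ (g (f zero)) (List.map g (List.tabulate (f ∘ suc))))
      (cong (⟦ P? (g (f zero)) ⟧ +_) (length-filter-map-tabulate g (f ∘ suc)))

  length-filter-product : {P : Fin m × Fin n → Set} (P? : ∀ a → Dec (P a)) →
    length (filter P? (cartesianProduct (allFin m) (allFin n))) ≡ ∑[ i < m ] ∑[ j < n ] ⟦ P? (i , j) ⟧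
  length-filter-product {m} {n} P? = go id
    where
    go : ∀ {l} (f : Fin l → Fin m) →
      length (filter P? (cartesianProduct (List.tabulate f) (allFin n))) ≡ ∑[ i < l ] ∑[ j < n ] ⟦ P? (f i , j) ⟧
    go {zero}  f = refl
    go {suc l} f = trans
      (length-filter-++ P? (List.map (f zero ,_) (allFin n)) (cartesianProduct (List.tabulate (f ∘ suc)) (allFin n)))
      (cong₂ _+_ (length-filter-map-tabulate P? (f zero ,_) id) (go (f ∘ suc)))

  -- The counted pairs with u < v and their reversals make up all ordered adjacent pairs, since
  -- there are no loops.
  2*countEdges : {E : Rel (Fin n) 0ℓ} (E? : Decidable E) → (∀ {u v} → E u v → E v u) → (∀ {u} → ¬ E u u) →
                 2 * countEdges E? ≡ ∑[ u < n ] ∑[ v < n ] ⟦ E? u v ⟧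
  2*countEdges {n} {E} E? E-sym E-irrefl = begin
    2 * countEdges E?                                   ≡⟨ cong (countEdges E? +_) (+-identityʳ (countEdges E?)) ⟩
    countEdges E? + countEdges E?                       ≡⟨ cong₂ _+_ edges (trans edges (∑-comm (λ u v → ⟦ lt u v ⟧))) ⟩
    ∑[ u < n ] ∑[ v < n ] ⟦ lt u v ⟧ + ∑[ v < n ] ∑[ u < n ] ⟦ lt u v ⟧
      ≡⟨ ∑-distrib-+ (λ u → ∑[ v < n ] ⟦ lt u v ⟧) (λ v → ∑[ u < n ] ⟦ lt u v ⟧) ⟨
    ∑[ u < n ] (∑[ v < n ] ⟦ lt u v ⟧ + ∑[ v < n ] ⟦ lt v u ⟧)
      ≡⟨ sum-cong-≗ (λ u → ∑-distrib-+ (λ v → ⟦ lt u v ⟧) (λ v → ⟦ lt v u ⟧)) ⟨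
    ∑[ u < n ] ∑[ v < n ] (⟦ lt u v ⟧ + ⟦ lt v u ⟧)     ≡⟨ sum-cong-≗ (λ u → sum-cong-≗ (tri u)) ⟩
    ∑[ u < n ] ∑[ v < n ] ⟦ E? u v ⟧                    ∎
    where
    open ≡-Reasoning
    lt : ∀ u v → Dec (u Fin.< v × E u v)
    lt u v = (u Fin.<? v) ×-dec E? u v
    edges : countEdges E? ≡ ∑[ u < n ] ∑[ v < n ] ⟦ lt u v ⟧
    edges = length-filter-product (λ p → lt (proj₁ p) (proj₂ p))
    tri : ∀ u v → ⟦ lt u v ⟧ + ⟦ lt v u ⟧ ≡ ⟦ E? u v ⟧
    tri u v with Fin.<-cmp u v
    ... | tri< u<v _ ¬v<u = trans
      (cong₂ _+_ (⟦⟧-cong (lt u v) (E? u v) proj₂ (u<v ,_)) (⟦no⟧ (lt v u) (¬v<u ∘ proj₁))) (+-identityʳ _)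
    ... | tri> ¬u<v _ v<u =
      cong₂ _+_ (⟦no⟧ (lt u v) (¬u<v ∘ proj₁)) (⟦⟧-cong (lt v u) (E? u v) (E-sym ∘ proj₂) (λ e → v<u , E-sym e))
    ... | tri≈ ¬u<v refl ¬v<u = trans
      (cong₂ _+_ (⟦no⟧ (lt u u) (¬u<v ∘ proj₁)) (⟦no⟧ (lt u u) (¬v<u ∘ proj₁))) (sym (⟦no⟧ (E? u u) E-irrefl))

  degree≡sum : ∀ {H} (F : Subgraph H) v → degree F v ≡ ∑[ w < order H ] ⟦ edge? F v w ⟧
  degree≡sum F v = ∣tabulate∣ (λ w → does (edge? F v w))

  -- Edges and regular subgraphs of tensor powers.

  module TensorPower (G : Graph) where

    A : Fin (order G) → Fin (order G) → ℕ
    A a b = ⟦ adj? G a b ⟧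

    A-sym : ∀ a b → A a b ≡ A b a
    A-sym a b = ⟦⟧-cong (adj? G a b) (adj? G b a) (symm G) (symm G)

    ⟦all-adj?⟧ : (f g : Fin K → Fin (order G)) →
      ⟦ Fin.all? (λ i → adj? G (f i) (g i)) ⟧ ≡ (A ⊗) (tabulate f) (tabulate g)
    ⟦all-adj?⟧ {zero}  f g = ⟦yes⟧ (Fin.all? (λ i → adj? G (f i) (g i))) (λ ())
    ⟦all-adj?⟧ {suc K} f g = begin
      ⟦ Fin.all? (λ i → adj? G (f i) (g i)) ⟧
        ≡⟨ ⟦⟧-cong (Fin.all? (λ i → adj? G (f i) (g i)))
                   (adj? G (f zero) (g zero) ×-dec Fin.all? (λ i → adj? G (f (suc i)) (g (suc i))))
                   (λ h → h zero , h ∘ suc) (λ { (h , t) zero → h ; (h , t) (suc i) → t i }) ⟩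
      ⟦ adj? G (f zero) (g zero) ×-dec Fin.all? (λ i → adj? G (f (suc i)) (g (suc i))) ⟧
        ≡⟨ ⟦×⟧ (adj? G (f zero) (g zero)) (Fin.all? (λ i → adj? G (f (suc i)) (g (suc i)))) ⟩
      A (f zero) (g zero) * ⟦ Fin.all? (λ i → adj? G (f (suc i)) (g (suc i))) ⟧
        ≡⟨ cong (A (f zero) (g zero) *_) (⟦all-adj?⟧ (f ∘ suc) (g ∘ suc)) ⟩
      A (f zero) (g zero) * (A ⊗) (tabulate (f ∘ suc)) (tabulate (g ∘ suc)) ∎
      where open ≡-Reasoning

    module _ (K : ℕ) .{{_ : NonZero K}} where

      private
        vec : Fin (order G ^ K) → Vec (Fin (order G)) K
        vec = toVec

      ⟦adj?⟧ : ∀ u v → ⟦ adj? (tensorPower G K) u v ⟧ ≡ (A ⊗) (vec u) (vec v)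
      ⟦adj?⟧ u v = ⟦all-adj?⟧ (finToFun {order G} {K} u) (finToFun v)

      module _ (F : Subgraph (tensorPower G K)) where

        private
          N : ℕ
          N = order G ^ K

        -- Row sums of the tensor power are products of degrees in G, so their total is the `K`-th
        -- power of the degree sum of G.
        Mₛ≤M^K : Mₛ F ≤ M G ^ K
        Mₛ≤M^K = begin
          Mₛ F
            ≡⟨ 2*countEdges (edge? F) (edge-symm F) (λ {u} e → irrefl (tensorPower G K) {u} {u} refl (edge⇒adj F e)) ⟩
          ∑[ u < N ] ∑[ v < N ] ⟦ edge? F u v ⟧
            ≤⟨ sum-mono {N} (λ u → sum-mono {N} λ v → ≤-trans
                 (⟦⟧-mono (edge? F u v) (adj? (tensorPower G K) u v) (edge⇒adj F)) (≤-reflexive (⟦adj?⟧ u v))) ⟩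
          ∑[ u < N ] ∑[ v < N ] (A ⊗) (vec u) (vec v)
            ≡⟨ sum-cong-≗ {N} (λ u → trans (degree-∏ (vec u)) (∑ⱽ-toVec ((A ⊗) (vec u)))) ⟨
          ∑[ u < N ] ∏ (λ a → ∑[ b < order G ] (A a b * 1)) (vec u)
            ≡⟨ ∑ⱽ-toVec (∏ (λ a → ∑[ b < order G ] (A a b * 1))) ⟨
          ∑ⱽ {K = K} (∏ (λ a → ∑[ b < order G ] (A a b * 1)))
            ≡⟨ ∑ⱽ-∏ K (λ a → ∑[ b < order G ] (A a b * 1)) ⟩
          (∑[ a < order G ] ∑[ b < order G ] (A a b * 1)) ^ K
            ≡⟨ cong (_^ K) (sum-cong-≗ λ a → sum-cong-≗ λ b → *-identityʳ (A a b)) ⟩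
          (∑[ a < order G ] ∑[ b < order G ] A a b) ^ K
            ≡⟨ cong (_^ K) (2*countEdges (adj? G) (symm G) (irrefl G refl)) ⟨
          M G ^ K ∎
          where
          open ≤-Reasoning
          degree-∏ : ∀ x → ∏ (λ a → ∑[ b < order G ] (A a b * 1)) x ≡ ∑ⱽ ((A ⊗) x)
          degree-∏ x = trans (sym (∑ⱽ-⊗-∏ A (λ _ → 1) x))
            (∑ⱽ-cong λ y → trans (cong ((A ⊗) x y *_) (∏-1 y)) (*-identityʳ _))

        -- The tensor product ψ of the vectors w u, over the coordinates u of a vertex u₀ of F, satisfies
        -- q ^ K * (the sum of ψ over the neighbours of v) ≤ p ^ K * ψ v; now sum over all v in F.
        degree-upper-bound : ∀ {d} → IsRegular F d → (w : Fin (order G) → Fin (order G) → ℕ) (p q : ℕ) →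
          (∀ a → 1 ≤ w a a) → (∀ u a → q * ∑[ b < order G ] (A a b * w u b) ≤ p * w u a) →
          q ^ K * d ≤ p ^ K
        degree-upper-bound {d} regular w p q 1≤w qAw≤pw = *-cancelʳ-≤ (q ^ K * d) (p ^ K) Ψ {{>-nonZero 1≤Ψ}} (begin
          q ^ K * d * Ψ                                      ≡⟨ *-assoc (q ^ K) d Ψ ⟩
          q ^ K * (d * Ψ)                                    ≤⟨ *-monoʳ-≤ (q ^ K) dΨ≤ ⟩
          q ^ K * ∑[ v < N ] (is v * ∑ⱽ (λ y → (A ⊗) (vec v) y * (w ⊗) (vec u₀) y))
            ≡⟨ *-distribˡ-sum {N} (q ^ K) (λ v → is v * ∑ⱽ (λ y → (A ⊗) (vec v) y * (w ⊗) (vec u₀) y)) ⟩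
          ∑[ v < N ] (q ^ K * (is v * ∑ⱽ (λ y → (A ⊗) (vec v) y * (w ⊗) (vec u₀) y)))
            ≤⟨ sum-mono {N} (λ v → begin
                 q ^ K * (is v * ∑ⱽ (λ y → (A ⊗) (vec v) y * (w ⊗) (vec u₀) y))
                   ≡⟨ exchange (q ^ K) (is v) _ ⟩
                 is v * (q ^ K * ∑ⱽ (λ y → (A ⊗) (vec v) y * (w ⊗) (vec u₀) y))
                   ≤⟨ *-monoʳ-≤ (is v) (⊗-subharmonic A w p q qAw≤pw (vec u₀) (vec v)) ⟩
                 is v * (p ^ K * ψ v)
                   ≡⟨ exchange (is v) (p ^ K) (ψ v) ⟩
                 p ^ K * (is v * ψ v) ∎) ⟩
          ∑[ v < N ] (p ^ K * (is v * ψ v))                  ≡⟨ *-distribˡ-sum {N} (p ^ K) (λ v → is v * ψ v) ⟨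
          p ^ K * Ψ                                          ∎)
          where
          open ≤-Reasoning
          u₀ : Fin N
          u₀ = proj₁ (inhabited F)
          ψ : Fin N → ℕ
          ψ v = (w ⊗) (vec u₀) (vec v)
          is : Fin N → ℕ
          is v = ⟦ v ∈? vertices F ⟧
          Ψ : ℕ
          Ψ = ∑[ v < N ] (is v * ψ v)
          1≤Ψ : 1 ≤ Ψ
          -- The diagonal bound `1 ≤ w a a` gives ψ ≥ 1 at `u₀` itself, so that `Ψ` may be
          -- cancelled.
          1≤Ψ = ≤-trans (*-mono-≤ (≤-reflexive (sym (⟦yes⟧ (u₀ ∈? vertices F) (proj₂ (inhabited F)))))
            (⊗-diagonal w 1≤w (vec u₀))) (term≤sum (λ v → is v * ψ v) u₀)
          exchange : ∀ a b c → a * (b * c) ≡ b * (a * c)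
          exchange = solve 3 (λ a b c → a :* (b :* c) := b :* (a :* c)) refl
            where open +-*-Solver
          is*d≤ : ∀ v → is v * d ≤ ∑[ x < N ] ⟦ edge? F v x ⟧
          is*d≤ v = begin
            is v * d               ≡⟨ ⟦⟧*-cong (v ∈? vertices F) (λ v∈F → sym (regular v v∈F)) ⟩
            is v * degree F v      ≤⟨ ⟦⟧*≤ (v ∈? vertices F) (degree F v) ⟩
            degree F v             ≡⟨ degree≡sum F v ⟩
            ∑[ x < N ] ⟦ edge? F v x ⟧ ∎
          edge≤ : ∀ v x → ⟦ edge? F v x ⟧ ≤ is x * (A ⊗) (vec x) (vec v)
          edge≤ v x = begin
            ⟦ edge? F v x ⟧
              ≤⟨ ⟦⟧-mono (edge? F v x) ((x ∈? vertices F) ×-dec adj? (tensorPower G K) x v)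
                   (λ e → proj₂ (edge⇒∈ F e) , edge⇒adj F (edge-symm F e)) ⟩
            ⟦ (x ∈? vertices F) ×-dec adj? (tensorPower G K) x v ⟧   ≡⟨ ⟦×⟧ (x ∈? vertices F) (adj? (tensorPower G K) x v) ⟩
            is x * ⟦ adj? (tensorPower G K) x v ⟧                    ≡⟨ cong (is x *_) (⟦adj?⟧ x v) ⟩
            is x * (A ⊗) (vec x) (vec v)                         ∎
          -- The edges of F at `v` all lead to vertices `x` of F. After exchanging the sums, each
          -- such `x` collects ψ over its neighbours in F, which is at most the sum over its
          -- neighbours in the whole power.
          dΨ≤ : d * Ψ ≤ ∑[ v < N ] (is v * ∑ⱽ (λ y → (A ⊗) (vec v) y * (w ⊗) (vec u₀) y))
          dΨ≤ = begin
            d * Ψ                                            ≡⟨ *-distribˡ-sum {N} d (λ v → is v * ψ v) ⟩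
            ∑[ v < N ] (d * (is v * ψ v))
              ≤⟨ sum-mono {N} (λ v → ≤-trans (≤-reflexive (rotate d (is v) (ψ v))) (*-monoˡ-≤ (ψ v) (is*d≤ v))) ⟩
            ∑[ v < N ] (∑[ x < N ] ⟦ edge? F v x ⟧ * ψ v)
              ≡⟨ sum-cong-≗ {N} (λ v → *-distribʳ-sum {N} (ψ v) (λ x → ⟦ edge? F v x ⟧)) ⟩
            ∑[ v < N ] ∑[ x < N ] (⟦ edge? F v x ⟧ * ψ v)
              ≤⟨ sum-mono {N} (λ v → sum-mono {N} λ x → *-monoˡ-≤ (ψ v) (edge≤ v x)) ⟩
            ∑[ v < N ] ∑[ x < N ] (is x * (A ⊗) (vec x) (vec v) * ψ v)
              ≡⟨ ∑-comm {N} {N} (λ v x → is x * (A ⊗) (vec x) (vec v) * ψ v) ⟩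
            ∑[ x < N ] ∑[ v < N ] (is x * (A ⊗) (vec x) (vec v) * ψ v)
              ≡⟨ sum-cong-≗ {N} (λ x → begin-equality
                   ∑[ v < N ] (is x * (A ⊗) (vec x) (vec v) * ψ v)
                     ≡⟨ sum-cong-≗ {N} (λ v → *-assoc (is x) _ (ψ v)) ⟩
                   ∑[ v < N ] (is x * ((A ⊗) (vec x) (vec v) * ψ v))
                     ≡⟨ *-distribˡ-sum {N} (is x) (λ v → (A ⊗) (vec x) (vec v) * ψ v) ⟨
                   is x * ∑[ v < N ] ((A ⊗) (vec x) (vec v) * ψ v)
                     ≡⟨ cong (is x *_) (∑ⱽ-toVec (λ y → (A ⊗) (vec x) y * (w ⊗) (vec u₀) y)) ⟨
                   is x * ∑ⱽ (λ y → (A ⊗) (vec x) y * (w ⊗) (vec u₀) y) ∎) ⟩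
            ∑[ x < N ] (is x * ∑ⱽ (λ y → (A ⊗) (vec x) y * (w ⊗) (vec u₀) y)) ∎
            where
            rotate : ∀ a b c → a * (b * c) ≡ b * a * c
            rotate = solve 3 (λ a b c → a :* (b :* c) := b :* a :* c) refl
              where open +-*-Solver

    module _ (k : ℕ) .{{_ : NonZero (k + k)}} where

      open Types A A-sym {k}

      private
        N : ℕ
        N = order G ^ (k + k)

        vec : Fin N → Vec (Fin (order G)) (k + k)
        vec = toVec

        left right : Fin N → Vec (Fin (order G)) k
        left  u = take k (vec u)
        right u = drop k (vec u)

        left++right : ∀ u → left u ++ right u ≡ vec u
        left++right u = take++drop≡id k (vec u)

      -- Between two types σ and τ the tensor power is biregular.  Pairing a vertex of type σ with one
      -- of type τ, in either order, equalises the degrees on the two sides.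
      module Swap (σ τ : Fin P) where

        V : Fin N → Set
        V u = (type (left u) ≡ σ × type (right u) ≡ τ) ⊎ (type (left u) ≡ τ × type (right u) ≡ σ)

        V? : ∀ u → Dec (V u)
        V? u = ((type (left u) Fin.≟ σ) ×-dec (type (right u) Fin.≟ τ)) ⊎-dec
               ((type (left u) Fin.≟ τ) ×-dec (type (right u) Fin.≟ σ))

        E : Fin N → Fin N → Set
        E u v = V u × (type (left v) ≡ type (right u) × type (right v) ≡ type (left u)) × Adj (tensorPower G (k + k)) u v

        E? : ∀ u v → Dec (E u v)
        E? u v = V? u ×-dec ((type (left v) Fin.≟ type (right u)) ×-dec (type (right v) Fin.≟ type (left u)))
                      ×-dec adj? (tensorPower G (k + k)) u v

        E⇒V : ∀ {u v} → E u v → V v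
        E⇒V (inj₁ (l , r) , (p , q) , _) = inj₂ (trans p r , trans q l)
        E⇒V (inj₂ (l , r) , (p , q) , _) = inj₁ (trans p r , trans q l)

        vs : Subset N
        vs = tabulate (does ∘ V?)

        V⇒∈ : ∀ {u} → V u → u ∈ vs
        V⇒∈ {u} Vu = lookup⇒[]= u vs (trans (lookup∘tabulate (does ∘ V?) u) (dec-true (V? u) Vu))

        ∈⇒V : ∀ {u} → u ∈ vs → V u
        ∈⇒V {u} u∈ = does≡true (V? u) (trans (sym (lookup∘tabulate (does ∘ V?) u)) ([]=⇒lookup u∈))
          where
          does≡true : {P : Set} (d : Dec P) → does d ≡ true → P
          does≡true (yes p) _ = p

        swapGraph : ∃[ u ] V u → Subgraph (tensorPower G (k + k))
        swapGraph (u₀ , Vu₀) = record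
          { vertices  = vs
          ; inhabited = u₀ , V⇒∈ Vu₀
          ; Edge      = E
          ; edge?     = E?
          ; edge-symm = λ { {u} {v} e@(_ , (p , q) , a) → E⇒V e , (sym q , sym p) , symm (tensorPower G (k + k)) {u} {v} a }
          ; edge⇒adj  = proj₂ ∘ proj₂
          ; edge⇒∈    = λ e → V⇒∈ (proj₁ e) , V⇒∈ (E⇒V e)
          }

        -- The halves of a neighbour are chosen independently: the left one among the neighbours of
        -- `left u` having the type of `right u`, the right one the other way round.
        sum-E : ∀ u → V u → ∑[ v < N ] ⟦ E? u v ⟧ ≡ D (left u) (type (right u)) * D (right u) (type (left u))
        sum-E u Vu = begin
          ∑[ v < N ] ⟦ E? u v ⟧                              ≡⟨ sum-cong-≗ {N} ⟦E?⟧ ⟩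
          ∑[ v < N ] f (vec v)                             ≡⟨ ∑ⱽ-toVec f ⟨
          ∑ⱽ f                                               ≡⟨ ∑ⱽ-++ k f ⟩
          ∑ⱽ (λ x → ∑ⱽ (λ y → f (x ++ y)))
            ≡⟨ ∑ⱽ-cong (λ x → trans (∑ⱽ-cong (f-++ x)) (∑ⱽ-*ˡ ((A ⊗) l x * is (type r) x) (λ y → (A ⊗) r y * is (type l) y))) ⟩
          ∑ⱽ (λ x → (A ⊗) l x * is (type r) x * D r (type l)) ≡⟨ ∑ⱽ-*ʳ (λ x → (A ⊗) l x * is (type r) x) (D r (type l)) ⟩
          D l (type r) * D r (type l)                        ∎
          where
          open ≡-Reasoning
          l = left u
          r = right u
          f : Vec (Fin (order G)) (k + k) → ℕ
          f z = is (type r) (take k z) * is (type l) (drop k z) * (A ⊗) (l ++ r) z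
          f-++ : ∀ x y → f (x ++ y) ≡ (A ⊗) l x * is (type r) x * ((A ⊗) r y * is (type l) y)
          f-++ x y with ++-injective (take k (x ++ y)) x (take++drop≡id k (x ++ y))
          ... | p , q rewrite p | q | ⊗-++ A l x {r} {y} =
            solve 4 (λ a b c d → a :* b :* (c :* d) := c :* a :* (d :* b)) refl
              (is (type r) x) (is (type l) y) ((A ⊗) l x) ((A ⊗) r y)
            where open +-*-Solver
          ⟦E?⟧ : ∀ v → ⟦ E? u v ⟧ ≡ f (vec v)
          ⟦E?⟧ v = begin
            ⟦ E? u v ⟧                           ≡⟨ ⟦×⟧ (V? u) (types ×-dec adj) ⟩
            ⟦ V? u ⟧ * ⟦ types ×-dec adj ⟧       ≡⟨ cong (_* ⟦ types ×-dec adj ⟧) (⟦yes⟧ (V? u) Vu) ⟩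
            1 * ⟦ types ×-dec adj ⟧              ≡⟨ *-identityˡ _ ⟩
            ⟦ types ×-dec adj ⟧                  ≡⟨ ⟦×⟧ types adj ⟩
            ⟦ types ⟧ * ⟦ adj ⟧
              ≡⟨ cong₂ _*_ (⟦×⟧ (type (left v) Fin.≟ type r) (type (right v) Fin.≟ type l))
                           (trans (⟦adj?⟧ (k + k) u v) (cong (λ z → (A ⊗) z (vec v)) (sym (left++right u)))) ⟩
            f (vec v) ∎
            where
            types = (type (left v) Fin.≟ type r) ×-dec (type (right v) Fin.≟ type l)
            adj = adj? (tensorPower G (k + k)) u v

      -- A vertex of the power with exponent `k + k` is a pair of vertices of the `k`-th power.
      -- Maximising over single vertices thus covers all pairs of realised types, and the maximiser
      -- also inhabits the subgraph.
      regular-subgraph : Σ[ F ∈ Subgraph (tensorPower G (k + k)) ] ∃[ Δ ]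
                         IsRegular F Δ × (∀ x y → D x (type y) * D y (type x) ≤ Δ)
      regular-subgraph = swapGraph (u₀ , inj₁ (refl , refl)) , value u₀ , regular , maximal
        where
        value : Fin N → ℕ
        value u = D (left u) (type (right u)) * D (right u) (type (left u))
        best : ∃[ u ] (∀ v → value v ≤ value u)
        best = ∃argmax {{m^n≢0 (order G) (k + k) {{nonempty G}}}} value
        u₀ = proj₁ best
        open Swap (type (left u₀)) (type (right u₀))
        regular : IsRegular (swapGraph (u₀ , inj₁ (refl , refl))) (value u₀)
        regular v v∈ = trans (degree≡sum (swapGraph (u₀ , inj₁ (refl , refl))) v) (trans (sum-E v (∈⇒V v∈)) (same (∈⇒V v∈)))
          where
          same : V v → value v ≡ value u₀
          same (inj₁ (p , q)) = cong₂ _*_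
            (trans (cong (D (left v)) q) (D-cong (left v) (left u₀) (type (right u₀)) p))
            (trans (cong (D (right v)) p) (D-cong (right v) (right u₀) (type (left u₀)) q))
          same (inj₂ (p , q)) = trans (cong₂ _*_
            (trans (cong (D (left v)) q) (D-cong (left v) (right u₀) (type (left u₀)) p))
            (trans (cong (D (right v)) p) (D-cong (right v) (left u₀) (type (right u₀)) q)))
            (*-comm (D (right u₀) (type (left u₀))) _)
        maximal : ∀ x y → D x (type y) * D y (type x) ≤ value u₀
        maximal x y = subst (_≤ value u₀) (cong₂ (λ x y → D x (type y) * D y (type x)) left≡ right≡) (proj₂ best u)
          where
          u = fromVec (x ++ y)
          halves : left u ≡ x × right u ≡ y
          halves = ++-injective (left u) x (trans (left++right u) (toVec-fromVec (x ++ y)))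
          left≡ = proj₁ halves
          right≡ = proj₂ halves

-- Rational arithmetic, clearing of denominators, geometric decay.

module Rationals where

  open import Algebra.Properties.Semiring.Sum (CommutativeRing.semiring ℚ.+-*-commutativeRing) using (sum; sum-syntax)
  open import Data.Integer.Solver using (module +-*-Solver)
  open import Data.Maybe.Base using (Maybe; just; nothing)
  open import Data.Rational.Base
  open import Data.Rational.Properties
  open import Tactic.RingSolver.Core.AlmostCommutativeRing using (AlmostCommutativeRing; fromCommutativeRing)

  private variable
    n : ℕ

  ring : AlmostCommutativeRing _ _
  ring = fromCommutativeRing +-*-commutativeRing 0≟
    where
    0≟ : ∀ x → Maybe (0ℚ ≡ x)
    0≟ x with 0ℚ ≟ x
    ... | yes p = just p
    ... | no  _ = nothing

  0≤1 : 0ℚ ≤ 1ℚ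
  0≤1 = nonNegative⁻¹ 1ℚ

  x+[y-x]≡y : ∀ x y → x + (y - x) ≡ y
  x+[y-x]≡y = solve-∀ ring

  ≤⇒0≤- : ∀ {x y} → x ≤ y → 0ℚ ≤ y - x
  ≤⇒0≤- {x} {y} x≤y = subst (_≤ y - x) (+-inverseʳ x) (+-monoˡ-≤ (- x) x≤y)

  ≤-by : ∀ {x y} z → y ≡ x + z → 0ℚ ≤ z → x ≤ y
  ≤-by {x} z eq 0≤z = subst (_ ≤_) (sym eq) (subst (_≤ x + z) (+-identityʳ x) (+-monoʳ-≤ x 0≤z))

  0≤+ : ∀ {x y} → 0ℚ ≤ x → 0ℚ ≤ y → 0ℚ ≤ x + y
  0≤+ = +-mono-≤

  0<+ : ∀ {x y} → 0ℚ < x → 0ℚ ≤ y → 0ℚ < x + y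
  0<+ = +-mono-<-≤

  *-monoˡ : ∀ {r x y} → 0ℚ ≤ r → x ≤ y → r * x ≤ r * y
  *-monoˡ {r} 0≤r = *-monoˡ-≤-nonNeg r {{nonNegative 0≤r}}

  *-monoʳ : ∀ {r x y} → 0ℚ ≤ r → x ≤ y → x * r ≤ y * r
  *-monoʳ {r} 0≤r = *-monoʳ-≤-nonNeg r {{nonNegative 0≤r}}

  *-mono : ∀ {x y z w} → 0ℚ ≤ x → 0ℚ ≤ w → x ≤ y → z ≤ w → x * z ≤ y * w
  *-mono 0≤x 0≤w x≤y z≤w = ≤-trans (*-monoˡ 0≤x z≤w) (*-monoʳ 0≤w x≤y)

  0≤* : ∀ {x y} → 0ℚ ≤ x → 0ℚ ≤ y → 0ℚ ≤ x * y
  0≤* {x} {y} 0≤x 0≤y = subst (_≤ x * y) (*-zeroʳ x) (*-monoˡ 0≤x 0≤y)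

  0<* : ∀ {x y} → 0ℚ < x → 0ℚ < y → 0ℚ < x * y
  0<* {x} {y} 0<x 0<y = positive⁻¹ (x * y) {{pos*pos⇒pos x {{positive 0<x}} y {{positive 0<y}}}}

  reciprocal : ∀ x → 0ℚ < x → Σ[ y ∈ ℚ ] 0ℚ < y × x * y ≡ 1ℚ
  reciprocal x 0<x = 1/ x , positive⁻¹ _ {{1/pos⇒pos x}} , *-inverseʳ x
    where instance
      x⁺ = positive 0<x
      x≢0 = pos⇒nonZero x

  half : ∀ ε → 0ℚ < ε → Σ[ δ ∈ ℚ ] 0ℚ < δ × δ + δ ≡ ε
  half ε 0<ε = ½ * ε , 0<* (positive⁻¹ ½) 0<ε , trans (sym (*-distribʳ-+ ε ½ ½)) (*-identityˡ ε)

  ∣∣≤ : ∀ {x y} → x ≤ y → - x ≤ y → ∣ x ∣ ≤ y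
  ∣∣≤ {x} {y} p q with ∣p∣≡p∨∣p∣≡-p x
  ... | inj₁ eq = subst (_≤ y) (sym eq) p
  ... | inj₂ eq = subst (_≤ y) (sym eq) q

  ≤∣∣ : ∀ x → x ≤ ∣ x ∣
  ≤∣∣ x with ≤-total 0ℚ x
  ... | inj₁ 0≤x = ≤-reflexive (sym (0≤p⇒∣p∣≡p 0≤x))
  ... | inj₂ x≤0 = ≤-trans x≤0 (0≤∣p∣ x)

  -≤∣∣ : ∀ x → - x ≤ ∣ x ∣
  -≤∣∣ x = subst (- x ≤_) (∣-p∣≡∣p∣ x) (≤∣∣ (- x))

  ∣-∣-sym : ∀ x y → ∣ x - y ∣ ≡ ∣ y - x ∣
  ∣-∣-sym x y = trans (sym (∣-p∣≡∣p∣ (x - y))) (cong ∣_∣ (flip x y))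
    where
    flip : ∀ x y → - (x - y) ≡ y - x
    flip = solve-∀ ring

  ∣-∣≤⇒≤+ : ∀ {x y ε} → ∣ x - y ∣ ≤ ε → x ≤ y + ε
  ∣-∣≤⇒≤+ {x} {y} {ε} h = subst (_≤ y + ε) (x+[y-x]≡y y x) (+-monoʳ-≤ y (≤-trans (≤∣∣ (x - y)) h))

  ∣-∣-triangle : ∀ x y z → ∣ x - z ∣ ≤ ∣ x - y ∣ + ∣ y - z ∣
  ∣-∣-triangle x y z = subst (λ t → ∣ t ∣ ≤ ∣ x - y ∣ + ∣ y - z ∣) (split x y z) (∣p+q∣≤∣p∣+∣q∣ (x - y) (y - z))
    where
    split : ∀ x y z → (x - y) + (y - z) ≡ x - z
    split = solve-∀ ring

  0≤² : ∀ x → 0ℚ ≤ x * x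
  0≤² x = subst (0ℚ ≤_) (square x) (0≤* (0≤∣p∣ x) (0≤∣p∣ x))
    where
    neg-square : ∀ x → (- x) * (- x) ≡ x * x
    neg-square = solve-∀ ring
    square : ∀ x → ∣ x ∣ * ∣ x ∣ ≡ x * x
    square x with ∣p∣≡p∨∣p∣≡-p x
    ... | inj₁ eq = cong₂ _*_ eq eq
    ... | inj₂ eq = trans (cong₂ _*_ eq eq) (neg-square x)

  ∣x∣²≡x² : ∀ x → ∣ x ∣ * ∣ x ∣ ≡ x * x
  ∣x∣²≡x² x = trans (sym (∣p*q∣≡∣p∣*∣q∣ x x)) (0≤p⇒∣p∣≡p (0≤² x))

  infixr 8 _^_
  _^_ : ℚ → ℕ → ℚ
  x ^ zero  = 1ℚ
  x ^ suc k = x * x ^ k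

  0≤^ : ∀ {x} k → 0ℚ ≤ x → 0ℚ ≤ x ^ k
  0≤^ zero    0≤x = 0≤1
  0≤^ (suc k) 0≤x = 0≤* 0≤x (0≤^ k 0≤x)

  1≤^ : ∀ {x} k → 1ℚ ≤ x → 1ℚ ≤ x ^ k
  1≤^ zero    1≤x = ≤-refl
  1≤^ {x} (suc k) 1≤x = ≤-trans 1≤x (subst (_≤ x * x ^ k) (*-identityʳ x) (*-monoˡ (≤-trans 0≤1 1≤x) (1≤^ k 1≤x)))

  *-interchange : ∀ a b c d → a * b * (c * d) ≡ a * c * (b * d)
  *-interchange = solve-∀ ring

  *-^-distrib : ∀ x y k → (x * y) ^ k ≡ x ^ k * y ^ k
  *-^-distrib x y zero    = refl
  *-^-distrib x y (suc k) = trans (cong (x * y *_) (*-^-distrib x y k)) (*-interchange x y (x ^ k) (y ^ k))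

  sum-mono : {f g : Fin n → ℚ} → (∀ i → f i ≤ g i) → sum f ≤ sum g
  sum-mono {zero}  f≤g = ≤-refl
  sum-mono {suc n} f≤g = +-mono-≤ (f≤g zero) (sum-mono (f≤g ∘ suc))

  0≤sum : {f : Fin n → ℚ} → (∀ i → 0ℚ ≤ f i) → 0ℚ ≤ sum f
  0≤sum {zero}  0≤f = ≤-refl
  0≤sum {suc n} 0≤f = 0≤+ (0≤f zero) (0≤sum (0≤f ∘ suc))

  term≤sum : {f : Fin n → ℚ} → (∀ i → 0ℚ ≤ f i) → ∀ i → f i ≤ sum f
  term≤sum {suc n} {f} 0≤f zero    = ≤-by (sum (f ∘ suc)) refl (0≤sum (0≤f ∘ suc))
  term≤sum {suc n} {f} 0≤f (suc i) = ≤-trans (term≤sum (0≤f ∘ suc) i) (≤-by (f zero) (+-comm (f zero) _) (0≤f zero))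

  ∣sum∣≤ : (f : Fin n → ℚ) → ∣ sum f ∣ ≤ ∑[ i < n ] ∣ f i ∣
  ∣sum∣≤ {zero}  f = ≤-refl
  ∣sum∣≤ {suc n} f = ≤-trans (∣p+q∣≤∣p∣+∣q∣ (f zero) (sum (f ∘ suc))) (+-monoʳ-≤ ∣ f zero ∣ (∣sum∣≤ (f ∘ suc)))

  ι : ℕ → ℚ
  ι n = ℤ.+ n / 1

  toℚᵘ-ι : ∀ n → toℚᵘ (ι n) ℚᵘ.≃ ℚᵘ.mkℚᵘ (ℤ.+ n) 0
  toℚᵘ-ι n = toℚᵘ-fromℚᵘ (ℚᵘ.mkℚᵘ (ℤ.+ n) 0)

  ι-+ : ∀ m n → ι (m ℕ.+ n) ≡ ι m + ι n
  ι-+ m n = toℚᵘ-injective (begin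
    toℚᵘ (ι (m ℕ.+ n))                                       ≈⟨ toℚᵘ-ι (m ℕ.+ n) ⟩
    ℚᵘ.mkℚᵘ (ℤ.+ (m ℕ.+ n)) 0                                ≈⟨ ℚᵘ.*≡* (eq (ℤ.+ m) (ℤ.+ n)) ⟩
    ℚᵘ.mkℚᵘ (ℤ.+ m) 0 ℚᵘ.+ ℚᵘ.mkℚᵘ (ℤ.+ n) 0                 ≈⟨ ℚᵘ.+-cong (toℚᵘ-ι m) (toℚᵘ-ι n) ⟨
    toℚᵘ (ι m) ℚᵘ.+ toℚᵘ (ι n)                               ≈⟨ toℚᵘ-homo-+ (ι m) (ι n) ⟨
    toℚᵘ (ι m + ι n)                                         ∎)
    where
    open ℚᵘ.≃-Reasoning
    open +-*-Solver
    eq : ∀ a b → (a ℤ.+ b) ℤ.* ℤ.1ℤ ≡ (a ℤ.* ℤ.1ℤ ℤ.+ b ℤ.* ℤ.1ℤ) ℤ.* ℤ.1ℤ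
    eq = solve 2 (λ a b → (a :+ b) :* con ℤ.1ℤ := (a :* con ℤ.1ℤ :+ b :* con ℤ.1ℤ) :* con ℤ.1ℤ) refl

  ι-* : ∀ m n → ι (m ℕ.* n) ≡ ι m * ι n
  ι-* m n = toℚᵘ-injective (begin
    toℚᵘ (ι (m ℕ.* n))                                       ≈⟨ toℚᵘ-ι (m ℕ.* n) ⟩
    ℚᵘ.mkℚᵘ (ℤ.+ (m ℕ.* n)) 0                                ≈⟨ ℚᵘ.*≡* (cong (ℤ._* ℤ.1ℤ) (ℤ.pos-* m n)) ⟩
    ℚᵘ.mkℚᵘ (ℤ.+ m) 0 ℚᵘ.* ℚᵘ.mkℚᵘ (ℤ.+ n) 0                 ≈⟨ ℚᵘ.*-cong (toℚᵘ-ι m) (toℚᵘ-ι n) ⟨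
    toℚᵘ (ι m) ℚᵘ.* toℚᵘ (ι n)                               ≈⟨ toℚᵘ-homo-* (ι m) (ι n) ⟨
    toℚᵘ (ι m * ι n)                                         ∎)
    where open ℚᵘ.≃-Reasoning

  ι-mono : ∀ {m n} → m ℕ.≤ n → ι m ≤ ι n
  ι-mono {m} {n} m≤n = toℚᵘ-cancel-≤ (ℚᵘ.≤-respˡ-≃ (ℚᵘ.≃-sym (toℚᵘ-ι m)) (ℚᵘ.≤-respʳ-≃ (ℚᵘ.≃-sym (toℚᵘ-ι n))
    (ℚᵘ.*≤* (ℤ.*-monoʳ-≤-nonNeg ℤ.1ℤ (ℤ.+≤+ m≤n)))))

  ι-cancel-≤ : ∀ {m n} → ι m ≤ ι n → m ℕ.≤ n
  ι-cancel-≤ {m} {n} le = ℤ.drop‿+≤+ (ℤ.*-cancelʳ-≤-pos (ℤ.+ m) (ℤ.+ n) ℤ.1ℤ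
    (ℚᵘ.drop-*≤* (ℚᵘ.≤-respˡ-≃ (toℚᵘ-ι m) (ℚᵘ.≤-respʳ-≃ (toℚᵘ-ι n) (toℚᵘ-mono-≤ le)))))

  0≤ι : ∀ n → 0ℚ ≤ ι n
  0≤ι n = ι-mono {0} {n} ℕ.z≤n

  ι-^ : ∀ m k → ι (m ℕ.^ k) ≡ ι m ^ k
  ι-^ m zero    = refl
  ι-^ m (suc k) = trans (ι-* m (m ℕ.^ k)) (cong (ι m *_) (ι-^ m k))

  fraction : ∀ x → 0ℚ ≤ x → ∃[ p ] ∃[ q ] 1 ℕ.≤ q × ι q * x ≡ ι p
  fraction x@(mkℚ (ℤ.-[1+ _ ]) _ _) 0≤x with nonNegative 0≤x
  ... | ()
  fraction x@(mkℚ (ℤ.+ p) q-1 c) 0≤x = p , suc q-1 , ℕ.s≤s ℕ.z≤n , toℚᵘ-injective (begin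
    toℚᵘ (ι (suc q-1) * x)                        ≈⟨ toℚᵘ-homo-* (ι (suc q-1)) x ⟩
    toℚᵘ (ι (suc q-1)) ℚᵘ.* toℚᵘ x                ≈⟨ ℚᵘ.*-congʳ (toℚᵘ-ι (suc q-1)) ⟩
    ℚᵘ.mkℚᵘ (ℤ.+ suc q-1) 0 ℚᵘ.* toℚᵘ x           ≈⟨ ℚᵘ.*≡* (eq (ℤ.+ suc q-1) (ℤ.+ p)) ⟩
    ℚᵘ.mkℚᵘ (ℤ.+ p) 0                             ≈⟨ toℚᵘ-ι p ⟨
    toℚᵘ (ι p)                                    ∎)
    where
    open ℚᵘ.≃-Reasoning
    open +-*-Solver
    eq : ∀ q p → (q ℤ.* p) ℤ.* ℤ.1ℤ ≡ p ℤ.* (ℤ.1ℤ ℤ.* q)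
    eq = solve 2 (λ q p → (q :* p) :* con ℤ.1ℤ := p :* (con ℤ.1ℤ :* q)) refl

  archimedean : ∀ x → ∃[ m ] x ≤ ι m
  archimedean x with fraction ∣ x ∣ (0≤∣p∣ x)
  ... | p , q , 1≤q , eq = p , (begin
    x                ≤⟨ ≤∣∣ x ⟩
    ∣ x ∣            ≡⟨ *-identityˡ ∣ x ∣ ⟨
    ι 1 * ∣ x ∣      ≤⟨ *-monoʳ (0≤∣p∣ x) (ι-mono 1≤q) ⟩
    ι q * ∣ x ∣      ≡⟨ eq ⟩
    ι p              ∎)
    where open ≤-Reasoning

  common-denominator : (f : Fin n → ℚ) → (∀ i → 0ℚ ≤ f i) →
    ∃[ q ] 1 ℕ.≤ q × Σ[ g ∈ (Fin n → ℕ) ] (∀ i → ι q * f i ≡ ι (g i))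
  common-denominator {zero}  f 0≤f = 1 , ℕ.≤-refl , (λ ()) , λ ()
  common-denominator {suc n} f 0≤f with fraction (f zero) (0≤f zero) | common-denominator (f ∘ suc) (0≤f ∘ suc)
  ... | p , q , 1≤q , eq | r , 1≤r , g , eqs = r ℕ.* q , ℕ.*-mono-≤ 1≤r 1≤q , h , h-eq
    where
    rotate : ∀ a b c → a * b * c ≡ b * (a * c)
    rotate = solve-∀ ring
    h : Fin (suc n) → ℕ
    h zero    = r ℕ.* p
    h (suc i) = q ℕ.* g i
    h-eq : ∀ i → ι (r ℕ.* q) * f i ≡ ι (h i)
    h-eq zero = trans (cong (_* f zero) (ι-* r q)) (trans (*-assoc (ι r) (ι q) (f zero))
      (trans (cong (ι r *_) eq) (sym (ι-* r p))))
    h-eq (suc i) = trans (cong (_* f (suc i)) (ι-* r q)) (trans (rotate (ι r) (ι q) (f (suc i)))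
      (trans (cong (ι q *_) (eqs i)) (sym (ι-* q (g i)))))

  -- Bernoulli's inequality without division. The induction step rests on (1 - θ)(1 + (i + 1)θ) = 1
  -- + iθ - (i + 1)θ².
  bernoulli : ∀ {θ} → 0ℚ ≤ θ → θ ≤ 1ℚ → ∀ i → (1ℚ - θ) ^ i * (1ℚ + ι i * θ) ≤ 1ℚ
  bernoulli {θ} 0≤θ θ≤1 zero = ≤-reflexive (eq θ)
    where
    eq : ∀ θ → 1ℚ * (1ℚ + 0ℚ * θ) ≡ 1ℚ
    eq = solve-∀ ring
  bernoulli {θ} 0≤θ θ≤1 (suc i) = ≤-trans
    (≤-by (g ^ i * (θ * (θ * (1ℚ + ι i))))
      (trans (eq θ (g ^ i) (ι i)) (cong (λ t → g * g ^ i * (1ℚ + t * θ) + g ^ i * (θ * (θ * (1ℚ + ι i)))) (sym (ι-+ 1 i))))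
      (0≤* (0≤^ i (≤⇒0≤- θ≤1)) (0≤* 0≤θ (0≤* 0≤θ (0≤+ 0≤1 (0≤ι i))))))
    (bernoulli 0≤θ θ≤1 i)
    where
    g = 1ℚ - θ
    eq : ∀ θ G i → G * (1ℚ + i * θ) ≡ (1ℚ - θ) * G * (1ℚ + (1ℚ + i) * θ) + G * (θ * (θ * (1ℚ + i)))
    eq = solve-∀ ring

  -- By `bernoulli`, iθ(1 - θ)^i ≤ 1, so any N ≥ C / (θε) will do.
  geometric→0 : ∀ {θ} → 0ℚ < θ → θ ≤ 1ℚ → ∀ C → 0ℚ ≤ C → ∀ ε → 0ℚ < ε →
                ∃[ N ] (∀ i → N ℕ.≤ i → C * (1ℚ - θ) ^ i ≤ ε)
  geometric→0 {θ} 0<θ θ≤1 C 0≤C ε 0<ε with reciprocal (θ * ε) (0<* 0<θ 0<ε)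
  ... | ρ , 0<ρ , θερ≡1 with archimedean (C * ρ)
  ...   | N , Cρ≤N = N , λ i N≤i → begin
    C * g ^ i                        ≤⟨ *-monoʳ (0≤^ i 0≤g) (C≤ i N≤i) ⟩
    ι i * (θ * ε) * g ^ i            ≤⟨ ≤-by (ε * g ^ i) (eq (ι i) θ ε (g ^ i)) (0≤* (<⇒≤ 0<ε) (0≤^ i 0≤g)) ⟩
    ε * (g ^ i * (1ℚ + ι i * θ))     ≤⟨ *-monoˡ (<⇒≤ 0<ε) (bernoulli (<⇒≤ 0<θ) θ≤1 i) ⟩
    ε * 1ℚ                           ≡⟨ *-identityʳ ε ⟩
    ε                                ∎
    where
    open ≤-Reasoning
    g = 1ℚ - θ
    0≤g = ≤⇒0≤- θ≤1
    eq : ∀ i θ ε G → ε * (G * (1ℚ + i * θ)) ≡ i * (θ * ε) * G + ε * G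
    eq = solve-∀ ring
    cancel : ∀ a b c → a * b ≡ 1ℚ → c ≡ c * b * a
    cancel a b c ab≡1 = trans (sym (*-identityʳ c)) (trans (cong (c *_) (trans (sym ab≡1) (*-comm a b))) (sym (*-assoc c b a)))
    C≤ : ∀ i → N ℕ.≤ i → C ≤ ι i * (θ * ε)
    C≤ i N≤i = begin
      C                    ≡⟨ cancel (θ * ε) ρ C θερ≡1 ⟩
      C * ρ * (θ * ε)      ≤⟨ *-monoʳ (<⇒≤ (0<* 0<θ 0<ε)) (≤-trans Cρ≤N (ι-mono N≤i)) ⟩
      ι i * (θ * ε)        ∎

  -- The decrease of `h` pays for each step of `f`, and what is left at `i` bounds all later
  -- movement.
  telescope : (f h : ℕ → ℚ) → (∀ i → ∣ f (suc i) - f i ∣ ≤ h i - h (suc i)) → (∀ i → 0ℚ ≤ h i) →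
              ∀ i j → i ℕ.≤ j → ∣ f j - f i ∣ ≤ h i
  telescope f h step 0≤h i j i≤j = ≤-trans (go j (ℕ.≤⇒≤′ i≤j)) (≤-by (h j) (eq (h i) (h j)) (0≤h j))
    where
    eq : ∀ a b → a ≡ a - b + b
    eq = solve-∀ ring
    join : ∀ a b c → (c - b) + (a - c) ≡ a - b
    join = solve-∀ ring
    go : ∀ j → i ℕ.≤′ j → ∣ f j - f i ∣ ≤ h i - h j
    go j ℕ.≤′-refl = ≤-reflexive (trans (cong ∣_∣ (+-inverseʳ (f i))) (sym (+-inverseʳ (h i))))
    go (suc j) (ℕ.≤′-step i≤j) = ≤-trans (∣-∣-triangle (f (suc j)) (f j) (f i))
      (subst (∣ f (suc j) - f j ∣ + ∣ f j - f i ∣ ≤_) (join (h i) (h (suc j)) (h j)) (+-mono-≤ (step j) (go j i≤j)))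

-- Perron vectors with an explicit rate of convergence.

module PerronFrobenius where

  open import Algebra.Properties.Semiring.Sum (CommutativeRing.semiring ℚ.+-*-commutativeRing)
    using (sum; sum-syntax; sum-cong-≗; ∑-distrib-+; *-distribˡ-sum; *-distribʳ-sum)
  open import Data.Rational.Base
  open import Data.Rational.Properties
  open import Algebra.Properties.Semiring.Sum ℕ.+-*-semiring using () renaming (sum to ℕsum)
  open Combinatorics using (⟦_⟧; ⟦⟧-mono; ⟦⟧≤1; ⟦yes⟧; ⟦no⟧; sum≤const) renaming (sum-mono to ℕsum-mono)
  open Rationals

  module Reachability {n : ℕ} {Adj : Rel (Fin n) 0ℓ} (adj? : Decidable Adj) (u₀ : Fin n) where

    Reach : ℕ → Fin n → Set
    Reach zero    a = a ≡ u₀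
    Reach (suc j) a = Reach j a ⊎ ∃[ b ] Adj a b × Reach j b

    Reach? : ∀ j a → Dec (Reach j a)
    Reach? zero    a = a Fin.≟ u₀
    Reach? (suc j) a = Reach? j a ⊎-dec Fin.any? (λ b → adj? a b ×-dec Reach? j b)

    reach-u₀ : ∀ j → Reach j u₀
    reach-u₀ zero    = refl
    reach-u₀ (suc j) = inj₁ (reach-u₀ j)

    Stable : ℕ → Set
    Stable N = ∀ a → Reach (suc N) a → Reach N a

    private
      size : ℕ → ℕ
      size j = ℕsum (λ a → ⟦ Reach? j a ⟧)

      grow : ∀ {j a} → Reach (suc j) a → ¬ Reach j a → size j ℕ.< size (suc j)
      grow {j} {a} new ¬old = sum-strict (λ b → ⟦⟧-mono (Reach? j b) (Reach? (suc j) b) inj₁) a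
        (subst₂ ℕ._<_ (sym (⟦no⟧ (Reach? j a) ¬old)) (sym (⟦yes⟧ (Reach? (suc j) a) new)) (ℕ.s≤s ℕ.z≤n))
        where
        sum-strict : ∀ {m} {f g : Fin m → ℕ} → (∀ i → f i ℕ.≤ g i) → ∀ i → f i ℕ.< g i → ℕsum f ℕ.< ℕsum g
        sum-strict f≤g zero    lt = ℕ.+-mono-<-≤ lt (ℕsum-mono (f≤g ∘ suc))
        sum-strict f≤g (suc i) lt = ℕ.+-mono-≤-< (f≤g zero) (sum-strict (f≤g ∘ suc) i lt)

      -- An unstable level is followed by one with at least one more vertex, and no level has more
      -- than `n`; hence the fuel cannot run out.
      search : ∀ fuel j → n ℕ.< size j ℕ.+ fuel → ∃[ N ] Stable N
      search zero j n< = contradiction (ℕ.<-≤-trans n< (ℕ.≤-trans (ℕ.≤-reflexive (ℕ.+-identityʳ (size j)))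
        (ℕ.≤-trans (sum≤const (λ a → ⟦⟧≤1 (Reach? j a)))
                   (ℕ.≤-reflexive (ℕ.*-identityʳ n))))) (ℕ.<-irrefl refl)
      search (suc fuel) j n< with Fin.any? (λ a → Reach? (suc j) a ×-dec ¬? (Reach? j a))
      ... | yes (a , new , ¬old) = search fuel (suc j) (ℕ.<-≤-trans n<
        (subst (ℕ._≤ size (suc j) ℕ.+ fuel) (sym (ℕ.+-suc (size j) fuel)) (ℕ.+-monoˡ-≤ fuel (grow new ¬old))))
      ... | no ∄a = j , λ a new → decidable-stable (Reach? j a) (λ ¬old → ∄a (a , new , ¬old))

    opaque
      eccentricity : ℕ
      eccentricity = proj₁ (search (suc n) 0 (ℕ.m≤n+m (suc n) (size 0)))

      stable : Stable eccentricity
      stable = proj₂ (search (suc n) 0 (ℕ.m≤n+m (suc n) (size 0)))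

  -- With s = 1 / p and t = 1 / q this compares X / q to Y / p. Both X p and Y q lie between α Y p
  -- and β Y p, while p / q ≤ 1 and Y / p ≤ k.
  ratio-difference : ∀ {X Y p q s t α β k} → 0ℚ ≤ Y → 0ℚ ≤ p → 0ℚ ≤ s → 0ℚ ≤ t → p * s ≡ 1ℚ → q * t ≡ 1ℚ → p ≤ q →
    α * Y ≤ X → X ≤ β * Y → α * p ≤ q → q ≤ β * p → 0ℚ ≤ β - α → Y * s ≤ k →
    ∣ X * t - Y * s ∣ ≤ (β - α) * k
  ratio-difference {X} {Y} {p} {q} {s} {t} {α} {β} {k} 0≤Y 0≤p 0≤s 0≤t ps≡1 qt≡1 p≤q αY≤X X≤βY αp≤q q≤βp 0≤β-α Ys≤k = ∣∣≤
    (begin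
      X * t - Y * s                         ≡⟨ common ⟩
      (X * p - Y * q) * (s * t)             ≤⟨ *-monoʳ 0≤st (+-mono-≤ (*-monoʳ 0≤p X≤βY) (neg-antimono-≤ (*-monoˡ 0≤Y αp≤q))) ⟩
      (β * Y * p - Y * (α * p)) * (s * t)   ≤⟨ bound ⟩
      (β - α) * k                           ∎)
    (begin
      - (X * t - Y * s)                     ≡⟨ cong -_ common ⟩
      - ((X * p - Y * q) * (s * t))         ≡⟨ flip (X * p) (Y * q) (s * t) ⟩
      (Y * q - X * p) * (s * t)             ≤⟨ *-monoʳ 0≤st (+-mono-≤ (*-monoˡ 0≤Y q≤βp) (neg-antimono-≤ (*-monoʳ 0≤p αY≤X))) ⟩
      (Y * (β * p) - α * Y * p) * (s * t)   ≡⟨ cong (_* (s * t)) (swap α β Y p) ⟩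
      (β * Y * p - Y * (α * p)) * (s * t)   ≤⟨ bound ⟩
      (β - α) * k                           ∎)
    where
    open ≤-Reasoning
    0≤st = 0≤* 0≤s 0≤t
    common : X * t - Y * s ≡ (X * p - Y * q) * (s * t)
    common = trans
      (cong₂ _-_ (trans (sym (*-identityʳ (X * t))) (cong (X * t *_) (sym ps≡1)))
                 (trans (sym (*-identityʳ (Y * s))) (cong (Y * s *_) (sym qt≡1))))
      (rearrange X Y s t p q)
      where
      rearrange : ∀ X Y s t p q → X * t * (p * s) - Y * s * (q * t) ≡ (X * p - Y * q) * (s * t)
      rearrange = solve-∀ ring
    flip : ∀ a b c → - ((a - b) * c) ≡ (b - a) * c
    flip = solve-∀ ring
    swap : ∀ α β Y p → Y * (β * p) - α * Y * p ≡ β * Y * p - Y * (α * p)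
    swap = solve-∀ ring
    pt≤1 : p * t ≤ 1ℚ
    pt≤1 = ≤-trans (*-monoʳ 0≤t p≤q) (≤-reflexive qt≡1)
    bound : (β * Y * p - Y * (α * p)) * (s * t) ≤ (β - α) * k
    bound = begin
      (β * Y * p - Y * (α * p)) * (s * t)   ≡⟨ factor α β Y p s t ⟩
      (β - α) * (Y * s) * (p * t)           ≤⟨ *-monoˡ (0≤* 0≤β-α (0≤* 0≤Y 0≤s)) pt≤1 ⟩
      (β - α) * (Y * s) * 1ℚ                ≡⟨ *-identityʳ ((β - α) * (Y * s)) ⟩
      (β - α) * (Y * s)                     ≤⟨ *-monoˡ 0≤β-α Ys≤k ⟩
      (β - α) * k                           ∎
      where
      factor : ∀ α β Y p s t → (β * Y * p - Y * (α * p)) * (s * t) ≡ (β - α) * (Y * s) * (p * t)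
      factor = solve-∀ ring

  -- Perron–Frobenius for the component of u₀ by power iteration.  The operator B = I + A is
  -- iterated in blocks of N steps, N the eccentricity of u₀: B ^ N spreads the mass of any vector at
  -- u₀ over the whole component, which makes the bounds α y ≤ X ≤ β y between two iterates
  -- contract geometrically.
  module PowerIteration {n : ℕ} {Adj : Rel (Fin n) 0ℓ} (adj? : Decidable Adj) (symm : Symmetric Adj) (u₀ : Fin n) where

    open Reachability adj? u₀

    A : Fin n → Fin n → ℚ
    A a b = if does (adj? a b) then 1ℚ else 0ℚ

    A-adj : ∀ {a b} → Adj a b → A a b ≡ 1ℚ
    A-adj {a} {b} ab with adj? a b
    ... | yes _  = refl
    ... | no ¬ab = contradiction ab ¬ab

    0≤A : ∀ a b → 0ℚ ≤ A a b
    0≤A a b with adj? a b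
    ... | yes _ = 0≤1
    ... | no  _ = ≤-refl

    A≤1 : ∀ a b → A a b ≤ 1ℚ
    A≤1 a b with adj? a b
    ... | yes _ = ≤-refl
    ... | no  _ = 0≤1

    Aᵛ : (Fin n → ℚ) → Fin n → ℚ
    Aᵛ f a = ∑[ b < n ] (A a b * f b)

    -- Powers of A alone oscillate on a bipartite component. The added identity prevents this: no
    -- value ever drops, so walks of length at most `N` may be used in place of walks of one exact
    -- length.
    B : (Fin n → ℚ) → Fin n → ℚ
    B f a = f a + Aᵛ f a

    B^ : ℕ → (Fin n → ℚ) → Fin n → ℚ
    B^ zero    f = f
    B^ (suc j) f = B (B^ j f)

    -- An upper bound for the row sums of I + A: one application of `B` raises a uniform bound by at
    -- most this factor.
    κ : ℚ
    κ = 1ℚ + ∑[ b < n ] 1ℚ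

    1≤κ : 1ℚ ≤ κ
    1≤κ = ≤-by (∑[ b < n ] 1ℚ) refl (0≤sum {n} λ _ → 0≤1)

    0≤κ : 0ℚ ≤ κ
    0≤κ = ≤-trans 0≤1 1≤κ

    B-cong : ∀ {f g} → f ≗ g → B f ≗ B g
    B-cong f≗g a = cong₂ _+_ (f≗g a) (sum-cong-≗ λ b → cong (A a b *_) (f≗g b))

    0≤Aᵛ : ∀ {f} → (∀ a → 0ℚ ≤ f a) → ∀ a → 0ℚ ≤ Aᵛ f a
    0≤Aᵛ 0≤f a = 0≤sum λ b → 0≤* (0≤A a b) (0≤f b)

    0≤B : ∀ {f} → (∀ a → 0ℚ ≤ f a) → ∀ a → 0ℚ ≤ B f a
    0≤B 0≤f a = 0≤+ (0≤f a) (0≤Aᵛ 0≤f a)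

    0≤B^ : ∀ j {f} → (∀ a → 0ℚ ≤ f a) → ∀ a → 0ℚ ≤ B^ j f a
    0≤B^ zero    0≤f = 0≤f
    0≤B^ (suc j) 0≤f = 0≤B (0≤B^ j 0≤f)

    f≤B : ∀ {f} → (∀ a → 0ℚ ≤ f a) → ∀ a → f a ≤ B f a
    f≤B 0≤f a = ≤-by _ refl (0≤Aᵛ 0≤f a)

    f≤B^ : ∀ j {f} → (∀ a → 0ℚ ≤ f a) → ∀ a → f a ≤ B^ j f a
    f≤B^ zero    0≤f a = ≤-refl
    f≤B^ (suc j) 0≤f a = ≤-trans (f≤B^ j 0≤f a) (f≤B (0≤B^ j 0≤f) a)

    adj≤B : ∀ {f a b} → (∀ a → 0ℚ ≤ f a) → Adj a b → f b ≤ B f a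
    adj≤B {f} {a} {b} 0≤f ab = begin
      f b            ≡⟨ *-identityˡ (f b) ⟨
      1ℚ * f b       ≡⟨ cong (_* f b) (A-adj ab) ⟨
      A a b * f b    ≤⟨ term≤sum (λ b → 0≤* (0≤A a b) (0≤f b)) b ⟩
      Aᵛ f a         ≤⟨ ≤-by (f a) (+-comm (f a) _) (0≤f a) ⟩
      B f a          ∎
      where open ≤-Reasoning

    B-lin : ∀ f g c a → B (λ b → f b - c * g b) a ≡ B f a - c * B g a
    B-lin f g c a = begin
      (f a - c * g a) + ∑[ b < n ] (A a b * (f b - c * g b))
        ≡⟨ cong (f a - c * g a +_) (sum-cong-≗ λ b → expand (A a b) (f b) c (g b)) ⟩
      (f a - c * g a) + ∑[ b < n ] (A a b * f b + (- c) * (A a b * g b))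
        ≡⟨ cong (f a - c * g a +_) (∑-distrib-+ (λ b → A a b * f b) (λ b → (- c) * (A a b * g b))) ⟩
      (f a - c * g a) + (Aᵛ f a + ∑[ b < n ] ((- c) * (A a b * g b)))
        ≡⟨ cong (λ t → f a - c * g a + (Aᵛ f a + t)) (*-distribˡ-sum (- c) (λ b → A a b * g b)) ⟨
      (f a - c * g a) + (Aᵛ f a + (- c) * Aᵛ g a)
        ≡⟨ collect (f a) c (g a) (Aᵛ f a) (Aᵛ g a) ⟩
      B f a - c * B g a ∎
      where
      open ≡-Reasoning
      expand : ∀ a f c g → a * (f - c * g) ≡ a * f + (- c) * (a * g)
      expand = solve-∀ ring
      collect : ∀ f c g F G → (f - c * g) + (F + (- c) * G) ≡ (f + F) - c * (g + G)
      collect = solve-∀ ring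

    B^-lin : ∀ j f g c a → B^ j (λ b → f b - c * g b) a ≡ B^ j f a - c * B^ j g a
    B^-lin zero    f g c a = refl
    B^-lin (suc j) f g c a = trans (B-cong (B^-lin j f g c) a) (B-lin (B^ j f) (B^ j g) c a)

    B^-B : ∀ j f → B^ j (B f) ≗ B (B^ j f)
    B^-B zero    f a = refl
    B^-B (suc j) f a = B-cong (B^-B j f) a

    B^-comm : ∀ j k f → B^ j (B^ k f) ≗ B^ k (B^ j f)
    B^-comm zero    k f a = refl
    B^-comm (suc j) k f a = trans (B-cong (B^-comm j k f) a) (sym (B^-B k (B^ j f) a))

    B-bound : ∀ {f c} → 0ℚ ≤ c → (∀ a → f a ≤ c) → ∀ a → B f a ≤ κ * c
    B-bound {f} {c} 0≤c f≤c a = begin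
      f a + Aᵛ f a                        ≤⟨ +-mono-≤ (f≤c a) (sum-mono λ b → ≤-trans
                                               (*-monoˡ (0≤A a b) (f≤c b)) (*-monoʳ 0≤c (A≤1 a b))) ⟩
      c + ∑[ b < n ] (1ℚ * c)             ≡⟨ cong (c +_) (*-distribʳ-sum {n} c (λ _ → 1ℚ)) ⟨
      c + (∑[ b < n ] 1ℚ) * c             ≡⟨ factor c (∑[ b < n ] 1ℚ) ⟩
      κ * c                               ∎
      where
      open ≤-Reasoning
      factor : ∀ c s → c + s * c ≡ (1ℚ + s) * c
      factor = solve-∀ ring

    B^-bound : ∀ j {f c} → 0ℚ ≤ c → (∀ a → f a ≤ c) → ∀ a → B^ j f a ≤ κ ^ j * c
    B^-bound zero    0≤c f≤c a = ≤-trans (f≤c a) (≤-reflexive (sym (*-identityˡ _)))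
    B^-bound (suc j) {c = c} 0≤c f≤c a = ≤-trans (B-bound (0≤* (0≤^ j 0≤κ) 0≤c) (B^-bound j 0≤c f≤c) a)
      (≤-reflexive (sym (*-assoc κ (κ ^ j) c)))

    from-u₀ : ∀ j {a f} → Reach j a → (∀ a → 0ℚ ≤ f a) → f u₀ ≤ B^ j f a
    from-u₀ zero    refl 0≤f = ≤-refl
    from-u₀ (suc j) {a} (inj₁ r) 0≤f = ≤-trans (from-u₀ j r 0≤f) (f≤B (0≤B^ j 0≤f) a)
    from-u₀ (suc j) (inj₂ (b , ab , r)) 0≤f = ≤-trans (from-u₀ j r 0≤f) (adj≤B (0≤B^ j 0≤f) ab)

    to-u₀ : ∀ j {a f} → Reach j a → (∀ a → 0ℚ ≤ f a) → f a ≤ B^ j f u₀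
    to-u₀ zero    refl 0≤f = ≤-refl
    to-u₀ (suc j) (inj₁ r) 0≤f = ≤-trans (to-u₀ j r 0≤f) (f≤B (0≤B^ j 0≤f) u₀)
    to-u₀ (suc j) {f = f} (inj₂ (b , ab , r)) 0≤f = ≤-trans (adj≤B 0≤f (symm ab))
      (≤-trans (to-u₀ j r (0≤B 0≤f)) (≤-reflexive (B^-B j f u₀)))

    N : ℕ
    N = eccentricity

    Q : (Fin n → ℚ) → Fin n → ℚ
    Q = B^ N

    Supported : (Fin n → ℚ) → Set
    Supported f = ∀ a → ¬ Reach N a → f a ≡ 0ℚ

    B-supported : ∀ {f} → Supported f → Supported (B f)
    B-supported {f} supp a ¬r = trans (cong₂ _+_ (supp a ¬r) Aᵛ≡0) (+-identityˡ 0ℚ)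
      where
      term : ∀ b → A a b * f b ≡ 0ℚ * f b
      term b with adj? a b
      ... | no _   = refl
      ... | yes ab = trans (*-identityˡ (f b)) (trans (supp b (λ r → ¬r (stable a (inj₂ (b , ab , r))))) (sym (*-zeroˡ (f b))))
      Aᵛ≡0 : Aᵛ f a ≡ 0ℚ
      Aᵛ≡0 = trans (sum-cong-≗ term) (trans (sym (*-distribˡ-sum 0ℚ f)) (*-zeroˡ (sum f)))

    B^-supported : ∀ j {f} → Supported f → Supported (B^ j f)
    B^-supported zero    supp = supp
    B^-supported (suc j) supp = B-supported (B^-supported j supp)

    e : Fin n → ℚ
    e a = if does (a Fin.≟ u₀) then 1ℚ else 0ℚ

    0≤e : ∀ a → 0ℚ ≤ e a
    0≤e a with a Fin.≟ u₀
    ... | yes _ = 0≤1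
    ... | no  _ = ≤-refl

    e≤1 : ∀ a → e a ≤ 1ℚ
    e≤1 a with a Fin.≟ u₀
    ... | yes _ = ≤-refl
    ... | no  _ = 0≤1

    e-u₀ : e u₀ ≡ 1ℚ
    e-u₀ with u₀ Fin.≟ u₀
    ... | yes _ = refl
    ... | no ≢  = contradiction refl ≢

    e-supported : Supported e
    e-supported a ¬r with a Fin.≟ u₀
    ... | yes refl = contradiction (reach-u₀ N) ¬r
    ... | no  _    = refl

    -- The estimates concern `y i`, one block later than `x i`: after a block the vector is at least
    -- 1 on the whole component and comparable to its value at `u₀`.
    x y : ℕ → Fin n → ℚ
    x zero    = e
    x (suc i) = Q (x i)
    y i = x (suc i)

    0≤x : ∀ i a → 0ℚ ≤ x i a
    0≤x zero    = 0≤e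
    0≤x (suc i) = 0≤B^ N (0≤x i)

    x-supported : ∀ i → Supported (x i)
    x-supported zero    = e-supported
    x-supported (suc i) = B^-supported N (x-supported i)

    0≤y : ∀ i a → 0ℚ ≤ y i a
    0≤y i = 0≤x (suc i)

    1≤x-u₀ : ∀ i → 1ℚ ≤ x i u₀
    1≤x-u₀ zero    = ≤-reflexive (sym e-u₀)
    1≤x-u₀ (suc i) = ≤-trans (1≤x-u₀ i) (f≤B^ N (0≤x i) u₀)

    1≤y-u₀ : ∀ i → 1ℚ ≤ y i u₀
    1≤y-u₀ i = 1≤x-u₀ (suc i)

    K₀ : ℚ
    K₀ = κ ^ N

    1≤K₀ : 1ℚ ≤ K₀
    1≤K₀ = 1≤^ N 1≤κ

    0≤K₀ : 0ℚ ≤ K₀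
    0≤K₀ = ≤-trans 0≤1 1≤K₀

    -- A Harnack inequality: a block of `N` steps brings every entry of `x i` to `u₀`, and it raises
    -- the maximum by a factor of at most κ^N.
    y≤K₀y-u₀ : ∀ i a → y i a ≤ K₀ * y i u₀
    y≤K₀y-u₀ i a = B^-bound N (0≤y i u₀) x≤ a
      where
      x≤ : ∀ a → x i a ≤ y i u₀
      x≤ a with Reach? N a
      ... | yes r = to-u₀ N r (0≤x i)
      ... | no ¬r = ≤-trans (≤-reflexive (x-supported i a ¬r)) (0≤y i u₀)

    K : ℚ
    K = K₀ * K₀

    1≤K : 1ℚ ≤ K
    1≤K = ≤-trans 1≤K₀ (≤-trans (≤-reflexive (sym (*-identityʳ K₀))) (*-monoˡ 0≤K₀ 1≤K₀))

    Qy≤Ky-u₀ : ∀ i a → y (suc i) a ≤ K * y i u₀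
    Qy≤Ky-u₀ i a = ≤-trans (B^-bound N (0≤* 0≤K₀ (0≤y i u₀)) (y≤K₀y-u₀ i) a)
      (≤-reflexive (sym (*-assoc K₀ K₀ (y i u₀))))

    opaque
      K⁻¹ : Σ[ θ ∈ ℚ ] 0ℚ < θ × K * θ ≡ 1ℚ
      K⁻¹ = reciprocal K (<-≤-trans (positive⁻¹ 1ℚ) 1≤K)

      θ : ℚ
      θ = proj₁ K⁻¹

      0<θ : 0ℚ < θ
      0<θ = proj₁ (proj₂ K⁻¹)

      0≤θ : 0ℚ ≤ θ
      0≤θ = <⇒≤ 0<θ

      Kθ≡1 : K * θ ≡ 1ℚ
      Kθ≡1 = proj₂ (proj₂ K⁻¹)

    θ≤1 : θ ≤ 1ℚ
    θ≤1 = ≤-trans (≤-reflexive (sym (*-identityˡ θ))) (≤-trans (*-monoʳ 0≤θ 1≤K) (≤-reflexive Kθ≡1))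

    γ : ℚ
    γ = 1ℚ - θ

    0≤γ : 0ℚ ≤ γ
    0≤γ = ≤⇒0≤- θ≤1

    opaque
      y-u₀⁻¹ : ∀ i → Σ[ r ∈ ℚ ] 0ℚ < r × y i u₀ * r ≡ 1ℚ
      y-u₀⁻¹ i = reciprocal (y i u₀) (<-≤-trans (positive⁻¹ 1ℚ) (1≤y-u₀ i))

      inv : ℕ → ℚ
      inv i = proj₁ (y-u₀⁻¹ i)

      0≤inv : ∀ i → 0ℚ ≤ inv i
      0≤inv i = <⇒≤ (proj₁ (proj₂ (y-u₀⁻¹ i)))

      y*inv≡1 : ∀ i → y i u₀ * inv i ≡ 1ℚ
      y*inv≡1 i = proj₂ (proj₂ (y-u₀⁻¹ i))

    Between : ℚ → (Fin n → ℚ) → ℚ → ℕ → Set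
    Between α X β i = ∀ a → α * y i a ≤ X a × X a ≤ β * y i a

    cancel : ∀ s u v → u * v ≡ 1ℚ → s ≡ s * v * u
    cancel s u v uv≡1 = trans (sym (*-identityʳ s)) (trans (cong (s *_) (trans (sym uv≡1) (*-comm u v))) (sym (*-assoc s v u)))

    -- The nonnegative vector X - α y has the value (r - α) y at `u₀`. One block spreads at least
    -- this value over the component, where the next iterate is at most `K` times y at `u₀`. So α
    -- can be raised by θ(r - α) with θ = 1 / K; likewise β drops by θ(β - r), and r cancels from
    -- the width.
    contract : ∀ {α β X} i → Supported X → Between α X β i →
               ∃[ α′ ] ∃[ β′ ] Between α′ (Q X) β′ (suc i) × β′ - α′ ≡ γ * (β - α)
    contract {α} {β} {X} i supp αyXβy = α′ , β′ , between , width α β r θ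
      where
      open ≤-Reasoning
      r α′ β′ : ℚ
      r = X u₀ * inv i
      α′ = α + θ * (r - α)
      β′ = β - θ * (β - r)
      X≡ry : X u₀ ≡ r * y i u₀
      X≡ry = cancel (X u₀) (y i u₀) (inv i) (y*inv≡1 i)
      width : ∀ α β r θ → (β - θ * (β - r)) - (α + θ * (r - α)) ≡ (1ℚ - θ) * (β - α)
      width = solve-∀ ring
      r≡ : ∀ t → t * y i u₀ * inv i ≡ t
      r≡ t = trans (*-assoc t _ _) (trans (cong (t *_) (y*inv≡1 i)) (*-identityʳ t))
      0≤r-α : 0ℚ ≤ r - α
      0≤r-α = ≤⇒0≤- (subst (_≤ r) (r≡ α) (*-monoʳ (0≤inv i) (proj₁ (αyXβy u₀))))
      0≤β-r : 0ℚ ≤ β - r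
      0≤β-r = ≤⇒0≤- (subst (r ≤_) (r≡ β) (*-monoʳ (0≤inv i) (proj₂ (αyXβy u₀))))
      lose : ∀ s a → 0ℚ ≤ s → θ * s * y (suc i) a ≤ s * y i u₀
      lose s a 0≤s = begin
        θ * s * y (suc i) a          ≤⟨ *-monoˡ (0≤* 0≤θ 0≤s) (Qy≤Ky-u₀ i a) ⟩
        θ * s * (K * y i u₀)         ≡⟨ regroup θ s K (y i u₀) ⟩
        K * θ * (s * y i u₀)         ≡⟨ cong (_* (s * y i u₀)) Kθ≡1 ⟩
        1ℚ * (s * y i u₀)            ≡⟨ *-identityˡ _ ⟩
        s * y i u₀                   ∎
        where
        regroup : ∀ θ s K y → θ * s * (K * y) ≡ K * θ * (s * y)
        regroup = solve-∀ ring
      lower : ∀ a → Reach N a → (r - α) * y i u₀ ≤ Q X a - α * y (suc i) a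
      lower a reach = begin
        (r - α) * y i u₀                     ≡⟨ expand r α (y i u₀) ⟩
        r * y i u₀ - α * y i u₀              ≡⟨ cong (_- α * y i u₀) X≡ry ⟨
        X u₀ - α * y i u₀                    ≤⟨ from-u₀ N reach (λ b → ≤⇒0≤- (proj₁ (αyXβy b))) ⟩
        B^ N (λ b → X b - α * y i b) a       ≡⟨ B^-lin N X (y i) α a ⟩
        Q X a - α * y (suc i) a              ∎
        where
        expand : ∀ r α y → (r - α) * y ≡ r * y - α * y
        expand = solve-∀ ring
      upper : ∀ a → Reach N a → (β - r) * y i u₀ ≤ β * y (suc i) a - Q X a
      upper a reach = begin
        (β - r) * y i u₀                       ≡⟨ expand r β (y i u₀) ⟩
        - (r * y i u₀ - β * y i u₀)            ≡⟨ cong (λ t → - (t - β * y i u₀)) X≡ry ⟨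
        - (X u₀ - β * y i u₀)                  ≡⟨ negate (X u₀ - β * y i u₀) ⟩
        0ℚ - 1ℚ * (X u₀ - β * y i u₀)          ≤⟨ from-u₀ N reach (λ b → subst (0ℚ ≤_) (swap (X b) β (y i b)) (≤⇒0≤- (proj₂ (αyXβy b)))) ⟩
        B^ N (λ b → 0ℚ - 1ℚ * (X b - β * y i b)) a
          ≡⟨ B^-lin N (λ _ → 0ℚ) (λ b → X b - β * y i b) 1ℚ a ⟩
        B^ N (λ _ → 0ℚ) a - 1ℚ * B^ N (λ b → X b - β * y i b) a
          ≡⟨ cong₂ (λ s t → s - 1ℚ * t) (B^-zero a) (B^-lin N X (y i) β a) ⟩
        0ℚ - 1ℚ * (Q X a - β * y (suc i) a)    ≡⟨ swap (Q X a) β (y (suc i) a) ⟨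
        β * y (suc i) a - Q X a                ∎
        where
        expand : ∀ r β y → (β - r) * y ≡ - (r * y - β * y)
        expand = solve-∀ ring
        negate : ∀ t → - t ≡ 0ℚ - 1ℚ * t
        negate = solve-∀ ring
        swap : ∀ X β y → β * y - X ≡ 0ℚ - 1ℚ * (X - β * y)
        swap = solve-∀ ring
        B^-zero : ∀ a → B^ N (λ _ → 0ℚ) a ≡ 0ℚ
        -- As 0 - 1 · 0 reduces to 0, linearity says that the value t equals t - 1 · t.
        B^-zero a = trans (B^-lin N (λ _ → 0ℚ) (λ _ → 0ℚ) 1ℚ a) (self (B^ N (λ _ → 0ℚ) a))
          where
          self : ∀ t → t - 1ℚ * t ≡ 0ℚ
          self = solve-∀ ring
      between : Between α′ (Q X) β′ (suc i)
      between a with Reach? N a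
      ... | no ¬r = ≤-reflexive (zero≡ α′) , ≤-reflexive (sym (zero≡ β′))
        where
        zero≡ : ∀ c → c * y (suc i) a ≡ Q X a
        zero≡ c = trans (cong (c *_) (x-supported (suc (suc i)) a ¬r)) (trans (*-zeroʳ c) (sym (B^-supported N supp a ¬r)))
      ... | yes reach =
        ≤-by _ (expand₁ α θ (r - α) (y (suc i) a) (Q X a)) (≤⇒0≤- (≤-trans (lose (r - α) a 0≤r-α) (lower a reach))) ,
        ≤-by _ (expand₂ β θ (β - r) (y (suc i) a) (Q X a)) (≤⇒0≤- (≤-trans (lose (β - r) a 0≤β-r) (upper a reach)))
        where
        expand₁ : ∀ α θ s y X → X ≡ (α + θ * s) * y + ((X - α * y) - θ * s * y)
        expand₁ = solve-∀ ring
        expand₂ : ∀ β θ s y X → (β - θ * s) * y ≡ X + ((β * y - X) - θ * s * y)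
        expand₂ = solve-∀ ring

    -- An upper bound for all entries of `B^ j (y 0)`, hence for their ratio to `y 0`, which is at
    -- least 1 on the component.
    β₀ : ℕ → ℚ
    β₀ j = κ ^ j * K₀

    0≤β₀ : ∀ j → 0ℚ ≤ β₀ j
    0≤β₀ j = 0≤* (0≤^ j 0≤κ) 0≤K₀

    initial : ∀ j → Between 0ℚ (B^ j (y 0)) (β₀ j) 0
    initial j a = ≤-trans (≤-reflexive (*-zeroˡ (y 0 a))) (0≤B^ j (0≤y 0) a) , upper
      where
      open ≤-Reasoning
      y₀≤ : ∀ a → y 0 a ≤ K₀
      y₀≤ a = ≤-trans (B^-bound N 0≤1 e≤1 a) (≤-reflexive (*-identityʳ K₀))
      upper : B^ j (y 0) a ≤ β₀ j * y 0 a
      upper with Reach? N a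
      ... | no ¬r = ≤-reflexive (trans (B^-supported j (x-supported 1) a ¬r)
        (sym (trans (cong (β₀ j *_) (x-supported 1 a ¬r)) (*-zeroʳ (β₀ j)))))
      ... | yes r = begin
        B^ j (y 0) a        ≤⟨ B^-bound j 0≤K₀ y₀≤ a ⟩
        β₀ j                ≡⟨ *-identityʳ (β₀ j) ⟨
        β₀ j * 1ℚ           ≤⟨ *-monoˡ (0≤β₀ j) (subst (_≤ y 0 a) e-u₀ (from-u₀ N r 0≤e)) ⟩
        β₀ j * y 0 a        ∎

    -- Needed for j = 1, where the ratios approximate the eigenvalue of I + A, and for j = N, where
    -- they compare consecutive iterates.
    Squeezed : ℕ → ℕ → Set
    Squeezed j i = ∃[ α ] ∃[ β ] Between α (B^ j (y i)) β i × β - α ≡ β₀ j * γ ^ i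

    squeeze : ∀ j i → Squeezed j i
    squeeze j zero = 0ℚ , β₀ j , initial j , eq (β₀ j)
      where
      eq : ∀ β → β - 0ℚ ≡ β * 1ℚ
      eq = solve-∀ ring
    squeeze j (suc i) =
      let α , β , between , width = squeeze j i
          α′ , β′ , between′ , width′ = contract {α} {β} {B^ j (y i)} i (B^-supported j (x-supported (suc i))) between
      in α′ , β′ ,
         (λ a → subst (λ t → α′ * y (suc i) a ≤ t × t ≤ β′ * y (suc i) a) (B^-comm N j (y i) a) (between′ a)) ,
         trans width′ (trans (cong (γ *_) width) (exchange γ (β₀ j) (γ ^ i)))
      where
      exchange : ∀ g b p → g * (b * p) ≡ b * (g * p)
      exchange = solve-∀ ring

    v : ℕ → Fin n → ℚ
    v i a = y i a * inv i

    μ : ℕ → ℚ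
    μ i = Aᵛ (v i) u₀

    0≤v : ∀ i a → 0ℚ ≤ v i a
    0≤v i a = 0≤* (0≤y i a) (0≤inv i)

    v-u₀ : ∀ i → v i u₀ ≡ 1ℚ
    v-u₀ = y*inv≡1

    v≤K₀ : ∀ i a → v i a ≤ K₀
    v≤K₀ i a = ≤-trans (*-monoʳ (0≤inv i) (y≤K₀y-u₀ i a))
      (≤-reflexive (trans (*-assoc K₀ _ _) (trans (cong (K₀ *_) (y*inv≡1 i)) (*-identityʳ K₀))))

    0≤μ : ∀ i → 0ℚ ≤ μ i
    0≤μ i = 0≤Aᵛ (0≤v i) u₀

    Aᵛ-scale : ∀ i a → Aᵛ (y i) a * inv i ≡ Aᵛ (v i) a
    Aᵛ-scale i a = trans (*-distribʳ-sum (inv i) (λ b → A a b * y i b)) (sum-cong-≗ λ b → *-assoc (A a b) (y i b) (inv i))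

    width₁ : ℕ → ℚ
    width₁ i = β₀ 1 * γ ^ i

    -- 1 + μ i is the ratio B (y i) u₀ / y i u₀.
    OneStep : ℕ → Set
    OneStep i = ∃[ α ] ∃[ β ] Between α (B (y i)) β i × α ≤ 1ℚ + μ i × 1ℚ + μ i ≤ β × β - α ≡ width₁ i

    one-step : ∀ i → OneStep i
    one-step i = let α , β , between , width = squeeze 1 i in α , β , between ,
      ratio α (*-monoʳ (0≤inv i) (proj₁ (between u₀))) , ratio′ β (*-monoʳ (0≤inv i) (proj₂ (between u₀))) , width
      where
      r≡ : ∀ t → t * y i u₀ * inv i ≡ t
      r≡ t = trans (*-assoc t _ _) (trans (cong (t *_) (y*inv≡1 i)) (*-identityʳ t))
      By≡ : B (y i) u₀ * inv i ≡ 1ℚ + μ i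
      By≡ = trans (*-distribʳ-+ (inv i) (y i u₀) (Aᵛ (y i) u₀)) (cong₂ _+_ (y*inv≡1 i) (Aᵛ-scale i u₀))
      ratio : ∀ t → t * y i u₀ * inv i ≤ B (y i) u₀ * inv i → t ≤ 1ℚ + μ i
      ratio t = subst₂ _≤_ (r≡ t) By≡
      ratio′ : ∀ t → B (y i) u₀ * inv i ≤ t * y i u₀ * inv i → 1ℚ + μ i ≤ t
      ratio′ t = subst₂ _≤_ By≡ (r≡ t)

    -- All ratios of `B (y i)` to `y i` are at most β, and α ≤ 1 + μ, so β exceeds 1 + μ by no more
    -- than the width.
    collatz : ∀ i a → Aᵛ (y i) a ≤ (μ i + width₁ i) * y i a
    collatz i a = from (one-step i)
      where
      from : OneStep i → Aᵛ (y i) a ≤ (μ i + width₁ i) * y i a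
      from (α , β , between , α≤1+μ , _ , width) = begin
        Aᵛ (y i) a                                      ≡⟨ eq₁ (y i a) (Aᵛ (y i) a) ⟩
        B (y i) a - y i a                               ≤⟨ +-monoˡ-≤ (- y i a) (proj₂ (between a)) ⟩
        β * y i a - y i a                               ≡⟨ eq₂ α β (y i a) ⟩
        (α + (β - α) - 1ℚ) * y i a                      ≤⟨ *-monoʳ (0≤y i a) (+-monoˡ-≤ (- 1ℚ) (+-monoˡ-≤ (β - α) α≤1+μ)) ⟩
        (1ℚ + μ i + (β - α) - 1ℚ) * y i a               ≡⟨ cong (λ w → (1ℚ + μ i + w - 1ℚ) * y i a) width ⟩
        (1ℚ + μ i + width₁ i - 1ℚ) * y i a              ≡⟨ eq₃ (μ i) (width₁ i) (y i a) ⟩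
        (μ i + width₁ i) * y i a                        ∎
        where
        open ≤-Reasoning
        eq₁ : ∀ y A → A ≡ (y + A) - y
        eq₁ = solve-∀ ring
        eq₂ : ∀ α β y → β * y - y ≡ (α + (β - α) - 1ℚ) * y
        eq₂ = solve-∀ ring
        eq₃ : ∀ m w y → (1ℚ + m + w - 1ℚ) * y ≡ (m + w) * y
        eq₃ = solve-∀ ring

    -- Both (I + A) v and (1 + μ) v lie between α v and β v.
    near-eigenvector : ∀ i a → ∣ Aᵛ (v i) a - μ i * v i a ∣ ≤ width₁ i * K₀
    near-eigenvector i a = from (one-step i)
      where
      from : OneStep i → ∣ Aᵛ (v i) a - μ i * v i a ∣ ≤ width₁ i * K₀
      from (α , β , between , α≤1+μ , 1+μ≤β , width) = ∣∣≤
        (begin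
          Aᵛ (v i) a - μ i * v i a                 ≡⟨ eq₁ (Aᵛ (v i) a) (μ i) (v i a) ⟩
          Bv - (1ℚ + μ i) * v i a                  ≤⟨ +-mono-≤ Bv≤ (neg-antimono-≤ (*-monoʳ (0≤v i a) α≤1+μ)) ⟩
          β * v i a - α * v i a                    ≤⟨ bound ⟩
          width₁ i * K₀                            ∎)
        (begin
          - (Aᵛ (v i) a - μ i * v i a)             ≡⟨ eq₂ (Aᵛ (v i) a) (μ i) (v i a) ⟩
          (1ℚ + μ i) * v i a - Bv                  ≤⟨ +-mono-≤ (*-monoʳ (0≤v i a) 1+μ≤β) (neg-antimono-≤ ≤Bv) ⟩
          β * v i a - α * v i a                    ≤⟨ bound ⟩
          width₁ i * K₀                            ∎)
        where
        open ≤-Reasoning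
        Bv = v i a + Aᵛ (v i) a
        Bv≡ : B (y i) a * inv i ≡ Bv
        Bv≡ = trans (*-distribʳ-+ (inv i) (y i a) (Aᵛ (y i) a)) (cong (v i a +_) (Aᵛ-scale i a))
        Bv≤ : Bv ≤ β * v i a
        Bv≤ = subst₂ _≤_ Bv≡ (*-assoc β _ _) (*-monoʳ (0≤inv i) (proj₂ (between a)))
        ≤Bv : α * v i a ≤ Bv
        ≤Bv = subst₂ _≤_ (*-assoc α _ _) Bv≡ (*-monoʳ (0≤inv i) (proj₁ (between a)))
        eq₁ : ∀ A m v → A - m * v ≡ (v + A) - (1ℚ + m) * v
        eq₁ = solve-∀ ring
        eq₂ : ∀ A m v → - (A - m * v) ≡ (1ℚ + m) * v - (v + A)
        eq₂ = solve-∀ ring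
        factor : ∀ α β v → β * v - α * v ≡ (β - α) * v
        factor = solve-∀ ring
        bound : β * v i a - α * v i a ≤ width₁ i * K₀
        bound = begin
          β * v i a - α * v i a     ≡⟨ factor α β (v i a) ⟩
          (β - α) * v i a           ≡⟨ cong (_* v i a) width ⟩
          width₁ i * v i a          ≤⟨ *-monoˡ (0≤* (0≤β₀ 1) (0≤^ i 0≤γ)) (v≤K₀ i a) ⟩
          width₁ i * K₀             ∎

    -- The factor `K` is the sum of the geometric series: as K(1 - γ) = 1, the decrease of `h` at
    -- `i` is exactly the bound that `ratio-difference` gives for one step.
    h : ℕ → ℚ
    h i = β₀ N * K₀ * K * γ ^ i

    v-step : ∀ i a → ∣ v (suc i) a - v i a ∣ ≤ h i - h (suc i)
    v-step i a =
      let α , β , between , width = squeeze N i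
          αY≤X , X≤βY = between a
          αp≤q , q≤βp = between u₀
          0≤W = 0≤* (0≤β₀ N) (0≤^ i 0≤γ)
      in ≤-trans
        (ratio-difference {y (suc i) a} {y i a} {y i u₀} {y (suc i) u₀} {inv i} {inv (suc i)} {α} {β} {K₀} (0≤y i a) (0≤y i u₀) (0≤inv i) (0≤inv (suc i)) (y*inv≡1 i) (y*inv≡1 (suc i))
          (f≤B^ N (0≤y i) u₀) αY≤X X≤βY αp≤q q≤βp (subst (0ℚ ≤_) (sym width) 0≤W) (v≤K₀ i a))
        (≤-reflexive (trans (cong (_* K₀) width) (decrease (β₀ N) (γ ^ i) K₀ θ K Kθ≡1)))
      where
      decrease : ∀ b g k θ K → K * θ ≡ 1ℚ → b * g * k ≡ b * k * K * g - b * k * K * ((1ℚ - θ) * g)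
      decrease b g k θ K Kθ≡1 = trans (sym (*-identityʳ (b * g * k))) (trans (cong (b * g * k *_) (sym Kθ≡1)) (expand b g k θ K))
        where
        expand : ∀ b g k θ K → b * g * k * (K * θ) ≡ b * k * K * g - b * k * K * ((1ℚ - θ) * g)
        expand = solve-∀ ring

    0≤h : ∀ i → 0ℚ ≤ h i
    0≤h i = 0≤* (0≤* (0≤* (0≤β₀ N) 0≤K₀) (≤-trans 0≤1 1≤K)) (0≤^ i 0≤γ)

    v-cauchy : ∀ i j a → i ℕ.≤ j → ∣ v j a - v i a ∣ ≤ h i
    v-cauchy i j a = telescope (λ i → v i a) h (λ i → v-step i a) 0≤h i j

    h→0 : ∀ ε → 0ℚ < ε → ∃[ M ] (∀ i → M ℕ.≤ i → h i ≤ ε)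
    h→0 = geometric→0 0<θ θ≤1 (β₀ N * K₀ * K) (0≤* (0≤* (0≤β₀ N) 0≤K₀) (≤-trans 0≤1 1≤K))

    width₁→0 : ∀ ε → 0ℚ < ε → ∃[ M ] (∀ i → M ℕ.≤ i → width₁ i ≤ ε)
    width₁→0 = geometric→0 0<θ θ≤1 (β₀ 1) (0≤β₀ 1)

    width₁*K₀→0 : ∀ ε → 0ℚ < ε → ∃[ M ] (∀ i → M ℕ.≤ i → width₁ i * K₀ ≤ ε)
    width₁*K₀→0 ε 0<ε =
      let L , small = geometric→0 0<θ θ≤1 (β₀ 1 * K₀) (0≤* (0≤β₀ 1) 0≤K₀) ε 0<ε
      in L , λ i L≤i → subst (_≤ ε) (exchange (β₀ 1) K₀ (γ ^ i)) (small i L≤i)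
      where
      exchange : ∀ b k g → b * k * g ≡ b * g * k
      exchange = solve-∀ ring

-- Null sequences, continuity of powers, rational approximation.

module Reals where

  open import Algebra.Properties.Semiring.Sum (CommutativeRing.semiring ℚ.+-*-commutativeRing)
    using (sum; sum-syntax; sum-cong-≗; *-distribʳ-sum)
  open import Data.Rational.Base
  open import Data.Rational.Properties
  open import Algebra.Properties.Semiring.Sum ℕ.+-*-semiring using () renaming (sum to ℕsum)
  open import Data.Vec.Functional using (Vector; foldr)
  open import Defs using (ℝ; mkℝ; seq; cauchy; eventually-bounded; _≈_; 0ℝ; ℂ; _+i_; re; im; _≈ᶜ_; 0ᶜ; _+ᶜ_; _*ᶜ_;
    HasModulus; _·_; IsEigenvalue; IsSpectralRadius; adjacencyMatrix; Graph; order; adj?; symm)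
    renaming (_≤_ to _≤ʳ_; _+_ to _+ʳ_; _*_ to _*ʳ_; _^_ to _^ʳ_)
  open Combinatorics using (⟦_⟧)
  open Rationals
  open PerronFrobenius using (module PowerIteration)

  -- `x ≈ y` unfolds to `Null` of the difference of the two sequences, so closure properties of null
  -- sequences are congruences for `≈`.
  Null : (ℕ → ℚ) → Set
  Null f = ∀ ε → 0ℚ < ε → ∃[ N ] (∀ i → N ℕ.≤ i → ∣ f i ∣ ≤ ε)

  Null-cong : ∀ {f g} → f ≗ g → Null f → Null g
  Null-cong f≗g f→0 ε 0<ε = proj₁ (f→0 ε 0<ε) ,
    λ i N≤i → subst (λ t → ∣ t ∣ ≤ ε) (f≗g i) (proj₂ (f→0 ε 0<ε) i N≤i)

  Null-≗0 : ∀ {f} → (∀ i → f i ≡ 0ℚ) → Null f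
  Null-≗0 f≗0 ε 0<ε = 0 , λ i _ → ≤-trans (≤-reflexive (cong ∣_∣ (f≗0 i))) (<⇒≤ 0<ε)

  Null-+ : ∀ {f g} → Null f → Null g → Null (λ i → f i + g i)
  Null-+ {f} {g} f→0 g→0 ε 0<ε with half ε 0<ε
  ... | δ , 0<δ , δ+δ≡ε with f→0 δ 0<δ | g→0 δ 0<δ
  ...   | M , f≤ | N , g≤ = M ℕ.⊔ N , λ i MN≤i → ≤-trans (∣p+q∣≤∣p∣+∣q∣ (f i) (g i)) (≤-trans
    (+-mono-≤ (f≤ i (ℕ.≤-trans (ℕ.m≤m⊔n M N) MN≤i)) (g≤ i (ℕ.≤-trans (ℕ.m≤n⊔m M N) MN≤i))) (≤-reflexive δ+δ≡ε))

  Null-neg : ∀ {f} → Null f → Null (λ i → - f i)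
  Null-neg {f} f→0 ε 0<ε = proj₁ (f→0 ε 0<ε) ,
    λ i N≤i → ≤-trans (≤-reflexive (∣-p∣≡∣p∣ (f i))) (proj₂ (f→0 ε 0<ε) i N≤i)

  Null-sum : ∀ {n} {f : Fin n → ℕ → ℚ} → (∀ a → Null (f a)) → Null (λ i → ∑[ a < n ] f a i)
  Null-sum {zero}  f→0 = Null-≗0 (λ i → refl)
  Null-sum {suc n} f→0 = Null-+ (f→0 zero) (Null-sum (f→0 ∘ suc))

  Null-* : ∀ (x : ℝ) {f} → Null f → Null (λ i → seq x i * f i)
  Null-* x {f} f→0 ε 0<ε =
    let B , B⁺ , L , x≤B = eventually-bounded x
        ρ , 0<ρ , Bρ≡1 = reciprocal B (positive⁻¹ B {{B⁺}})
        L′ , f≤ = f→0 (ρ * ε) (0<* 0<ρ 0<ε)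
    in L ℕ.⊔ L′ , λ i LL′≤i → bound (<⇒≤ (0<* 0<ρ 0<ε)) Bρ≡1 (seq x i) (f i)
         (x≤B i (ℕ.≤-trans (ℕ.m≤m⊔n L L′) LL′≤i)) (f≤ i (ℕ.≤-trans (ℕ.m≤n⊔m L L′) LL′≤i))
    where
    open ≤-Reasoning
    bound : ∀ {B ρ} → 0ℚ ≤ ρ * ε → B * ρ ≡ 1ℚ → ∀ s t → ∣ s ∣ ≤ B → ∣ t ∣ ≤ ρ * ε → ∣ s * t ∣ ≤ ε
    bound {B} {ρ} 0≤ρε Bρ≡1 s t s≤ t≤ = begin
      ∣ s * t ∣          ≡⟨ ∣p*q∣≡∣p∣*∣q∣ s t ⟩
      ∣ s ∣ * ∣ t ∣      ≤⟨ *-mono (0≤∣p∣ s) 0≤ρε s≤ t≤ ⟩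
      B * (ρ * ε)        ≡⟨ *-assoc B ρ ε ⟨
      B * ρ * ε          ≡⟨ cong (_* ε) Bρ≡1 ⟩
      1ℚ * ε             ≡⟨ *-identityˡ ε ⟩
      ε                  ∎

  ≗⇒≈ : ∀ {x y} → seq x ≗ seq y → x ≈ y
  ≗⇒≈ {x} {y} x≗y = Null-≗0 λ i → trans (cong (_- seq y i) (x≗y i)) (+-inverseʳ (seq y i))

  ≈-sym : ∀ {x y} → x ≈ y → y ≈ x
  ≈-sym {x} {y} x≈y = Null-cong (λ i → flip (seq x i) (seq y i)) (Null-neg x≈y)
    where
    flip : ∀ x y → - (x - y) ≡ y - x
    flip = solve-∀ ring

  ≈-trans : ∀ {x y z} → x ≈ y → y ≈ z → x ≈ z
  ≈-trans {x} {y} {z} x≈y y≈z = Null-cong (λ i → join (seq x i) (seq y i) (seq z i)) (Null-+ x≈y y≈z)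
    where
    join : ∀ x y z → (x - y) + (y - z) ≡ x - z
    join = solve-∀ ring

  +-cong-≈ : ∀ {x x′ y y′} → x ≈ x′ → y ≈ y′ → (x +ʳ y) ≈ (x′ +ʳ y′)
  +-cong-≈ {x} {x′} {y} {y′} x≈ y≈ = Null-cong (λ i → eq (seq x i) (seq x′ i) (seq y i) (seq y′ i)) (Null-+ x≈ y≈)
    where
    eq : ∀ a b c d → (a - b) + (c - d) ≡ (a + c) - (b + d)
    eq = solve-∀ ring

  *-cong-≈ : ∀ {x x′ y y′} → x ≈ x′ → y ≈ y′ → (x *ʳ y) ≈ (x′ *ʳ y′)
  *-cong-≈ {x} {x′} {y} {y′} x≈ y≈ = Null-cong (λ i → eq (seq x i) (seq x′ i) (seq y i) (seq y′ i))
    (Null-+ (Null-* x y≈) (Null-* y′ x≈))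
    where
    eq : ∀ a b c d → a * (c - d) + d * (a - b) ≡ a * c - b * d
    eq = solve-∀ ring

  ι-sum : ∀ {n} (f : Fin n → ℕ) → ι (ℕsum f) ≡ sum (ι ∘ f)
  ι-sum {zero}  f = refl
  ι-sum {suc n} f = trans (ι-+ (f zero) (ℕsum (f ∘ suc))) (cong (ι (f zero) +_) (ι-sum (f ∘ suc)))

  ι-⟦⟧ : ∀ {P : Set} (d : Dec P) → ι ⟦ d ⟧ ≡ (if does d then 1ℚ else 0ℚ)
  ι-⟦⟧ (yes _) = refl
  ι-⟦⟧ (no _)  = refl

  seq-^ : ∀ x k i → seq (x ^ʳ k) i ≡ seq x i ^ k
  seq-^ x zero    i = refl
  seq-^ x (suc k) i = cong (seq x i *_) (seq-^ x k i)

  -- A Lipschitz constant of t ↦ t ^ k on [- b , b].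
  lipschitz : ℚ → ℕ → ℚ
  lipschitz b zero    = 0ℚ
  lipschitz b (suc k) = b * lipschitz b k + b ^ k

  0≤lipschitz : ∀ {b} → 0ℚ ≤ b → ∀ k → 0ℚ ≤ lipschitz b k
  0≤lipschitz 0≤b zero    = ≤-refl
  0≤lipschitz 0≤b (suc k) = 0≤+ (0≤* 0≤b (0≤lipschitz 0≤b k)) (0≤^ k 0≤b)

  ∣^∣≤ : ∀ {s b} → 0ℚ ≤ b → ∣ s ∣ ≤ b → ∀ k → ∣ s ^ k ∣ ≤ b ^ k
  ∣^∣≤ 0≤b s≤b zero = ≤-refl
  ∣^∣≤ {s} 0≤b s≤b (suc k) = ≤-trans (≤-reflexive (∣p*q∣≡∣p∣*∣q∣ s (s ^ k)))
    (*-mono (0≤∣p∣ s) (0≤^ k 0≤b) s≤b (∣^∣≤ 0≤b s≤b k))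

  ^-lipschitz : ∀ {b s t} → 0ℚ ≤ b → ∣ s ∣ ≤ b → ∣ t ∣ ≤ b → ∀ k → ∣ s ^ k - t ^ k ∣ ≤ lipschitz b k * ∣ s - t ∣
  ^-lipschitz {s = s} {t} 0≤b s≤b t≤b zero = ≤-reflexive (sym (*-zeroˡ ∣ s - t ∣))
  ^-lipschitz {b} {s} {t} 0≤b s≤b t≤b (suc k) = begin
    ∣ s * s ^ k - t * t ^ k ∣                                ≡⟨ cong ∣_∣ (split s t (s ^ k) (t ^ k)) ⟩
    ∣ s * (s ^ k - t ^ k) + (s - t) * t ^ k ∣                ≤⟨ ∣p+q∣≤∣p∣+∣q∣ (s * (s ^ k - t ^ k)) ((s - t) * t ^ k) ⟩
    ∣ s * (s ^ k - t ^ k) ∣ + ∣ (s - t) * t ^ k ∣            ≡⟨ cong₂ _+_ (∣p*q∣≡∣p∣*∣q∣ s _) (∣p*q∣≡∣p∣*∣q∣ (s - t) _) ⟩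
    ∣ s ∣ * ∣ s ^ k - t ^ k ∣ + ∣ s - t ∣ * ∣ t ^ k ∣
      ≤⟨ +-mono-≤ (*-mono (0≤∣p∣ s) (0≤* (0≤lipschitz 0≤b k) 0≤d) s≤b (^-lipschitz 0≤b s≤b t≤b k)) (*-monoˡ 0≤d (∣^∣≤ 0≤b t≤b k)) ⟩
    b * (lipschitz b k * ∣ s - t ∣) + ∣ s - t ∣ * b ^ k      ≡⟨ collect b (lipschitz b k) ∣ s - t ∣ (b ^ k) ⟩
    lipschitz b (suc k) * ∣ s - t ∣                          ∎
    where
    open ≤-Reasoning
    0≤d = 0≤∣p∣ (s - t)
    split : ∀ s t S T → s * S - t * T ≡ s * (S - T) + (s - t) * T
    split = solve-∀ ring
    collect : ∀ b l d p → b * (l * d) + d * p ≡ (b * l + p) * d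
    collect = solve-∀ ring

  -- The witness is η = 1 / (1 + c / ε).
  small : ∀ c ε → 0ℚ ≤ c → 0ℚ < ε → Σ[ η ∈ ℚ ] 0ℚ < η × η ≤ 1ℚ × c * η ≤ ε
  small c ε 0≤c 0<ε =
    let ρ , 0<ρ , ερ≡1 = reciprocal ε 0<ε
        0≤cρ = 0≤* 0≤c (<⇒≤ 0<ρ)
        η , 0<η , eq = reciprocal (1ℚ + c * ρ) (0<+ (positive⁻¹ 1ℚ) 0≤cρ)
    in η , 0<η , bounds 0≤cρ (<⇒≤ 0<η) ερ≡1 (trans (*-comm η (1ℚ + c * ρ)) eq)
    where
    open ≤-Reasoning
    expand : ∀ η t → η * (1ℚ + t) ≡ η + η * t
    expand = solve-∀ ring
    regroup : ∀ ε ρ c η → ε * ρ * (c * η) ≡ ε * (η * (c * ρ))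
    regroup = solve-∀ ring
    bounds : ∀ {ρ η} → 0ℚ ≤ c * ρ → 0ℚ ≤ η → ε * ρ ≡ 1ℚ → η * (1ℚ + c * ρ) ≡ 1ℚ → η ≤ 1ℚ × c * η ≤ ε
    bounds {ρ} {η} 0≤cρ 0≤η ερ≡1 eq = subst (η ≤_) eq (≤-by (η * (c * ρ)) (expand η (c * ρ)) (0≤* 0≤η 0≤cρ)) ,
      (begin
        c * η                       ≡⟨ *-identityˡ (c * η) ⟨
        1ℚ * (c * η)                ≡⟨ cong (_* (c * η)) ερ≡1 ⟨
        ε * ρ * (c * η)             ≡⟨ regroup ε ρ c η ⟩
        ε * (η * (c * ρ))           ≤⟨ *-monoˡ (<⇒≤ 0<ε) (≤-by η (trans (expand η (c * ρ)) (+-comm η _)) 0≤η) ⟩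
        ε * (η * (1ℚ + c * ρ))      ≡⟨ cong (ε *_) eq ⟩
        ε * 1ℚ                      ≡⟨ *-identityʳ ε ⟩
        ε                           ∎)

  ^-continuous : ∀ x k ε → 0ℚ < ε → Σ[ η ∈ ℚ ] 0ℚ < η × ∃[ L ] (∀ i s → L ℕ.≤ i → ∣ seq x i - s ∣ ≤ η →
                 ∣ seq x i ^ k - s ^ k ∣ ≤ ε)
  ^-continuous x k ε 0<ε =
    let b , b⁺ , L , x≤b = eventually-bounded x
        0≤b = <⇒≤ (positive⁻¹ b {{b⁺}})
        -- The bound is enlarged by 1 because `s` is only known to be within η ≤ 1 of `seq x i`.
        η , 0<η , η≤1 , cη≤ε = small (lipschitz (b + 1ℚ) k) ε (0≤lipschitz (0≤+ 0≤b 0≤1) k) 0<ε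
    in η , 0<η , L , λ i s L≤i close → estimate 0≤b η≤1 cη≤ε (seq x i) s (x≤b i L≤i) close
    where
    estimate : ∀ {b η} → 0ℚ ≤ b → η ≤ 1ℚ → lipschitz (b + 1ℚ) k * η ≤ ε →
               ∀ s t → ∣ s ∣ ≤ b → ∣ s - t ∣ ≤ η → ∣ s ^ k - t ^ k ∣ ≤ ε
    estimate {b} 0≤b η≤1 cη≤ε s t s≤b close =
      ≤-trans (^-lipschitz (0≤+ 0≤b 0≤1) (≤-trans s≤b (≤-by 1ℚ refl 0≤1)) t≤b+1 k)
        (≤-trans (*-monoˡ (0≤lipschitz (0≤+ 0≤b 0≤1) k) close) cη≤ε)
      where
      t≤b+1 : ∣ t ∣ ≤ b + 1ℚ
      t≤b+1 = ≤-trans (≤-reflexive (cong ∣_∣ (sym (x+[y-x]≡y s t)))) (≤-trans (∣p+q∣≤∣p∣+∣q∣ s (t - s))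
        (+-mono-≤ s≤b (≤-trans (≤-reflexive (∣-∣-sym t s)) (≤-trans close η≤1))))

  -- Rational approximations of x from above and from below, separated from x by some gap > 0.
  approximate : ∀ (x : ℝ) η → 0ℚ < η → Σ[ δ ∈ ℚ ] Σ[ t ∈ ℚ ] 0ℚ < δ × ∃[ L ] (∀ i → L ℕ.≤ i →
    (seq x i + δ ≤ t + (δ + δ) × ∣ seq x i - (t + (δ + δ)) ∣ ≤ η) ×
    (t - (δ + δ) + δ ≤ seq x i × ∣ seq x i - (t - (δ + δ)) ∣ ≤ η))
  approximate x η 0<η =
    -- δ is η / 4. With |x - t| ≤ δ, the points t ± 2δ are at least δ and at most 3δ ≤ η away from
    -- x.
    let η/2 , 0<η/2 , eq₁ = half η 0<η
        δ , 0<δ , eq₂ = half η/2 0<η/2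
        L , close = cauchy x δ 0<δ
    in δ , seq x L , 0<δ , L , λ i L≤i →
       estimate (<⇒≤ 0<δ) (trans (cong₂ _+_ eq₂ eq₂) eq₁) (seq x i) (seq x L) (close i L L≤i ℕ.≤-refl)
    where
    open ≤-Reasoning
    minus : ∀ t d → t - (t + d) ≡ - d
    minus = solve-∀ ring
    plus : ∀ t d → t - (t - d) ≡ d
    plus = solve-∀ ring
    cancel : ∀ s d → s + d - (d + d) + d ≡ s
    cancel = solve-∀ ring
    estimate : ∀ {δ} → 0ℚ ≤ δ → (δ + δ) + (δ + δ) ≡ η → ∀ s t → ∣ s - t ∣ ≤ δ →
      (s + δ ≤ t + (δ + δ) × ∣ s - (t + (δ + δ)) ∣ ≤ η) × (t - (δ + δ) + δ ≤ s × ∣ s - (t - (δ + δ)) ∣ ≤ η)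
    estimate {δ} 0≤δ 4δ≡η s t near =
      (≤-trans (+-monoˡ-≤ δ (∣-∣≤⇒≤+ {s} {t} near)) (≤-reflexive (+-assoc t δ δ)) ,
       dist (t + (δ + δ)) (trans (cong ∣_∣ (minus t (δ + δ))) (trans (∣-p∣≡∣p∣ (δ + δ)) (0≤p⇒∣p∣≡p (0≤+ 0≤δ 0≤δ))))) ,
      (≤-trans (+-monoˡ-≤ δ (+-monoˡ-≤ (- (δ + δ)) (∣-∣≤⇒≤+ {t} {s} (subst (_≤ δ) (∣-∣-sym s t) near)))) (≤-reflexive (cancel s δ)) ,
       dist (t - (δ + δ)) (trans (cong ∣_∣ (plus t (δ + δ))) (0≤p⇒∣p∣≡p (0≤+ 0≤δ 0≤δ))))
      where
      dist : ∀ r → ∣ t - r ∣ ≡ δ + δ → ∣ s - r ∣ ≤ η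
      dist r eq = begin
        ∣ s - r ∣                 ≤⟨ ∣-∣-triangle s t r ⟩
        ∣ s - t ∣ + ∣ t - r ∣     ≤⟨ +-mono-≤ near (≤-reflexive eq) ⟩
        δ + (δ + δ)               ≤⟨ +-monoˡ-≤ (δ + δ) (≤-by {δ} δ refl 0≤δ) ⟩
        (δ + δ) + (δ + δ)         ≡⟨ 4δ≡η ⟩
        η                         ∎

  -- The Perron eigenvalue as a real number, and its comparison with λ.

  module Spectrum (G : Graph) where

    private
      n : ℕ
      n = order G

    Aℚ : Fin n → Fin n → ℚ
    Aℚ a b = if does (adj? G a b) then 1ℚ else 0ℚ

    Aℚᵛ : (Fin n → ℚ) → Fin n → ℚ
    Aℚᵛ f a = ∑[ b < n ] (Aℚ a b * f b)

    module _ (z : Vector ℂ n) (i : ℕ) where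

      seq-re-sum : ∀ {m} (f : Vector ℂ m) → seq (re (foldr _+ᶜ_ 0ᶜ f)) i ≡ ∑[ b < m ] seq (re (f b)) i
      seq-re-sum {zero}  f = refl
      seq-re-sum {suc m} f = cong (seq (re (f zero)) i +_) (seq-re-sum (f ∘ suc))

      seq-im-sum : ∀ {m} (f : Vector ℂ m) → seq (im (foldr _+ᶜ_ 0ᶜ f)) i ≡ ∑[ b < m ] seq (im (f b)) i
      seq-im-sum {zero}  f = refl
      seq-im-sum {suc m} f = cong (seq (im (f zero)) i +_) (seq-im-sum (f ∘ suc))

      seq-re-A· : ∀ a → seq (re ((adjacencyMatrix G · z) a)) i ≡ Aℚᵛ (λ b → seq (re (z b)) i) a
      seq-re-A· a = trans (seq-re-sum (λ b → adjacencyMatrix G a b *ᶜ z b)) (sum-cong-≗ term)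
        where
        eq₁ : ∀ x y → 1ℚ * x + - (0ℚ * y) ≡ 1ℚ * x
        eq₁ = solve-∀ ring
        eq₀ : ∀ x y → 0ℚ * x + - (0ℚ * y) ≡ 0ℚ * x
        eq₀ = solve-∀ ring
        term : ∀ b → seq (re (adjacencyMatrix G a b *ᶜ z b)) i ≡ Aℚ a b * seq (re (z b)) i
        term b with does (adj? G a b)
        ... | true  = eq₁ (seq (re (z b)) i) (seq (im (z b)) i)
        ... | false = eq₀ (seq (re (z b)) i) (seq (im (z b)) i)

      seq-im-A· : ∀ a → seq (im ((adjacencyMatrix G · z) a)) i ≡ Aℚᵛ (λ b → seq (im (z b)) i) a
      seq-im-A· a = trans (seq-im-sum (λ b → adjacencyMatrix G a b *ᶜ z b)) (sum-cong-≗ term)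
        where
        eq₁ : ∀ x y → 1ℚ * y + 0ℚ * x ≡ 1ℚ * y
        eq₁ = solve-∀ ring
        eq₀ : ∀ x y → 0ℚ * y + 0ℚ * x ≡ 0ℚ * y
        eq₀ = solve-∀ ring
        term : ∀ b → seq (im (adjacencyMatrix G a b *ᶜ z b)) i ≡ Aℚ a b * seq (im (z b)) i
        term b with does (adj? G a b)
        ... | true  = eq₁ (seq (re (z b)) i) (seq (im (z b)) i)
        ... | false = eq₀ (seq (re (z b)) i) (seq (im (z b)) i)

    module Perron (u₀ : Fin n) where

      open PowerIteration (adj? G) (symm G) u₀

      component : Fin n → ℝ
      component a = mkℝ (λ i → v i a) λ ε 0<ε → c ε 0<ε
        where
        c : ∀ ε → 0ℚ < ε → ∃[ M ] (∀ i j → M ℕ.≤ i → M ℕ.≤ j → ∣ v i a - v j a ∣ ≤ ε)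
        c ε 0<ε =
          let δ , 0<δ , δ+δ≡ε = half ε 0<ε
              L , h≤δ = h→0 δ 0<δ
              close = λ j L≤j → ≤-trans (v-cauchy L j a L≤j) (h≤δ L ℕ.≤-refl)
          in L , λ i j L≤i L≤j → ≤-trans (∣-∣-triangle (v i a) (v L a) (v j a)) (≤-trans
               (+-mono-≤ (close i L≤i) (≤-trans (≤-reflexive (∣-∣-sym (v L a) (v j a))) (close j L≤j)))
               (≤-reflexive δ+δ≡ε))

      eigenvector : Vector ℂ n
      eigenvector a = component a +i 0ℝ

      -- The eigenvector is 1 at `u₀`, so the entry of its image there is the eigenvalue. Taken from
      -- the matrix product, this real number needs no Cauchy proof of its own.
      μʳ : ℝ
      μʳ = re ((adjacencyMatrix G · eigenvector) u₀)

      seq-μʳ : ∀ i → seq μʳ i ≡ μ i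
      seq-μʳ i = seq-re-A· eigenvector i u₀

      isEigenvalue : IsEigenvalue (adjacencyMatrix G) (μʳ +i 0ℝ)
      isEigenvalue = eigenvector , nonzero , λ a → re-eq a , im-eq a
        where
        nonzero : ¬ (∀ a → eigenvector a ≈ᶜ 0ᶜ)
        nonzero all≈0 =
          let L , le = proj₁ (all≈0 u₀) ½ (positive⁻¹ ½)
              1≤½ = subst (λ t → ∣ t - 0ℚ ∣ ≤ ½) (v-u₀ L) (le L ℕ.≤-refl)
          in <-irrefl refl (<-≤-trans ½<1 1≤½)
          where
          ½<1 : ½ < 1ℚ
          ½<1 = subst (_< 1ℚ) (+-identityʳ ½) (+-monoʳ-< ½ (positive⁻¹ ½))
        re-eq : ∀ a → re ((adjacencyMatrix G · eigenvector) a) ≈ re ((μʳ +i 0ℝ) *ᶜ eigenvector a)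
        re-eq a ε 0<ε =
          let L , le = width₁*K₀→0 ε 0<ε
          in L , λ i L≤i → ≤-trans (≤-reflexive (cong ∣_∣ (trans
            (cong₂ (λ s t → s - (t * v i a + - (0ℚ * 0ℚ))) (seq-re-A· eigenvector i a) (seq-μʳ i))
            (tidy (Aᵛ (v i) a) (μ i) (v i a))))) (≤-trans (near-eigenvector i a) (le i L≤i))
          where
          tidy : ∀ A m v → A - (m * v + - (0ℚ * 0ℚ)) ≡ A - m * v
          tidy = solve-∀ ring
        im-eq : ∀ a → im ((adjacencyMatrix G · eigenvector) a) ≈ im ((μʳ +i 0ℝ) *ᶜ eigenvector a)
        im-eq a = ≗⇒≈ {im ((adjacencyMatrix G · eigenvector) a)} {im ((μʳ +i 0ℝ) *ᶜ eigenvector a)} λ i → trans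
          (trans (seq-im-A· eigenvector i a) (trans (sym (*-distribʳ-sum 0ℚ (Aℚ a))) (*-zeroʳ (sum (Aℚ a)))))
          (sym (zeros (seq μʳ i) (v i a)))
          where
          zeros : ∀ m v → m * 0ℚ + 0ℚ * v ≡ 0ℚ
          zeros = solve-∀ ring

      hasModulus : HasModulus (μʳ +i 0ℝ) μʳ
      hasModulus = (λ ε 0<ε → 0 , λ i _ → 0≤+ (subst (0ℚ ≤_) (sym (seq-μʳ i)) (0≤μ i)) (<⇒≤ 0<ε)) ,
        ≗⇒≈ {μʳ *ʳ μʳ} {μʳ *ʳ μʳ +ʳ 0ℝ *ʳ 0ℝ} (λ i → sym (+-identityʳ (seq μʳ i * seq μʳ i)))

      -- Maximality of λ bounds the limit of μ; at a late index, μ plus the width is at most λ + δ ≤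
      -- s, and `collatz` applies to the iterate at that index.
      subharmonic : ∀ {lam} → IsSpectralRadius (adjacencyMatrix G) lam → ∀ {s δ M} → 0ℚ < δ →
        (∀ i → M ℕ.≤ i → seq lam i + δ ≤ s) →
        Σ[ w ∈ (Fin n → ℚ) ] (∀ a → 0ℚ ≤ w a) × 1ℚ ≤ w u₀ × (∀ a → Aℚᵛ w a ≤ s * w a)
      subharmonic {lam} (_ , max) {s} {δ} {L} 0<δ lam+δ≤s =
        let η , 0<η , η+η≡δ = half δ 0<δ
            L₁ , μ≤lam+η = max (μʳ +i 0ℝ) μʳ isEigenvalue hasModulus η 0<η
            L₂ , width≤η = width₁→0 η 0<η
            i = L ℕ.+ (L₁ ℕ.+ L₂)
            L₁≤i = ℕ.≤-trans (ℕ.m≤m+n L₁ L₂) (ℕ.m≤n+m (L₁ ℕ.+ L₂) L)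
            L₂≤i = ℕ.≤-trans (ℕ.m≤n+m L₂ L₁) (ℕ.m≤n+m (L₁ ℕ.+ L₂) L)
            bound = begin
              μ i + width₁ i         ≤⟨ +-mono-≤ (subst (_≤ seq lam i + η) (seq-μʳ i) (μ≤lam+η i L₁≤i)) (width≤η i L₂≤i) ⟩
              seq lam i + η + η      ≡⟨ trans (+-assoc (seq lam i) η η) (cong (seq lam i +_) η+η≡δ) ⟩
              seq lam i + δ          ≤⟨ lam+δ≤s i (ℕ.m≤m+n L (L₁ ℕ.+ L₂)) ⟩
              s                      ∎
        in y i , 0≤y i , 1≤y-u₀ i , λ a → ≤-trans (collatz i a) (*-monoʳ (0≤y i a) bound)
        where open ≤-Reasoning

-- Transfer of the two degree bounds from natural numbers to λ.

module Bounds where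

  open import Algebra.Properties.Semiring.Sum (CommutativeRing.semiring ℚ.+-*-commutativeRing)
    using (sum; sum-syntax; sum-cong-≗; ∑-distrib-+; *-distribˡ-sum)
  open import Data.Rational.Base
  open import Data.Rational.Properties
  open import Algebra.Properties.Semiring.Sum ℕ.+-*-semiring using () renaming (sum to ℕsum)
  open import Data.Vec.Functional using (Vector)
  open import Defs using (ℝ; seq; _≈_; 0ℝ; fromℕ; _^⁻_; ℂ; re; im; _≈ᶜ_; 0ᶜ; _*ᶜ_; HasModulus; _·_;
    IsSpectralRadius; adjacencyMatrix; Graph; order; adj?; Subgraph; IsRegular; tensorPower)
    renaming (_≤_ to _≤ʳ_; _+_ to _+ʳ_; _*_ to _*ʳ_; _^_ to _^ʳ_)
  open Combinatorics using (sum-zero; type; module Types; module TensorPower) renaming (term≤sum to ℕterm≤sum)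
  open Rationals
  open Reals

  1≤⇒0<ι : ∀ {q} → 1 ℕ.≤ q → 0ℚ < ι q
  1≤⇒0<ι 1≤q = <-≤-trans (positive⁻¹ 1ℚ) (ι-mono 1≤q)

  *-cancelˡ : ∀ {r s t} → 0ℚ < r → r * s ≤ r * t → s ≤ t
  *-cancelˡ {r} 0<r = *-cancelˡ-≤-pos r {{positive 0<r}}

  fraction-^-≤ : ∀ {p q s d} K → 1 ℕ.≤ q → ι q * s ≡ ι p → q ℕ.^ K ℕ.* d ℕ.≤ p ℕ.^ K → ι d ≤ s ^ K
  fraction-^-≤ {p} {q} {s} {d} K 1≤q qs≡p le = *-cancelˡ (1≤⇒0<ι (ℕ.m^n>0 q {{ℕ.>-nonZero 1≤q}} K)) (begin
    ι (q ℕ.^ K) * ι d        ≡⟨ ι-* (q ℕ.^ K) d ⟨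
    ι (q ℕ.^ K ℕ.* d)        ≤⟨ ι-mono le ⟩
    ι (p ℕ.^ K)              ≡⟨ ι-^ p K ⟩
    ι p ^ K                ≡⟨ cong (_^ K) qs≡p ⟨
    (ι q * s) ^ K          ≡⟨ *-^-distrib (ι q) s K ⟩
    ι q ^ K * s ^ K      ≡⟨ cong (_* s ^ K) (ι-^ q K) ⟨
    ι (q ℕ.^ K) * s ^ K    ∎)
    where open ≤-Reasoning

  ≤-fraction-^ : ∀ {p q s d} K → 1 ℕ.≤ q → ι q * s ≡ ι p → p ℕ.^ K ℕ.≤ q ℕ.^ K ℕ.* d → s ^ K ≤ ι d
  ≤-fraction-^ {p} {q} {s} {d} K 1≤q qs≡p le = *-cancelˡ (1≤⇒0<ι (ℕ.m^n>0 q {{ℕ.>-nonZero 1≤q}} K)) (begin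
    ι (q ℕ.^ K) * s ^ K    ≡⟨ cong (_* s ^ K) (ι-^ q K) ⟩
    ι q ^ K * s ^ K      ≡⟨ *-^-distrib (ι q) s K ⟨
    (ι q * s) ^ K          ≡⟨ cong (_^ K) qs≡p ⟩
    ι p ^ K                ≡⟨ ι-^ p K ⟨
    ι (p ℕ.^ K)              ≤⟨ ι-mono le ⟩
    ι (q ℕ.^ K ℕ.* d)        ≡⟨ ι-* (q ℕ.^ K) d ⟩
    ι (q ℕ.^ K) * ι d        ∎)
    where open ≤-Reasoning

  module _ (G : Graph) where

    open TensorPower G
    open Spectrum G

    private
      n : ℕ
      n = order G

    Aᴺᵛ : (Fin n → ℕ) → Fin n → ℕ
    Aᴺᵛ g a = ℕsum (λ b → A a b ℕ.* g b)

    Aℚᵛ-scale : ∀ c f a → Aℚᵛ (λ b → c * f b) a ≡ c * Aℚᵛ f a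
    Aℚᵛ-scale c f a = trans (sum-cong-≗ λ b → exchange (Aℚ a b) c (f b)) (sym (*-distribˡ-sum c (λ b → Aℚ a b * f b)))
      where
      exchange : ∀ a c f → a * (c * f) ≡ c * (a * f)
      exchange = solve-∀ ring

    ι-Aᴺᵛ : ∀ {D f} g → (∀ b → D * f b ≡ ι (g b)) → ∀ a → ι (Aᴺᵛ g a) ≡ D * Aℚᵛ f a
    ι-Aᴺᵛ {D} {f} g Df≡g a = begin
      ι (Aᴺᵛ g a)                        ≡⟨ ι-sum (λ b → A a b ℕ.* g b) ⟩
      ∑[ b < n ] ι (A a b ℕ.* g b)       ≡⟨ sum-cong-≗ (λ b → trans (ι-* (A a b) (g b)) (cong₂ _*_ (ι-⟦⟧ (adj? G a b)) (sym (Df≡g b)))) ⟩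
      Aℚᵛ (λ b → D * f b) a              ≡⟨ Aℚᵛ-scale D f a ⟩
      D * Aℚᵛ f a                        ∎
      where open ≡-Reasoning

    module _ {lam : ℝ} (spectral : IsSpectralRadius (adjacencyMatrix G) lam) where

      -- With s = p / q and each weight multiplied by a common denominator of its entries,
      -- `degree-upper-bound` applies in ℕ.
      regular⇒degree≤ : ∀ {s δ N} → 0ℚ ≤ s → 0ℚ < δ → (∀ i → N ℕ.≤ i → seq lam i + δ ≤ s) →
        ∀ K .{{_ : ℕ.NonZero K}} (F : Subgraph (tensorPower G K)) {d} → IsRegular F d → ι d ≤ s ^ K
      regular⇒degree≤ {s} 0≤s 0<δ gap K F {d} regular =
        let p , q , 1≤q , qs≡p = fraction s 0≤s
            weight = λ u → natural-weight {p} {q} 1≤q qs≡p u (Perron.subharmonic u {lam} spectral 0<δ gap)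
        in fraction-^-≤ {p} {q} {s} {d} K 1≤q qs≡p (degree-upper-bound K F regular (λ u → proj₁ (weight u)) p q
             (λ u → proj₁ (proj₂ (weight u))) (λ u → proj₂ (proj₂ (weight u))))
        where
        open ≤-Reasoning
        regroup : ∀ q D s w → q * (D * (s * w)) ≡ q * s * (D * w)
        regroup = solve-∀ ring
        natural-weight : ∀ {p q} → 1 ℕ.≤ q → ι q * s ≡ ι p → ∀ u →
          Σ[ w ∈ (Fin n → ℚ) ] (∀ a → 0ℚ ≤ w a) × 1ℚ ≤ w u × (∀ a → Aℚᵛ w a ≤ s * w a) →
          Σ[ g ∈ (Fin n → ℕ) ] 1 ℕ.≤ g u × (∀ a → q ℕ.* Aᴺᵛ g a ℕ.≤ p ℕ.* g a)
        natural-weight {p} {q} 1≤q qs≡p u (w , 0≤w , 1≤w , Aw≤sw) =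
          let D , 1≤D , g , Dw≡g = common-denominator w 0≤w
          in g ,
             ι-cancel-≤ {1} {g u} (subst (1ℚ ≤_) (Dw≡g u) (≤-trans (ι-mono 1≤D) (≤-trans
               (≤-reflexive (sym (*-identityʳ (ι D)))) (*-monoˡ (0≤ι D) 1≤w)))) ,
             λ a → ι-cancel-≤ {q ℕ.* Aᴺᵛ g a} {p ℕ.* g a} (begin
               ι (q ℕ.* Aᴺᵛ g a)             ≡⟨ ι-* q (Aᴺᵛ g a) ⟩
               ι q * ι (Aᴺᵛ g a)             ≡⟨ cong (ι q *_) (ι-Aᴺᵛ {ι D} {w} g Dw≡g a) ⟩
               ι q * (ι D * Aℚᵛ w a)         ≤⟨ *-monoˡ (0≤ι q) (*-monoˡ (0≤ι D) (Aw≤sw a)) ⟩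
               ι q * (ι D * (s * w a))       ≡⟨ regroup (ι q) (ι D) s (w a) ⟩
               ι q * s * (ι D * w a)         ≡⟨ cong₂ _*_ qs≡p (Dw≡g a) ⟩
               ι p * ι (g a)                 ≡⟨ ι-* p (g a) ⟨
               ι (p ℕ.* g a)                 ∎)

    Sᴺ Tᴺ : (Fin n → ℕ) → ℕ
    Sᴺ g = ℕsum (λ a → g a ℕ.* g a)
    Tᴺ g = ℕsum (λ a → Aᴺᵛ g a ℕ.* Aᴺᵛ g a)

    S T : (Fin n → ℚ) → ℚ
    S f = ∑[ a < n ] (f a * f a)
    T f = ∑[ a < n ] (Aℚᵛ f a * Aℚᵛ f a)

    ι-S : ∀ {D f} g → (∀ b → D * f b ≡ ι (g b)) → ι (Sᴺ g) ≡ D * D * S f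
    ι-S {D} {f} g Df≡g = trans (ι-sum (λ a → g a ℕ.* g a)) (trans
      (sum-cong-≗ λ a → trans (ι-* (g a) (g a)) (trans (sym (cong₂ _*_ (Df≡g a) (Df≡g a))) (square D (f a))))
      (sym (*-distribˡ-sum (D * D) (λ a → f a * f a))))
      where
      square : ∀ D f → D * f * (D * f) ≡ D * D * (f * f)
      square = solve-∀ ring

    ι-T : ∀ {D f} g → (∀ b → D * f b ≡ ι (g b)) → ι (Tᴺ g) ≡ D * D * T f
    ι-T {D} {f} g Df≡g = ι-S {D} {Aℚᵛ f} (Aᴺᵛ g) (λ a → sym (ι-Aᴺᵛ {D} {f} g Df≡g a))

    0≤Aℚ : ∀ a b → 0ℚ ≤ Aℚ a b
    0≤Aℚ a b with does (adj? G a b)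
    ... | true  = 0≤1
    ... | false = ≤-refl

    -- The entries of A are nonnegative. Passing to |f| keeps `S` and makes the vector nonnegative,
    -- so that clearing denominators lands in ℕ.
    T≤T∣∣ : ∀ f → T f ≤ T (∣_∣ ∘ f)
    T≤T∣∣ f = sum-mono λ a → begin
      Aℚᵛ f a * Aℚᵛ f a                 ≡⟨ ∣x∣²≡x² (Aℚᵛ f a) ⟨
      ∣ Aℚᵛ f a ∣ * ∣ Aℚᵛ f a ∣         ≤⟨ *-mono (0≤∣p∣ (Aℚᵛ f a)) (≤-trans (0≤∣p∣ (Aℚᵛ f a)) (∣A∣≤ a)) (∣A∣≤ a) (∣A∣≤ a) ⟩
      Aℚᵛ (∣_∣ ∘ f) a * Aℚᵛ (∣_∣ ∘ f) a ∎
      where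
      open ≤-Reasoning
      ∣A∣≤ : ∀ a → ∣ Aℚᵛ f a ∣ ≤ Aℚᵛ (∣_∣ ∘ f) a
      ∣A∣≤ a = ≤-trans (∣sum∣≤ (λ b → Aℚ a b * f b)) (≤-reflexive (sum-cong-≗ λ b →
        trans (∣p*q∣≡∣p∣*∣q∣ (Aℚ a b) (f b)) (cong (_* ∣ f b ∣) (0≤p⇒∣p∣≡p (0≤Aℚ a b)))))

    naturals⇒rationals : ∀ {p q r} → 1 ℕ.≤ q → ι q * r ≡ ι p → (∀ g → q ℕ.* Tᴺ g ℕ.≤ p ℕ.* Sᴺ g) → ∀ f → T f ≤ r * S f
    naturals⇒rationals {p} {q} {r} 1≤q qr≡p naturals f =
      let D , 1≤D , g , Df≡g = common-denominator (∣_∣ ∘ f) (λ a → 0≤∣p∣ (f a))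
      in ≤-trans (T≤T∣∣ f) (subst (λ t → T f′ ≤ r * t) (sum-cong-≗ λ a → ∣x∣²≡x² (f a))
        (*-cancelˡ (0<* (1≤⇒0<ι 1≤q) (0<* (1≤⇒0<ι 1≤D) (1≤⇒0<ι 1≤D))) (begin
          ι q * (ι D * ι D) * T f′         ≡⟨ *-assoc (ι q) (ι D * ι D) (T f′) ⟩
          ι q * (ι D * ι D * T f′)         ≡⟨ cong (ι q *_) (ι-T {ι D} {f′} g Df≡g) ⟨
          ι q * ι (Tᴺ g)                   ≡⟨ ι-* q (Tᴺ g) ⟨
          ι (q ℕ.* Tᴺ g)                   ≤⟨ ι-mono (naturals g) ⟩
          ι (p ℕ.* Sᴺ g)                   ≡⟨ ι-* p (Sᴺ g) ⟩
          ι p * ι (Sᴺ g)                   ≡⟨ cong₂ _*_ (sym qr≡p) (ι-S {ι D} {f′} g Df≡g) ⟩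
          ι q * r * (ι D * ι D * S f′)     ≡⟨ regroup (ι q) r (ι D * ι D) (S f′) ⟩
          ι q * (ι D * ι D) * (r * S f′)   ∎)))
      where
      open ≤-Reasoning
      f′ : Fin n → ℚ
      f′ = ∣_∣ ∘ f
      regroup : ∀ q r D S → q * r * (D * S) ≡ q * D * (r * S)
      regroup = solve-∀ ring

    square-cancel : ∀ {x ε} → 0ℚ < ε → x * x ≤ ε * ε → ∣ x ∣ ≤ ε
    square-cancel {x} {ε} 0<ε x²≤ε² with ≤-total ∣ x ∣ ε
    ... | inj₁ le   = le
    ... | inj₂ ε≤∣x∣ = *-cancelˡ (<-≤-trans 0<ε ε≤∣x∣) (begin
      ∣ x ∣ * ∣ x ∣    ≡⟨ ∣x∣²≡x² x ⟩
      x * x            ≤⟨ x²≤ε² ⟩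
      ε * ε            ≤⟨ *-monoʳ (<⇒≤ 0<ε) ε≤∣x∣ ⟩
      ∣ x ∣ * ε        ∎)
      where open ≤-Reasoning

    -- |A z|² = |μ|² |z|² = λ² |z|², whereas |A f|² ≤ r |f|² for the rational approximations f of the
    -- real and imaginary parts of z; as r < λ², this forces z = 0.
    module _ {lam : ℝ} {μ : ℂ} (modulus : HasModulus μ lam) (z : Vector ℂ n)
             (Az≈μz : ∀ a → (adjacencyMatrix G · z) a ≈ᶜ (μ *ᶜ z a))
             {r δ : ℚ} {N : ℕ} (0<δ : 0ℚ < δ) (gap : ∀ i → N ℕ.≤ i → r + δ ≤ seq lam i * seq lam i)
             (T≤rS : ∀ f → T f ≤ r * S f) where

      private
        x y : ℕ → Fin n → ℚ
        x i a = seq (re (z a)) i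
        y i a = seq (im (z a)) i

        Z W : ℕ → ℚ
        Z i = S (x i) + S (y i)
        W i = T (x i) + T (y i)

      pointwise : ∀ a → (re ((adjacencyMatrix G · z) a) *ʳ re ((adjacencyMatrix G · z) a) +ʳ
                         im ((adjacencyMatrix G · z) a) *ʳ im ((adjacencyMatrix G · z) a)) ≈
                        ((lam *ʳ lam) *ʳ (re (z a) *ʳ re (z a) +ʳ im (z a) *ʳ im (z a)))
      pointwise a = ≈-trans {R₁} {R₂} {R₃}
        (+-cong-≈ {p *ʳ p} {p′ *ʳ p′} {q *ʳ q} {q′ *ʳ q′}
          (*-cong-≈ {p} {p′} {p} {p′} (proj₁ (Az≈μz a)) (proj₁ (Az≈μz a)))
          (*-cong-≈ {q} {q′} {q} {q′} (proj₂ (Az≈μz a)) (proj₂ (Az≈μz a))))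
        (≈-trans {R₂} {m *ʳ t} {R₃}
          -- The two-square identity |μ z|² = |μ|² |z|² holds exactly at each index; |μ|² is then
          -- replaced by λ².
          (≗⇒≈ {R₂} {m *ʳ t} λ i → brahmagupta (seq (re μ) i) (seq (im μ) i) (x i a) (y i a))
          (*-cong-≈ {m} {lam *ʳ lam} {t} {t} (≈-sym {lam *ʳ lam} {m} (proj₂ modulus)) (≗⇒≈ {t} {t} λ _ → refl)))
        where
        p = re ((adjacencyMatrix G · z) a)
        q = im ((adjacencyMatrix G · z) a)
        p′ = re (μ *ᶜ z a)
        q′ = im (μ *ᶜ z a)
        m = re μ *ʳ re μ +ʳ im μ *ʳ im μ
        t = re (z a) *ʳ re (z a) +ʳ im (z a) *ʳ im (z a)
        R₁ = p *ʳ p +ʳ q *ʳ q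
        R₂ = p′ *ʳ p′ +ʳ q′ *ʳ q′
        R₃ = (lam *ʳ lam) *ʳ t
        brahmagupta : ∀ α β x y → (α * x + - (β * y)) * (α * x + - (β * y)) + (α * y + β * x) * (α * y + β * x) ≡
                                  (α * α + β * β) * (x * x + y * y)
        brahmagupta = solve-∀ ring

      W≈λ²Z : Null (λ i → W i - seq lam i * seq lam i * Z i)
      W≈λ²Z = Null-cong eq (Null-sum pointwise)
        where
        minus : ∀ w l z → w - l * z ≡ w + (- l) * z
        minus = solve-∀ ring
        eq : ∀ i → ∑[ a < n ] ((seq (re ((adjacencyMatrix G · z) a)) i * seq (re ((adjacencyMatrix G · z) a)) i +
                                seq (im ((adjacencyMatrix G · z) a)) i * seq (im ((adjacencyMatrix G · z) a)) i) -
                               seq lam i * seq lam i * (x i a * x i a + y i a * y i a))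
                 ≡ W i - seq lam i * seq lam i * Z i
        eq i = begin
          ∑[ a < n ] ((seq (re ((adjacencyMatrix G · z) a)) i * seq (re ((adjacencyMatrix G · z) a)) i +
                       seq (im ((adjacencyMatrix G · z) a)) i * seq (im ((adjacencyMatrix G · z) a)) i) -
                      l * (x i a * x i a + y i a * y i a))
            ≡⟨ sum-cong-≗ (λ a → trans
                 (cong₂ (λ s t → s * s + t * t - l * (x i a * x i a + y i a * y i a)) (seq-re-A· z i a) (seq-im-A· z i a))
                 (minus (X a * X a + Y a * Y a) l (x i a * x i a + y i a * y i a))) ⟩
          ∑[ a < n ] (X a * X a + Y a * Y a + (- l) * (x i a * x i a + y i a * y i a))
            ≡⟨ ∑-distrib-+ (λ a → X a * X a + Y a * Y a) (λ a → (- l) * (x i a * x i a + y i a * y i a)) ⟩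
          ∑[ a < n ] (X a * X a + Y a * Y a) + ∑[ a < n ] ((- l) * (x i a * x i a + y i a * y i a))
            ≡⟨ cong₂ _+_ (∑-distrib-+ (λ a → X a * X a) (λ a → Y a * Y a))
                 (trans (sym (*-distribˡ-sum (- l) (λ a → x i a * x i a + y i a * y i a)))
                        (cong ((- l) *_) (∑-distrib-+ (λ a → x i a * x i a) (λ a → y i a * y i a)))) ⟩
          W i + (- l) * Z i ≡⟨ minus (W i) l (Z i) ⟨
          W i - l * Z i ∎
          where
          open ≡-Reasoning
          l = seq lam i * seq lam i
          X = Aℚᵛ (x i)
          Y = Aℚᵛ (y i)

      0≤S : ∀ f → 0ℚ ≤ S f
      0≤S f = 0≤sum λ a → 0≤² (f a)

      -- W ≤ r Z and r + δ ≤ λ² give δ Z ≤ λ² Z - W, a null sequence.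
      Z→0 : ∀ ε → 0ℚ < ε → ∃[ L ] (∀ i → L ℕ.≤ i → Z i ≤ ε)
      Z→0 ε 0<ε =
        let L , close = W≈λ²Z (δ * ε) (0<* 0<δ 0<ε)
        in N ℕ.⊔ L , λ i NL≤i → *-cancelˡ 0<δ (bound i
             (gap i (ℕ.≤-trans (ℕ.m≤m⊔n N L) NL≤i)) (close i (ℕ.≤-trans (ℕ.m≤n⊔m N L) NL≤i)))
        where
        open ≤-Reasoning
        eq₁ : ∀ r δ Z → δ * Z ≡ (r + δ) * Z - r * Z
        eq₁ = solve-∀ ring
        eq₂ : ∀ l r s t → l * (s + t) - r * (s + t) ≡ l * (s + t) - (r * s + r * t)
        eq₂ = solve-∀ ring
        eq₃ : ∀ s t → s - t ≡ - (t - s)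
        eq₃ = solve-∀ ring
        bound : ∀ i → r + δ ≤ seq lam i * seq lam i → ∣ W i - seq lam i * seq lam i * Z i ∣ ≤ δ * ε → δ * Z i ≤ δ * ε
        bound i gapᵢ closeᵢ = begin
          δ * Z i                               ≡⟨ eq₁ r δ (Z i) ⟩
          (r + δ) * Z i - r * Z i               ≤⟨ +-monoˡ-≤ (- (r * Z i)) (*-monoʳ (0≤+ (0≤S (x i)) (0≤S (y i))) gapᵢ) ⟩
          l * Z i - r * Z i                     ≡⟨ eq₂ l r (S (x i)) (S (y i)) ⟩
          l * Z i - (r * S (x i) + r * S (y i)) ≤⟨ +-monoʳ-≤ (l * Z i) (neg-antimono-≤ (+-mono-≤ (T≤rS (x i)) (T≤rS (y i)))) ⟩
          l * Z i - W i                         ≡⟨ eq₃ (l * Z i) (W i) ⟩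
          - (W i - l * Z i)                     ≤⟨ -≤∣∣ (W i - l * Z i) ⟩
          ∣ W i - l * Z i ∣                     ≤⟨ closeᵢ ⟩
          δ * ε                                 ∎
          where l = seq lam i * seq lam i

      z≈0 : ∀ a → z a ≈ᶜ 0ᶜ
      z≈0 a = part (re (z a)) (λ i → ≤-trans (term≤sum (λ a → 0≤² (x i a)) a) (≤-by (S (y i)) refl (0≤S (y i)))) ,
              part (im (z a)) (λ i → ≤-trans (term≤sum (λ a → 0≤² (y i a)) a)
                                       (≤-by (S (x i)) (+-comm (S (x i)) (S (y i))) (0≤S (x i))))
        where
        part : ∀ s → (∀ i → seq s i * seq s i ≤ Z i) → s ≈ 0ℝ
        part s s²≤Z ε 0<ε =
          let L , Z≤ε² = Z→0 (ε * ε) (0<* 0<ε 0<ε) in L , λ i L≤i → subst (λ t → ∣ t ∣ ≤ ε) (sym (+-identityʳ (seq s i)))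
          (square-cancel 0<ε (≤-trans (s²≤Z i) (Z≤ε² i L≤i)))

    module _ {lam : ℝ} (spectral : IsSpectralRadius (adjacencyMatrix G) lam) where

      -- If the corresponding inequality in ℕ failed, `degree-lower-bound` would rule out p |g|² ≤ q
      -- |A g|² for every nonzero natural `g`, so that |A g|² ≤ r |g|² without exception.
      ≤regular-degree : ∀ {r δ N} → 0ℚ ≤ r → 0ℚ < δ → (∀ i → N ℕ.≤ i → r + δ ≤ seq lam i * seq lam i) →
        ∀ k {Δ} → let open Types A A-sym {k} in
        (∀ x y → D x (type y) ℕ.* D y (type x) ℕ.≤ Δ) → r ^ k ≤ ι (P ℕ.* P ℕ.* (P ℕ.* P) ℕ.* Δ)
      ≤regular-degree {r} 0≤r 0<δ gap k {Δ} DD≤Δ =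
        let p , q , 1≤q , qr≡p = fraction r 0≤r
        in ≤-fraction-^ {p} {q} {r} {X} k 1≤q qr≡p
          (decidable-stable (p ℕ.^ k ℕ.≤? q ℕ.^ k ℕ.* X) λ fails →
            let ((μ , (z , z≉0 , Az≈μz) , modulus) , _) = spectral in
            z≉0 (z≈0 {lam} {μ} modulus z Az≈μz {r} 0<δ gap (naturals⇒rationals {p} {q} {r} 1≤q qr≡p (naturals p q fails))))
        where
        open Types A A-sym {k}
        X = P ℕ.* P ℕ.* (P ℕ.* P) ℕ.* Δ
        naturals : ∀ p q → ¬ p ℕ.^ k ℕ.≤ q ℕ.^ k ℕ.* X → ∀ g → q ℕ.* Tᴺ g ℕ.≤ p ℕ.* Sᴺ g
        naturals p q fails g = cases (1 ℕ.≤? Sᴺ g) (ℕ.≤-total (q ℕ.* Tᴺ g) (p ℕ.* Sᴺ g))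
          where
          T≡0 : ¬ 1 ℕ.≤ Sᴺ g → Tᴺ g ≡ 0
          T≡0 1≰S = sum-zero λ a → cong (λ t → t ℕ.* t) (sum-zero λ b → trans (cong (A a b ℕ.*_) (g≡0 b)) (ℕ.*-zeroʳ (A a b)))
            where
            square≡0 : ∀ m → ¬ 1 ℕ.≤ m ℕ.* m → m ≡ 0
            square≡0 zero    _  = refl
            square≡0 (suc m) ≰ = contradiction (ℕ.s≤s ℕ.z≤n) ≰
            g≡0 : ∀ b → g b ≡ 0
            g≡0 b = square≡0 (g b) λ 1≤g² → 1≰S (ℕ.≤-trans 1≤g² (ℕterm≤sum (λ a → g a ℕ.* g a) b))
          cases : Dec (1 ℕ.≤ Sᴺ g) → q ℕ.* Tᴺ g ℕ.≤ p ℕ.* Sᴺ g ⊎ p ℕ.* Sᴺ g ℕ.≤ q ℕ.* Tᴺ g → q ℕ.* Tᴺ g ℕ.≤ p ℕ.* Sᴺ g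
          cases _         (inj₁ le) = le
          cases (yes 1≤S) (inj₂ ge) = contradiction (degree-lower-bound g DD≤Δ p q ge 1≤S) fails
          cases (no 1≰S)  (inj₂ _)  = ℕ.≤-trans (ℕ.≤-reflexive (trans (cong (q ℕ.*_) (T≡0 1≰S)) (ℕ.*-zeroʳ q))) ℕ.z≤n

  unit-fraction : ∀ m .{{_ : ℕ.NonZero m}} → (ℤ.+ 1 / m) * ι m ≡ 1ℚ
  unit-fraction (suc m) = toℚᵘ-injective (begin
    toℚᵘ ((ℤ.+ 1 / suc m) * ι (suc m))                 ≈⟨ toℚᵘ-homo-* (ℤ.+ 1 / suc m) (ι (suc m)) ⟩
    toℚᵘ (ℤ.+ 1 / suc m) ℚᵘ.* toℚᵘ (ι (suc m))
      ≈⟨ ℚᵘ.*-cong (toℚᵘ-fromℚᵘ (ℚᵘ.mkℚᵘ (ℤ.+ 1) m)) (toℚᵘ-ι (suc m)) ⟩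
    ℚᵘ.mkℚᵘ (ℤ.+ 1) m ℚᵘ.* ℚᵘ.mkℚᵘ (ℤ.+ suc m) 0       ≈⟨ ℚᵘ.*≡* (cross (ℤ.+ suc m)) ⟩
    ℚᵘ.1ℚᵘ                                             ∎)
    where
    open ℚᵘ.≃-Reasoning
    cross : ∀ z → ℤ.1ℤ ℤ.* z ℤ.* ℤ.1ℤ ≡ ℤ.1ℤ ℤ.* (z ℤ.* ℤ.1ℤ)
    cross z = ℤ.*-assoc ℤ.1ℤ z ℤ.1ℤ

  ^-+ : ∀ x j k → x ^ (j ℕ.+ k) ≡ x ^ j * x ^ k
  ^-+ x zero    k = sym (*-identityˡ (x ^ k))
  ^-+ x (suc j) k = trans (cong (x *_) (^-+ x j k)) (sym (*-assoc x (x ^ j) (x ^ k)))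

  0^ : ∀ k .{{_ : ℕ.NonZero k}} → 0ℚ ^ k ≡ 0ℚ
  0^ (suc k) = *-zeroˡ (0ℚ ^ k)

  module _ (G : Graph) {lam : ℝ} (spectral : IsSpectralRadius (adjacencyMatrix G) lam) where

    open TensorPower G

    -- For every ε there is a rational s above λ with s^K ≤ λ^K + ε, and d ≤ s^K.
    regular-degree≤lam^ : ∀ K .{{_ : ℕ.NonZero K}} (F : Subgraph (tensorPower G K)) {d} → IsRegular F d → fromℕ d ≤ʳ lam ^ʳ K
    regular-degree≤lam^ K F {d} regular ε 0<ε =
      let η , 0<η , L₁ , continuous = ^-continuous lam K ε 0<ε
          δ , t , 0<δ , L₂ , approx = approximate lam η 0<η
          -- A modulus is nonnegative: at a late index 0 ≤ λ + δ ≤ s.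
          L₃ , 0≤lam+δ = proj₁ (proj₂ (proj₂ (proj₁ spectral))) δ 0<δ
          s = t + (δ + δ)
          j = L₂ ℕ.⊔ L₃
          0≤s = ≤-trans (0≤lam+δ j (ℕ.m≤n⊔m L₂ L₃)) (proj₁ (proj₁ (approx j (ℕ.m≤m⊔n L₂ L₃))))
          d≤s^K = regular⇒degree≤ G {lam} spectral {s} 0≤s 0<δ (λ i L₂≤i → proj₁ (proj₁ (approx i L₂≤i))) K F regular
      in L₁ ℕ.⊔ L₂ , λ i L≤i → ≤-trans d≤s^K (subst (λ p → s ^ K ≤ p + ε) (sym (seq-^ lam K i))
           (∣-∣≤⇒≤+ {s ^ K} {seq lam i ^ K} (subst (_≤ ε) (∣-∣-sym (seq lam i ^ K) (s ^ K))
             (continuous i s (ℕ.≤-trans (ℕ.m≤m⊔n L₁ L₂) L≤i)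
               (proj₂ (proj₁ (approx i (ℕ.≤-trans (ℕ.m≤n⊔m L₁ L₂) L≤i))))))))

    module _ (k : ℕ) .{{_ : ℕ.NonZero k}} where

      open Types A A-sym {k}

      -- The square λ² is approximated from below by a rational r; when r < 0, λ² is within η of 0.
      lam²^k≤ : ∀ {Δ} → (∀ x y → D x (type y) ℕ.* D y (type x) ℕ.≤ Δ) →
        ∀ ε → 0ℚ < ε → ∃[ L ] (∀ i → L ℕ.≤ i → (seq lam i * seq lam i) ^ k ≤ ι (P ℕ.* P ℕ.* (P ℕ.* P) ℕ.* Δ) + ε)
      lam²^k≤ {Δ} DD≤Δ ε 0<ε =
        let η , 0<η , L₁ , continuous = ^-continuous (lam *ʳ lam) k ε 0<ε
            δ , t , 0<δ , L₂ , approx = approximate (lam *ʳ lam) η 0<η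
            r = t - (δ + δ)
            close = λ i s L≤i near → ∣-∣≤⇒≤+ {(seq lam i * seq lam i) ^ k} {s ^ k}
                      (continuous i s (ℕ.≤-trans (ℕ.m≤m⊔n L₁ L₂) L≤i) near)
            L₂≤ = λ {i} L≤i → ℕ.≤-trans {L₂} {L₁ ℕ.⊔ L₂} {i} (ℕ.m≤n⊔m L₁ L₂) L≤i
        in L₁ ℕ.⊔ L₂ , λ i L≤i → conclude {r} {δ} {L₂} 0<δ (λ i L₂≤i → proj₁ (proj₂ (approx i L₂≤i)))
             (close i r L≤i (proj₂ (proj₂ (approx i (L₂≤ L≤i)))))
             (λ r≤0 → close i 0ℚ L≤i (near-0 r≤0 (0≤² (seq lam i)) (proj₂ (proj₂ (approx i (L₂≤ L≤i))))))
        where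
        X = P ℕ.* P ℕ.* (P ℕ.* P) ℕ.* Δ
        near-0 : ∀ {r s η} → r ≤ 0ℚ → 0ℚ ≤ s → ∣ s - r ∣ ≤ η → ∣ s - 0ℚ ∣ ≤ η
        near-0 {r} {s} {η} r≤0 0≤s near = begin
          ∣ s - 0ℚ ∣    ≡⟨ cong ∣_∣ (+-identityʳ s) ⟩
          ∣ s ∣         ≡⟨ 0≤p⇒∣p∣≡p 0≤s ⟩
          s             ≤⟨ ≤-by {s} (- r) refl (neg-antimono-≤ r≤0) ⟩
          s - r         ≤⟨ ≤∣∣ (s - r) ⟩
          ∣ s - r ∣     ≤⟨ near ⟩
          η             ∎
          where open ≤-Reasoning
        conclude : ∀ {r δ L p} → 0ℚ < δ → (∀ i → L ℕ.≤ i → r + δ ≤ seq lam i * seq lam i) →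
          p ≤ r ^ k + ε → (r ≤ 0ℚ → p ≤ 0ℚ ^ k + ε) → p ≤ ι X + ε
        conclude {r} {δ} {L} {p} 0<δ gap p≤r^k p≤0^k = cases (≤-total 0ℚ r)
          where
          cases : 0ℚ ≤ r ⊎ r ≤ 0ℚ → p ≤ ι X + ε
          cases (inj₁ 0≤r) = ≤-trans p≤r^k (+-monoˡ-≤ ε (≤regular-degree G {lam} spectral {r} {δ} {L} 0≤r 0<δ gap k DD≤Δ))
          cases (inj₂ r≤0) = ≤-trans (p≤0^k r≤0) (+-monoˡ-≤ ε (≤-trans (≤-reflexive (0^ k)) (0≤ι X)))

      private
        n : ℕ
        n = order G

      -- P is (k + 1)^n, and k + 1 ≤ 2k. The exponent C = 4n originates here.
      P⁴≤ : P ℕ.* P ℕ.* (P ℕ.* P) ℕ.≤ (k ℕ.+ k) ℕ.^ (n ℕ.* 4)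
      P⁴≤ = begin
        P ℕ.* P ℕ.* (P ℕ.* P)                                   ≡⟨ fourth P ⟩
        P ℕ.^ 4                                                 ≡⟨ ℕ.^-*-assoc (suc k) n 4 ⟩
        suc k ℕ.^ (n ℕ.* 4)                                     ≤⟨ ℕ.^-monoˡ-≤ (n ℕ.* 4) (ℕ.+-monoˡ-≤ k (ℕ.>-nonZero⁻¹ k)) ⟩
        (k ℕ.+ k) ℕ.^ (n ℕ.* 4)                                 ∎
        where
        open ℕ.≤-Reasoning
        fourth : ∀ m → m ℕ.* m ℕ.* (m ℕ.* m) ≡ m ℕ.^ 4
        fourth m = trans (ℕ.*-assoc m m (m ℕ.* m)) (cong (λ t → m ℕ.* (m ℕ.* (m ℕ.* t))) (sym (ℕ.*-identityʳ m)))

      -- By `P⁴≤`, the factor P⁴ is at most m = (2k)^4n. Multiplication by 1 / m ≤ 1 removes it and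
      -- does not enlarge the error ε.
      lam^*^⁻≤ : .{{_ : ℕ.NonZero (k ℕ.+ k)}} → ∀ {Δ} → (∀ x y → D x (type y) ℕ.* D y (type x) ℕ.≤ Δ) →
        (lam ^ʳ (k ℕ.+ k)) *ʳ ((k ℕ.+ k) ^⁻ (n ℕ.* 4)) ≤ʳ fromℕ Δ
      lam^*^⁻≤ {Δ} DD≤Δ ε 0<ε =
        let L , bound = lam²^k≤ DD≤Δ ε 0<ε
        in L , λ i L≤i → begin
          seq (lam ^ʳ K) i * c                          ≡⟨ cong (_* c) (trans (seq-^ lam K i) (square-^ (seq lam i))) ⟩
          (seq lam i * seq lam i) ^ k * c             ≤⟨ *-monoʳ 0≤c (bound i L≤i) ⟩
          (ι (P ℕ.* P ℕ.* (P ℕ.* P) ℕ.* Δ) + ε) * c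
            ≤⟨ *-monoʳ 0≤c (+-monoˡ-≤ ε (≤-trans (ι-mono (ℕ.*-monoˡ-≤ Δ P⁴≤)) (≤-reflexive (ι-* m Δ)))) ⟩
          (ι m * ι Δ + ε) * c                           ≡⟨ expand (ι m) (ι Δ) ε c ⟩
          c * ι m * ι Δ + ε * c                         ≤⟨ +-mono-≤ (≤-reflexive (trans (cong (_* ι Δ) cm≡1) (*-identityˡ (ι Δ))))
                                                            (≤-trans (*-monoˡ (<⇒≤ 0<ε) c≤1) (≤-reflexive (*-identityʳ ε))) ⟩
          ι Δ + ε                                       ∎
        where
        open ≤-Reasoning
        K = k ℕ.+ k
        m = K ℕ.^ (n ℕ.* 4)
        instance
          m≢0 : ℕ.NonZero m
          m≢0 = ℕ.m^n≢0 K (n ℕ.* 4)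
        c : ℚ
        c = ℤ.+ 1 / m
        cm≡1 : c * ι m ≡ 1ℚ
        cm≡1 = unit-fraction m
        0≤c : 0ℚ ≤ c
        0≤c = nonNegative⁻¹ c {{pos⇒nonNeg c {{normalize-pos 1 m}}}}
        c≤1 : c ≤ 1ℚ
        c≤1 = begin
          c          ≡⟨ *-identityʳ c ⟨
          c * 1ℚ     ≤⟨ *-monoˡ 0≤c (ι-mono (ℕ.>-nonZero⁻¹ m)) ⟩
          c * ι m    ≡⟨ cm≡1 ⟩
          1ℚ         ∎
        square-^ : ∀ s → s ^ (k ℕ.+ k) ≡ (s * s) ^ k
        square-^ s = trans (^-+ s k k) (sym (*-^-distrib s s k))
        expand : ∀ m d ε c → (m * d + ε) * c ≡ c * m * d + ε * c
        expand = solve-∀ ring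

open import Defs

theorem1p2 :
  (G : Graph) → 0 ℕ.< M G →
  (lam : ℝ) → IsSpectralRadius (adjacencyMatrix G) lam →
  Σ[ C ∈ ℕ ] 0 ℕ.< C ×
    InfinitelyMany⁺ (λ k → λ {{_}} →
      Σ[ F ∈ Subgraph (tensorPower G k) ]
      ∃[ d ] IsRegular F d ×
             lam ^ k * (k ^⁻ C) ≤ fromℕ d ×
             fromℕ d ≤ lam ^ k ×
             Mₛ F ℕ.≤ M G ℕ.^ k)
theorem1p2 G _ lam spectral =
  -- C = 4n is positive as G has a vertex. Given `N`, the exponent is 2(N + 1), even because of the
  -- swapped pairs of types.
  order G ℕ.* 4 , ℕ.*-mono-≤ (ℕ.>-nonZero⁻¹ (order G) {{nonempty G}}) (ℕ.s≤s {n = 3} ℕ.z≤n) , λ N →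
  let k = suc N
      F , Δ , regular , DD≤Δ = Combinatorics.TensorPower.regular-subgraph G k
  in k ℕ.+ k , ℕ.≤-trans (ℕ.n≤1+n N) (ℕ.m≤m+n k k) , _ ,
     F , Δ , regular ,
     Bounds.lam^*^⁻≤ G {lam} spectral k DD≤Δ ,
     Bounds.regular-degree≤lam^ G {lam} spectral (k ℕ.+ k) F regular ,
     Combinatorics.TensorPower.Mₛ≤M^K G (k ℕ.+ k) F
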